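{- Let $n\geq 4$ and let $G$ be a contracted $3$-regular colored graph with $n$ vertices. If $n=4m$ for some integer $m\ge 1$, then $G$ is $\mathcal{D}$-equivalent to $\mathcal{P}_{2m-1}$. If $n=4m+2$ for some integer $m\ge 1$, then $G$ is $\mathcal{D}$-equivalent to $\mathcal{P}_{2m}$ or to $\mathcal{T}_{m}$.
   Context: A $3$-regular colored graph is a pair $(\Gamma,\gamma)$ where $\Gamma$ is a loopless $3$-regular multigraph and $\gamma:E(\Gamma)\to\{0,1,2\}$ is a proper edge-coloring (adjacent edges get different colors); colored graphs are identified up to color-preserving isomorphism. For colors $i\neq j$, $\Gamma_{\{i,j\}}$ is the spanning subgraph with edges of colors $i,j$; $\Gamma$ is contracted if every $\Gamma_{\{i,j\}}$ is connected (i.e. a Hamiltonian cycle). Connected sum: for disjoint colored graphs $\Gamma^1,\Gamma^2$ (same color set) and vertices $v_1\in\Gamma^1$, $v_2\in\Gamma^2$, let $u_{j,i}$ be the neighbour of $v_i$ along the color-$j$ edge in $\Gamma^i$; $\Gamma^1\#_{v_1v_2}\Gamma^2$ is obtained from $(\Gamma^1-v_1)\sqcup(\Gamma^2-v_2)$ by adding, for each color $j$, an edge $u_{j,1}u_{j,2}$ of color $j$. A bipartite graph comes with a fixed bipartition into black and white vertices; two vertices are of the same type if both are black or both white. $\Gamma^1\#\Gamma^2$ denotes $\Gamma^1\#_{v_1v_2}\Gamma^2$ for arbitrary $v_1,v_2$, except that if both graphs are bipartite, $v_1,v_2$ must be of different types. If $\Gamma=\Gamma^1\#_{uv}\Gamma^2$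 and $\Gamma'=\Gamma^1\#_{u'v'}\Gamma^2$ (with the different-type requirement when both are bipartite) and $(u,v)\ne(u',v')$, then $\Gamma'$ is obtained from $\Gamma$ by interchanging the vertices of connected sums. Simple cut: let $\Gamma$ be a $3$-regular colored graph and $G,H$ disjoint $2$-regular colored graphs with colors $0,1$ such that $V(G)\cup V(H)=V(\Gamma)\cup\{z_1,z_2\}$, $z_1\in V(G)$, $z_2\in V(H)$, and $\Gamma_{\{0,1\}}=G\#_{z_1z_2}H$ (connected sum defined analogously with two colors). Let $\bar\Gamma$ be the $3$-regular colored graph with $\bar\Gamma_{\{0,1\}}=G\sqcup H$, with $z_1z_2$ an edge of color $2$, and in which two vertices $u,v\notin\{z_1,z_2\}$ are joined by a color-$2$ edge iff they are so joined in $\Gamma$. Then $\bar\Gamma$ is obtained from $\Gamma$ by a simple cut with chosen color $2$ and pair $(z_1,z_2)$; the reverse process is a simple glueing. $\Gamma'$ is obtained from $\Gamma$ by a simple cut-and-glue move if there is $\bar\Gamma$ obtained from $\Gamma$ by a simple cut (color $2$, some pair $(z_1,z_2)$) and from $\Gamma'$ by a simple cut (color $2$, some pair $(w_1,w_2)$). Two $3$-regular colored graphs are $\mathcal{D}$-equivalent if one is obtained from the other by a finite sequence of simple cut-and-glue moves and interchanges of vertices of connected sums. $\mathcal{P}_1$ is $K_4$ with a proper $3$-edge-coloring (the unique contracted $3$-regular colored graph on $4$ vertices). $\mathcal{T}_1$ is $K_{3,3}$ on vertices $v_1,\dots,v_6$ with color-$0$ edges $v_1v_2,v_3v_4,v_5v_6$,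 color-$1$ edges $v_2v_3,v_4v_5,v_6v_1$, color-$2$ edges $v_1v_4,v_2v_5,v_3v_6$. For $m\ge1$, $\mathcal{P}_m$ (resp. $\mathcal{T}_m$) denotes a connected sum $\#$ of $m$ copies of $\mathcal{P}_1$ (resp. $\mathcal{T}_1$). -}

module Defs where

open import Data.Nat using (ℕ; zero; suc; _+_)
open import Data.Fin using (Fin; zero; suc)
open import Data.Bool using (Bool)
open import Data.Product using (Σ; ∃; ∃-syntax; _×_; _,_)
open import Data.Sum using (_⊎_)
open import Relation.Nullary using (¬_)
open import Relation.Binary.PropositionalEquality using (_≡_; _≢_; refl)
open import Relation.Binary.Construct.Closure.ReflexiveTransitive using (Star)

Colour : Set
Colour = Fin 3

c0 c1 c2 : Colour
c0 = zero
c1 = suc zero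
c2 = suc (suc zero)

-- A 3-regular colored graph on the vertex set Fin size.
-- A loopless 3-regular multigraph with a proper 3-edge-colouring is the
-- same thing as three fixed-point-free involutions σ c (c = 0,1,2):
-- σ c x is the other endpoint of the unique colour-c edge at x.

record CGraph : Set where
  field
    size     : ℕ
    σ        : Colour → Fin size → Fin size
    invol    : ∀ c x → σ c (σ c x) ≡ x
    loopless : ∀ c x → σ c x ≢ x
open CGraph public

data Reach (Γ : CGraph) (i j : Colour) (x : Fin (size Γ)) : Fin (size Γ) → Set where
  here  : Reach Γ i j x x
  stepi : ∀ {y} → Reach Γ i j x y → Reach Γ i j x (σ Γ i y)
  stepj : ∀ {y} → Reach Γ i j x y → Reach Γ i j x (σ Γ j y)

Contracted : CGraph → Set
Contracted Γ = ∀ (i j : Colour) → i ≢ j → ∀ (x y : Fin (size Γ)) → Reach Γ i j x y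

IsBipartition : (Γ : CGraph) → (Fin (size Γ) → Bool) → Set
IsBipartition Γ β = ∀ c x → β (σ Γ c x) ≢ β x

Bipartite : CGraph → Set
Bipartite Γ = ∃[ β ] IsBipartition Γ β

-- Connected sum:  IsConnSum Γ Γ₁ Γ₂ v₁ v₂  means  Γ ≅ Γ₁ #_{v₁v₂} Γ₂.
-- f₁ (resp. f₂) identifies the vertices of Γ₁ - v₁ (resp. Γ₂ - v₂) with
-- vertices of Γ (values at v₁, v₂ are irrelevant); together they form a
-- bijection (Γ₁ - v₁) ⊔ (Γ₂ - v₂) → V(Γ) preserving coloured edges, where
-- the edges at u_{c,1} = σ₁ c v₁ and u_{c,2} = σ₂ c v₂ are joined.

record IsConnSum (Γ Γ₁ Γ₂ : CGraph) (v₁ : Fin (size Γ₁)) (v₂ : Fin (size Γ₂)) : Set where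
  field
    f₁    : Fin (size Γ₁) → Fin (size Γ)
    f₂    : Fin (size Γ₂) → Fin (size Γ)
    inj₁  : ∀ x y → x ≢ v₁ → y ≢ v₁ → f₁ x ≡ f₁ y → x ≡ y
    inj₂  : ∀ x y → x ≢ v₂ → y ≢ v₂ → f₂ x ≡ f₂ y → x ≡ y
    disj  : ∀ x y → x ≢ v₁ → y ≢ v₂ → f₁ x ≢ f₂ y
    surj  : ∀ z → (∃[ x ] (x ≢ v₁ × f₁ x ≡ z)) ⊎ (∃[ y ] (y ≢ v₂ × f₂ y ≡ z))
    edge₁ : ∀ c x → x ≢ v₁ → σ Γ₁ c x ≢ v₁ → σ Γ c (f₁ x) ≡ f₁ (σ Γ₁ c x)
    join₁ : ∀ c x → x ≢ v₁ → σ Γ₁ c x ≡ v₁ → σ Γ c (f₁ x) ≡ f₂ (σ Γ₂ c v₂)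
    edge₂ : ∀ c y → y ≢ v₂ → σ Γ₂ c y ≢ v₂ → σ Γ c (f₂ y) ≡ f₂ (σ Γ₂ c y)
    join₂ : ∀ c y → y ≢ v₂ → σ Γ₂ c y ≡ v₂ → σ Γ c (f₂ y) ≡ f₁ (σ Γ₁ c v₁)

ConnSum : CGraph → CGraph → CGraph → Set
ConnSum Γ Γ₁ Γ₂ =
  ∃[ v₁ ] ∃[ v₂ ] (IsConnSum Γ Γ₁ Γ₂ v₁ v₂ ×
    (Bipartite Γ₁ → Bipartite Γ₂ →
      ∃[ β₁ ] ∃[ β₂ ] (IsBipartition Γ₁ β₁ × IsBipartition Γ₂ β₂ × β₁ v₁ ≢ β₂ v₂)))

Interchange : CGraph → CGraph → Set
Interchange Γ Γ' =
  ∃[ Γ₁ ] ∃[ Γ₂ ] ∃[ u ] ∃[ v ] ∃[ u' ] ∃[ v' ]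
    (IsConnSum Γ Γ₁ Γ₂ u v × IsConnSum Γ' Γ₁ Γ₂ u' v' × ¬ (u ≡ u' × v ≡ v') ×
     (Bipartite Γ₁ → Bipartite Γ₂ →
       ∃[ β₁ ] ∃[ β₂ ] (IsBipartition Γ₁ β₁ × IsBipartition Γ₂ β₂ ×
                        β₁ u ≢ β₂ v × β₁ u' ≢ β₂ v')))

-- Simple cut:  SimpleCut Γ Γ̄ z₁ z₂  means Γ̄ is obtained from Γ by a simple
-- cut with chosen colour 2 and pair (z₁, z₂).  g identifies the vertices of
-- Γ̄ other than z₁, z₂ bijectively with V(Γ).  The predicate S is the vertex
-- set of G (its complement that of H), a union of components of Γ̄_{01}, so
-- that Γ̄_{01} = G ⊔ H; Γ_{01} = G #_{z₁z₂} H; z₁z₂ is a colour-2 edge; the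
-- other colour-2 edges agree with those of Γ.

record SimpleCut (Γ Γ̄ : CGraph) (z₁ z₂ : Fin (size Γ̄)) : Set where
  field
    S      : Fin (size Γ̄) → Bool
    S-closed : ∀ c x → c ≢ c2 → S (σ Γ̄ c x) ≡ S x
    S-z₁   : S z₁ ≡ Bool.true
    S-z₂   : S z₂ ≡ Bool.false
    z-edge : σ Γ̄ c2 z₁ ≡ z₂
    g      : Fin (size Γ̄) → Fin (size Γ)
    g-inj  : ∀ x y → x ≢ z₁ → x ≢ z₂ → y ≢ z₁ → y ≢ z₂ → g x ≡ g y → x ≡ y
    g-surj : ∀ w → ∃[ x ] (x ≢ z₁ × x ≢ z₂ × g x ≡ w)
    col2   : ∀ x → x ≢ z₁ → x ≢ z₂ → σ Γ c2 (g x) ≡ g (σ Γ̄ c2 x)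
    col01  : ∀ c x → c ≢ c2 → x ≢ z₁ → x ≢ z₂ →
               σ Γ̄ c x ≢ z₁ → σ Γ̄ c x ≢ z₂ → σ Γ c (g x) ≡ g (σ Γ̄ c x)
    join₁  : ∀ c x → c ≢ c2 → x ≢ z₁ → x ≢ z₂ →
               σ Γ̄ c x ≡ z₁ → σ Γ c (g x) ≡ g (σ Γ̄ c z₂)
    join₂  : ∀ c x → c ≢ c2 → x ≢ z₁ → x ≢ z₂ →
               σ Γ̄ c x ≡ z₂ → σ Γ c (g x) ≡ g (σ Γ̄ c z₁)

CutGlue : CGraph → CGraph → Set
CutGlue Γ Γ' = ∃[ Γ̄ ] ∃[ z₁ ] ∃[ z₂ ] ∃[ w₁ ] ∃[ w₂ ]
  (SimpleCut Γ Γ̄ z₁ z₂ × SimpleCut Γ' Γ̄ w₁ w₂)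

Move : CGraph → CGraph → Set
Move Γ Γ' = CutGlue Γ Γ' ⊎ Interchange Γ Γ'

DEquiv : CGraph → CGraph → Set
DEquiv = Star Move

record Iso (Γ Δ : CGraph) : Set where
  field
    to      : Fin (size Γ) → Fin (size Δ)
    from    : Fin (size Δ) → Fin (size Γ)
    from-to : ∀ x → from (to x) ≡ x
    to-from : ∀ y → to (from y) ≡ y
    hom     : ∀ c x → to (σ Γ c x) ≡ σ Δ c (to x)

K4-σ : Fin 3 → Fin 4 → Fin 4
K4-σ zero zero = (suc zero)
K4-σ zero (suc zero) = zero
K4-σ zero (suc (suc zero)) = (suc (suc (suc zero)))
K4-σ zero (suc (suc (suc zero))) = (suc (suc zero))
K4-σ (suc zero) zero = (suc (suc zero))
K4-σ (suc zero) (suc zero) = (suc (suc (suc zero)))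
K4-σ (suc zero) (suc (suc zero)) = zero
K4-σ (suc zero) (suc (suc (suc zero))) = (suc zero)
K4-σ (suc (suc zero)) zero = (suc (suc (suc zero)))
K4-σ (suc (suc zero)) (suc zero) = (suc (suc zero))
K4-σ (suc (suc zero)) (suc (suc zero)) = (suc zero)
K4-σ (suc (suc zero)) (suc (suc (suc zero))) = zero

K4-invol : ∀ c x → K4-σ c (K4-σ c x) ≡ x
K4-invol zero zero = refl
K4-invol zero (suc zero) = refl
K4-invol zero (suc (suc zero)) = refl
K4-invol zero (suc (suc (suc zero))) = refl
K4-invol (suc zero) zero = refl
K4-invol (suc zero) (suc zero) = refl
K4-invol (suc zero) (suc (suc zero)) = refl
K4-invol (suc zero) (suc (suc (suc zero))) = refl
K4-invol (suc (suc zero)) zero = refl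
K4-invol (suc (suc zero)) (suc zero) = refl
K4-invol (suc (suc zero)) (suc (suc zero)) = refl
K4-invol (suc (suc zero)) (suc (suc (suc zero))) = refl

K4-loopless : ∀ c x → K4-σ c x ≢ x
K4-loopless zero zero ()
K4-loopless zero (suc zero) ()
K4-loopless zero (suc (suc zero)) ()
K4-loopless zero (suc (suc (suc zero))) ()
K4-loopless (suc zero) zero ()
K4-loopless (suc zero) (suc zero) ()
K4-loopless (suc zero) (suc (suc zero)) ()
K4-loopless (suc zero) (suc (suc (suc zero))) ()
K4-loopless (suc (suc zero)) zero ()
K4-loopless (suc (suc zero)) (suc zero) ()
K4-loopless (suc (suc zero)) (suc (suc zero)) ()
K4-loopless (suc (suc zero)) (suc (suc (suc zero))) ()

K33-σ : Fin 3 → Fin 6 → Fin 6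
K33-σ zero zero = (suc zero)
K33-σ zero (suc zero) = zero
K33-σ zero (suc (suc zero)) = (suc (suc (suc zero)))
K33-σ zero (suc (suc (suc zero))) = (suc (suc zero))
K33-σ zero (suc (suc (suc (suc zero)))) = (suc (suc (suc (suc (suc zero)))))
K33-σ zero (suc (suc (suc (suc (suc zero))))) = (suc (suc (suc (suc zero))))
K33-σ (suc zero) zero = (suc (suc (suc (suc (suc zero)))))
K33-σ (suc zero) (suc zero) = (suc (suc zero))
K33-σ (suc zero) (suc (suc zero)) = (suc zero)
K33-σ (suc zero) (suc (suc (suc zero))) = (suc (suc (suc (suc zero))))
K33-σ (suc zero) (suc (suc (suc (suc zero)))) = (suc (suc (suc zero)))
K33-σ (suc zero) (suc (suc (suc (suc (suc zero))))) = zero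
K33-σ (suc (suc zero)) zero = (suc (suc (suc zero)))
K33-σ (suc (suc zero)) (suc zero) = (suc (suc (suc (suc zero))))
K33-σ (suc (suc zero)) (suc (suc zero)) = (suc (suc (suc (suc (suc zero)))))
K33-σ (suc (suc zero)) (suc (suc (suc zero))) = zero
K33-σ (suc (suc zero)) (suc (suc (suc (suc zero)))) = (suc zero)
K33-σ (suc (suc zero)) (suc (suc (suc (suc (suc zero))))) = (suc (suc zero))

K33-invol : ∀ c x → K33-σ c (K33-σ c x) ≡ x
K33-invol zero zero = refl
K33-invol zero (suc zero) = refl
K33-invol zero (suc (suc zero)) = refl
K33-invol zero (suc (suc (suc zero))) = refl
K33-invol zero (suc (suc (suc (suc zero)))) = refl
K33-invol zero (suc (suc (suc (suc (suc zero))))) = refl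
K33-invol (suc zero) zero = refl
K33-invol (suc zero) (suc zero) = refl
K33-invol (suc zero) (suc (suc zero)) = refl
K33-invol (suc zero) (suc (suc (suc zero))) = refl
K33-invol (suc zero) (suc (suc (suc (suc zero)))) = refl
K33-invol (suc zero) (suc (suc (suc (suc (suc zero))))) = refl
K33-invol (suc (suc zero)) zero = refl
K33-invol (suc (suc zero)) (suc zero) = refl
K33-invol (suc (suc zero)) (suc (suc zero)) = refl
K33-invol (suc (suc zero)) (suc (suc (suc zero))) = refl
K33-invol (suc (suc zero)) (suc (suc (suc (suc zero)))) = refl
K33-invol (suc (suc zero)) (suc (suc (suc (suc (suc zero))))) = refl

K33-loopless : ∀ c x → K33-σ c x ≢ x
K33-loopless zero zero ()
K33-loopless zero (suc zero) ()
K33-loopless zero (suc (suc zero)) ()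
K33-loopless zero (suc (suc (suc zero))) ()
K33-loopless zero (suc (suc (suc (suc zero)))) ()
K33-loopless zero (suc (suc (suc (suc (suc zero))))) ()
K33-loopless (suc zero) zero ()
K33-loopless (suc zero) (suc zero) ()
K33-loopless (suc zero) (suc (suc zero)) ()
K33-loopless (suc zero) (suc (suc (suc zero))) ()
K33-loopless (suc zero) (suc (suc (suc (suc zero)))) ()
K33-loopless (suc zero) (suc (suc (suc (suc (suc zero))))) ()
K33-loopless (suc (suc zero)) zero ()
K33-loopless (suc (suc zero)) (suc zero) ()
K33-loopless (suc (suc zero)) (suc (suc zero)) ()
K33-loopless (suc (suc zero)) (suc (suc (suc zero))) ()
K33-loopless (suc (suc zero)) (suc (suc (suc (suc zero)))) ()
K33-loopless (suc (suc zero)) (suc (suc (suc (suc (suc zero))))) ()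

𝒫₁ : CGraph
𝒫₁ = record { size = 4 ; σ = K4-σ ; invol = K4-invol ; loopless = K4-loopless }

𝒯₁ : CGraph
𝒯₁ = record { size = 6 ; σ = K33-σ ; invol = K33-invol ; loopless = K33-loopless }

data IsSumOf (B : CGraph) : ℕ → CGraph → Set where
  one : ∀ {Γ} → Iso B Γ → IsSumOf B 1 Γ
  sum : ∀ {a b Γ₁ Γ₂ Γ} → IsSumOf B a Γ₁ → IsSumOf B b Γ₂ →
        ConnSum Γ Γ₁ Γ₂ → IsSumOf B (a + b) Γ

DEquivToP : CGraph → ℕ → Set
DEquivToP Γ m = ∃[ Δ ] (IsSumOf 𝒫₁ m Δ × DEquiv Γ Δ)

DEquivToT : CGraph → ℕ → Set
DEquivToT Γ m = ∃[ Δ ] (IsSumOf 𝒯₁ m Δ × DEquiv Γ Δ)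

{-# OPTIONS --safe #-}
module Submission where

-- Γ_{0,1} is a Hamiltonian cycle, so Γ is a polygon whose sides are glued in
-- pairs by the chords of colour 2, and the classification of surfaces by
-- cutting and glueing polygons applies.
-- If some chord joins two positions of equal parity, a single cut-and-glue move
-- along it produces a triangle, i.e. Γ becomes 𝒫₁ # Γ₂ where Γ₂ is Γ with that
-- chord deleted.  Should Γ₂ be bipartite, repeating the move along the chord of
-- the crosscap's middle vertex gives a non-bipartite rest instead (Dyck's
-- theorem).  If Γ is bipartite, two moves along crossing chords produce 𝒯₁ # Γ₂.
-- The reduction continues inside Γ₂: after an interchange has moved the vertex
-- at which the finished summand X is attached away from the chords involved,
-- every cut-and-glue move of Γ₂ lifts to X # Γ₂.

open import Defs
open import Data.Bool using (Bool; true; false; not; _xor_)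
import Data.Bool.Properties as 𝔹
open import Data.Bool.Properties using (not-involutive; not-¬; ¬-not)
open import Data.Empty using (⊥; ⊥-elim)
open import Data.Fin using (Fin; zero; suc)
open import Data.Fin.Patterns using (0F; 1F; 2F; 3F; 4F; 5F)
import Data.Fin as Fin
import Data.Fin.Properties as Fin
open import Data.Nat using (ℕ; zero; suc; _+_; _*_; _∸_; _<_; _≤_; z≤n; s≤s; >-nonZero)
open import Data.Nat.Induction using (<-rec)
import Data.Nat.Properties as ℕ
open import Data.Nat.Solver using (module +-*-Solver)
open import Data.Product using (Σ; ∃; ∃-syntax; _×_; _,_; proj₁; proj₂)
open import Data.Sum using (_⊎_; inj₁; inj₂; [_,_]′)
open import Data.Sum.Properties using (inj₁-injective; inj₂-injective)
open import Function using (_∘_; case_of_; id)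
open import Relation.Binary.Construct.Closure.ReflexiveTransitive using (Star; ε; _◅_; _◅◅_)
open import Relation.Binary.Definitions using (DecidableEquality; tri<; tri≈; tri>)
open import Relation.Binary.PropositionalEquality
  using (_≡_; _≢_; _≗_; refl; sym; trans; cong; cong₂; subst; subst₂)
open import Relation.Nullary using (¬_; yes; no; contradiction; ¬?; does)
open import Relation.Nullary.Decidable using (_×-dec_; _⊎-dec_; map′; dec-true; dec-false)
open import Relation.Unary using (Decidable)

-- Smoothings and connected sums

-- The basic surgery deletes two vertices and joins their loose ends: connected sums, simple
-- glueings and the deletion of a chord with its ends are all of this kind. Two such operations at
-- disjoint pairs commute, and this one fact yields associativity of sums, the lifting of moves to
-- sums, and the comparison of a crosscap with the chord it replaces. The obstacle is the type
-- condition on interchanges, which bites only when both summands are bipartite. In the bipartite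
-- case explicit colourings of the finished part, of the rest and of the intermediate cut graphs are
-- carried along. Otherwise the finished part contains a triangle and the condition is vacuous; but
-- then the rest must keep supplying chords between equal parities, which a bipartite rest cannot
-- do. Each round shrinks the rest by |B| - 2 vertices, where B is 𝒫₁ or 𝒯₁. It ends at the graph on
-- two vertices, which is neutral for connected sums, so `size` determines the number of summands.

record Graph : Set₁ where
  field
    -- An arbitrary vertex type lets a disjoint union be a literal sum type, open to pattern
    -- matching. `code` and `decode` supply decidable equality and the enumeration by which a
    -- `CGraph` is recovered.
    V           : Set
    card        : ℕ
    code        : V → Fin card
    decode      : Fin card → V
    decode-code : ∀ v → decode (code v) ≡ v
    code-decode : ∀ i → code (decode i) ≡ i
    ς           : Colour → V → V
    ς-invol     : ∀ c x → ς c (ς c x) ≡ x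
    ς-loopless  : ∀ c x → ς c x ≢ x

  _≟_ : DecidableEquality V
  x ≟ y with code x Fin.≟ code y
  ... | yes p = yes (trans (sym (decode-code x)) (trans (cong decode p) (decode-code y)))
  ... | no ¬p = no (¬p ∘ cong code)

  ς-flip : ∀ {c x y} → ς c x ≡ y → ς c y ≡ x
  ς-flip refl = ς-invol _ _

  ς-injective : ∀ {c x y} → ς c x ≡ ς c y → x ≡ y
  ς-injective {c} {x} p = trans (sym (ς-invol c x)) (ς-flip (sym p))

open Graph

⌊_⌋ : CGraph → Graph
⌊ Γ ⌋ = record
  { V = Fin (size Γ); card = size Γ
  ; code = λ v → v; decode = λ v → v; decode-code = λ _ → refl; code-decode = λ _ → refl
  ; ς = σ Γ; ς-invol = invol Γ; ς-loopless = loopless Γ }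

infixr 5 _⊔_
_⊔_ : Graph → Graph → Graph
Ω ⊔ Ξ = record
  { V = V Ω ⊎ V Ξ; card = card Ω + card Ξ
  ; code = λ v → Fin.join _ _ ([ inj₁ ∘ code Ω , inj₂ ∘ code Ξ ]′ v)
  ; decode = λ i → [ inj₁ ∘ decode Ω , inj₂ ∘ decode Ξ ]′ (Fin.splitAt (card Ω) i)
  ; decode-code = dc; code-decode = cd
  ; ς = λ c → [ inj₁ ∘ ς Ω c , inj₂ ∘ ς Ξ c ]′
  ; ς-invol = λ { c (inj₁ x) → cong inj₁ (ς-invol Ω c x) ; c (inj₂ x) → cong inj₂ (ς-invol Ξ c x) }
  ; ς-loopless = λ { c (inj₁ x) → ς-loopless Ω c x ∘ inj₁-injective
                   ; c (inj₂ x) → ς-loopless Ξ c x ∘ inj₂-injective } }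
  where
  dc : ∀ v → [ inj₁ ∘ decode Ω , inj₂ ∘ decode Ξ ]′
               (Fin.splitAt (card Ω) (Fin.join _ _ ([ inj₁ ∘ code Ω , inj₂ ∘ code Ξ ]′ v))) ≡ v
  dc (inj₁ x) rewrite Fin.splitAt-join (card Ω) (card Ξ) (inj₁ (code Ω x)) = cong inj₁ (decode-code Ω x)
  dc (inj₂ x) rewrite Fin.splitAt-join (card Ω) (card Ξ) (inj₂ (code Ξ x)) = cong inj₂ (decode-code Ξ x)
  cd : ∀ i → Fin.join _ _ ([ inj₁ ∘ code Ω , inj₂ ∘ code Ξ ]′
               ([ inj₁ ∘ decode Ω , inj₂ ∘ decode Ξ ]′ (Fin.splitAt (card Ω) i))) ≡ i
  cd i with Fin.splitAt (card Ω) i in eq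
  ... | inj₁ x rewrite code-decode Ω x = Fin.splitAt⁻¹-↑ˡ eq
  ... | inj₂ x rewrite code-decode Ξ x = Fin.splitAt⁻¹-↑ʳ {i = i} eq

-- A deleted pair is a function on `Bool`, so that `not` names the other member and both ends of a
-- join are treated at once.
Off : {A : Set} → (Bool → A) → A → Set
Off a x = ∀ i → x ≢ a i

⟪_,_⟫ : {A : Set} → A → A → Bool → A
⟪ x , y ⟫ true  = x
⟪ x , y ⟫ false = y

off-⟪⟫ : {A : Set} {x y z : A} → z ≢ x → z ≢ y → Off ⟪ x , y ⟫ z
off-⟪⟫ p q true  = p
off-⟪⟫ p q false = q

locate : (Ω : Graph) (a : Bool → V Ω) (x : V Ω) → (∃[ i ] x ≡ a i) ⊎ Off a x
locate Ω a x with _≟_ Ω x (a true) | _≟_ Ω x (a false)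
... | yes p | _     = inj₁ (true , p)
... | no _  | yes p = inj₁ (false , p)
... | no p  | no q  = inj₂ λ { true → p ; false → q }

pair-injective : {A : Set} (a : Bool → A) → a true ≢ a false → ∀ i j → a i ≡ a j → i ≡ j
pair-injective a a≢ true  true  p = refl
pair-injective a a≢ true  false p = contradiction p a≢
pair-injective a a≢ false true  p = contradiction (sym p) a≢
pair-injective a a≢ false false p = refl

-- If the continuation from `a (not i)` ended at `a i`, injectivity would give `x ≡ a (not i)`; if
-- it ended at `a (not i)`, that would be a loop. Hence a joined edge never passes through the pair
-- twice.
ς-partner-off : (Ω : Graph) {a : Bool → V Ω} → a true ≢ a false → ∀ {c i x} →
                Off a x → ς Ω c x ≡ a i → Off a (ς Ω c (a (not i)))
ς-partner-off Ω {a} a≢ {c} {i} {x} x∉ p j q with i 𝔹.≟ j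
... | yes refl = x∉ (not i) (ς-injective Ω (trans p (sym q)))
... | no i≢j rewrite ¬-not i≢j = ς-loopless Ω c (a (not (not j))) (trans q (cong a (sym (not-involutive j))))

-- Γ arises from Ω by deleting the two vertices a true, a false and joining,
-- for each colour, the two loose ends.  Connected sums are smoothings of
-- disjoint unions, and undoing a simple cut is a smoothing as well.
record Smoothing (Ω : Graph) (a : Bool → V Ω) (Γ : Graph) : Set where
  field
    distinct : a true ≢ a false
    g        : V Ω → V Γ
    g-inj    : ∀ {x y} → Off a x → Off a y → g x ≡ g y → x ≡ y
    lift     : V Γ → V Ω
    lift-off : ∀ w → Off a (lift w)
    g-lift   : ∀ w → g (lift w) ≡ w
    edge     : ∀ c {x} → Off a x → Off a (ς Ω c x) → ς Γ c (g x) ≡ g (ς Ω c x)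
    join     : ∀ c i {x} → Off a x → ς Ω c x ≡ a i → ς Γ c (g x) ≡ g (ς Ω c (a (not i)))

  lift-g : ∀ {x} → Off a x → lift (g x) ≡ x
  lift-g x∉ = g-inj (lift-off _) x∉ (g-lift _)

  a-inj : ∀ i j → a i ≡ a j → i ≡ j
  a-inj = pair-injective a distinct

  joined-off : ∀ {c i x} → Off a x → ς Ω c x ≡ a i → Off a (ς Ω c (a (not i)))
  joined-off = ς-partner-off Ω distinct

  elim : (Q : V Γ → Set) → (∀ x → Off a x → Q (g x)) → ∀ w → Q w
  elim Q f w = subst Q (g-lift w) (f (lift w) (lift-off w))

open Smoothing

-- Replaces function extensionality: pairs obtained along different routes agree only pointwise.
smoothing-≗ : ∀ {Ω a b Γ} → a ≗ b → Smoothing Ω a Γ → Smoothing Ω b Γ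
smoothing-≗ {Ω} {a} {b} a≗b s = record
  { distinct = λ p → distinct s (trans (a≗b true) (trans p (sym (a≗b false))))
  ; g = g s
  ; g-inj = λ x∉ y∉ → g-inj s (back x∉) (back y∉)
  ; lift = lift s
  ; lift-off = λ w i p → lift-off s w i (trans p (sym (a≗b i)))
  ; g-lift = g-lift s
  ; edge = λ c x∉ y∉ → edge s c (back x∉) (back y∉)
  ; join = λ c i x∉ p → trans (join s c i (back x∉) (trans p (sym (a≗b i))))
                              (cong (g s ∘ ς Ω c) (a≗b (not i))) }
  where
  back : ∀ {x} → Off b x → Off a x
  back x∉ i p = x∉ i (trans p (a≗b i))

module _ {Ω Γ₁ Γ₂ Γ : Graph} {a b : Bool → V Ω}
         (s₁ : Smoothing Ω a Γ₁) (s₂ : Smoothing Ω b Γ₂) (b∉a : ∀ i → Off a (b i))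
         (t : Smoothing Γ₁ (g s₁ ∘ b) Γ) where
  private
    k : V Ω → V Γ
    k = g t ∘ g s₁

    m : V Γ₂ → V Γ
    m = k ∘ lift s₂

    m-g : ∀ {x} → Off b x → m (g s₂ x) ≡ k x
    m-g x∉ = cong k (lift-g s₂ x∉)

    off₁ : ∀ {x} → Off a x → Off b x → Off (g s₁ ∘ b) (g s₁ x)
    off₁ x∉a x∉b i p = x∉b i (g-inj s₁ x∉a (b∉a i) p)

    lift-a : ∀ {w} → Off (g s₂ ∘ a) w → Off a (lift s₂ w)
    lift-a w∉ i p = w∉ i (trans (sym (g-lift s₂ _)) (cong (g s₂) p))

    a∉b : ∀ i → Off b (a i)
    a∉b i j p = b∉a j i (sym p)

    k-edge : ∀ c {x} → Off a x → Off b x → Off a (ς Ω c x) → Off b (ς Ω c x) →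
             ς Γ c (k x) ≡ k (ς Ω c x)
    k-edge c x∉a x∉b y∉a y∉b with e ← edge s₁ c x∉a y∉a =
      trans (edge t c (off₁ x∉a x∉b) (subst (Off _) (sym e) (off₁ y∉a y∉b))) (cong (g t) e)

    k-a : ∀ c i {x} → Off a x → Off b x → ς Ω c x ≡ a i → Off b (ς Ω c (a (not i))) →
          ς Γ c (k x) ≡ k (ς Ω c (a (not i)))
    k-a c i x∉a x∉b p y∉b with e ← join s₁ c i x∉a p =
      trans (edge t c (off₁ x∉a x∉b) (subst (Off _) (sym e) (off₁ (joined-off s₁ x∉a p) y∉b)))
            (cong (g t) e)

    -- The delicate case: the edge from `x` enters the first pair at `a i`, and its continuation
    -- enters the second at `b j`. It must then stop, since a return to the first pair would force
    -- `x ≡ b (not j)` or `b j ≡ b (not j)`.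
    k-ab : ∀ c i j {x} → Off a x → Off b x → ς Ω c x ≡ a i → ς Ω c (a (not i)) ≡ b j →
           ς Γ c (k x) ≡ k (ς Ω c (b (not j)))
    k-ab c i j {x} x∉a x∉b p q =
      trans (join t c j (off₁ x∉a x∉b) (trans (join s₁ c i x∉a p) (cong (g s₁) q)))
            (cong (g t) (edge s₁ c (b∉a (not j)) y∉a))
      where
      y∉a : Off a (ς Ω c (b (not j)))
      y∉a l r with i 𝔹.≟ l
      ... | yes refl = x∉b (not j) (ς-injective Ω (trans p (sym r)))
      ... | no i≢l with refl ← ¬-not i≢l =
        not-¬ {j} refl (sym (pair-injective b (distinct s₂) (not j) j
          (trans (sym (ς-flip Ω r)) (trans (cong (ς Ω c ∘ a) (sym (not-involutive l))) q))))

    k-b : ∀ c i {x} → Off a x → Off b x → ς Ω c x ≡ b i → Off a (ς Ω c (b (not i))) →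
          ς Γ c (k x) ≡ k (ς Ω c (b (not i)))
    k-b c i x∉a x∉b p y∉a =
      trans (join t c i (off₁ x∉a x∉b) (trans (edge s₁ c x∉a (subst (Off a) (sym p) (b∉a i))) (cong (g s₁) p)))
            (cong (g t) (edge s₁ c (b∉a (not i)) y∉a))

    k-ba : ∀ c i j {x} → Off a x → Off b x → ς Ω c x ≡ b i → ς Ω c (b (not i)) ≡ a j →
           ς Γ c (k x) ≡ k (ς Ω c (a (not j)))
    k-ba c i j x∉a x∉b p q =
      trans (join t c i (off₁ x∉a x∉b) (trans (edge s₁ c x∉a (subst (Off a) (sym p) (b∉a i))) (cong (g s₁) p)))
            (cong (g t) (join s₁ c j (b∉a (not i)) q))

    m-edge : ∀ c x → Off a x → Off b x → Off (g s₂ ∘ a) (ς Γ₂ c (g s₂ x)) →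
             ς Γ c (k x) ≡ m (ς Γ₂ c (g s₂ x))
    m-edge c x x∉a x∉b y∉ with locate Ω b (ς Ω c x)
    ... | inj₁ (i , p) = trans (k-b c i x∉a x∉b p z∉)
                               (sym (trans (cong m e) (m-g (joined-off s₂ x∉b p))))
      where
      e = join s₂ c i x∉b p
      z∉ : Off a (ς Ω c (b (not i)))
      z∉ j q = y∉ j (trans e (cong (g s₂) q))
    ... | inj₂ z∉b = trans (k-edge c x∉a x∉b z∉ z∉b) (sym (trans (cong m e) (m-g z∉b)))
      where
      e = edge s₂ c x∉b z∉b
      z∉ : Off a (ς Ω c x)
      z∉ j q = y∉ j (trans e (cong (g s₂) q))

    m-join : ∀ c i x → Off a x → Off b x → ς Γ₂ c (g s₂ x) ≡ g s₂ (a i) →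
             ς Γ c (k x) ≡ m (ς Γ₂ c (g s₂ (a (not i))))
    m-join c i x x∉a x∉b p with locate Ω b (ς Ω c x)
    ... | inj₁ (j , q) =
      trans (k-ba c j i x∉a x∉b q e)
            (sym (trans (cong m (edge s₂ c (a∉b (not i)) y∉b)) (m-g y∉b)))
      where
      e : ς Ω c (b (not j)) ≡ a i
      e = g-inj s₂ (joined-off s₂ x∉b q) (a∉b i) (trans (sym (join s₂ c j x∉b q)) p)
      y∉b : Off b (ς Ω c (a (not i)))
      y∉b l r with j 𝔹.≟ l
      ... | yes refl = x∉a (not i) (ς-injective Ω (trans q (sym r)))
      ... | no j≢l with refl ← ¬-not j≢l =
        not-¬ {i} refl (sym (a-inj s₁ (not i) i
          (trans (sym (ς-flip Ω r)) (trans (cong (ς Ω c ∘ b) (sym (not-involutive l))) e))))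
    ... | inj₂ z∉b with e ← g-inj s₂ z∉b (a∉b i) (trans (sym (edge s₂ c x∉b z∉b)) p)
      with locate Ω b (ς Ω c (a (not i)))
    ... | inj₁ (j , q) =
      trans (k-ab c i j x∉a x∉b e q)
            (sym (trans (cong m (join s₂ c j (a∉b (not i)) q)) (m-g (joined-off s₂ (a∉b (not i)) q))))
    ... | inj₂ y∉b =
      trans (k-a c i x∉a x∉b e y∉b)
            (sym (trans (cong m (edge s₂ c (a∉b (not i)) y∉b)) (m-g y∉b)))

  opaque
    -- In either order an edge is followed through whichever deleted vertices it meets, at most one
    -- passage through each pair, and ends at the same vertex. The cases `k-edge`, `k-a`, `k-b`,
    -- `k-ab`, `k-ba` record which pairs are met and in which order.
    smoothing-comm : Smoothing Γ₂ (g s₂ ∘ a) Γ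
    smoothing-comm = record
      { distinct = λ p → distinct s₁ (g-inj s₂ (a∉b true) (a∉b false) p)
      ; g = m
      ; g-inj = λ {x} {y} x∉ y∉ p →
          trans (sym (g-lift s₂ x)) (trans (cong (g s₂)
            (g-inj s₁ (lift-a x∉) (lift-a y∉)
              (g-inj t (off₁ (lift-a x∉) (lift-off s₂ x)) (off₁ (lift-a y∉) (lift-off s₂ y)) p)))
            (g-lift s₂ y))
      ; lift = g s₂ ∘ lift s₁ ∘ lift t
      ; lift-off = λ w i p → lift-off s₁ (lift t w) i (g-inj s₂ (off₂ w) (a∉b i) p)
      ; g-lift = λ w → trans (m-g (off₂ w)) (trans (cong (g t) (g-lift s₁ _)) (g-lift t w))
      ; edge = λ c {x} x∉ y∉ →
          subst (λ v → Off (g s₂ ∘ a) (ς Γ₂ c v) → ς Γ c (m x) ≡ m (ς Γ₂ c v)) (g-lift s₂ x)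
            (m-edge c (lift s₂ x) (lift-a x∉) (lift-off s₂ x)) y∉
      ; join = λ c i {x} x∉ p →
          m-join c i (lift s₂ x) (lift-a x∉) (lift-off s₂ x) (trans (cong (ς Γ₂ c) (g-lift s₂ x)) p) }
      where
      off₂ : ∀ w → Off b (lift s₁ (lift t w))
      off₂ w i p = lift-off t w i (trans (sym (g-lift s₁ _)) (cong (g s₁) p))

record Enumeration {k} (K : Fin k → Set) : Set where
  field
    count   : ℕ
    elem    : Fin count → Fin k
    elem-K  : ∀ i → K (elem i)
    elem-inj : ∀ {i j} → elem i ≡ elem j → i ≡ j
    index   : ∀ v → K v → ∃[ i ] elem i ≡ v

enumerate : ∀ {k} {K : Fin k → Set} → Decidable K → Enumeration K
enumerate {zero} K? = record
  { count = 0; elem = λ (); elem-K = λ (); elem-inj = λ {}; index = λ () }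
enumerate {suc k} K? with enumerate (K? ∘ suc) | K? zero
... | E | yes k₀ = record
  { count = suc count
  ; elem = λ { zero → zero ; (suc i) → suc (elem i) }
  ; elem-K = λ { zero → k₀ ; (suc i) → elem-K i }
  ; elem-inj = λ { {zero} {zero} _ → refl
                 ; {suc i} {suc j} p → cong suc (elem-inj (Fin.suc-injective p)) }
  ; index = λ { zero _ → zero , refl
              ; (suc v) kv → let i , p = index v kv in suc i , cong suc p } }
  where open Enumeration E
... | E | no ¬k₀ = record
  { count = count
  ; elem = suc ∘ elem
  ; elem-K = elem-K
  ; elem-inj = elem-inj ∘ Fin.suc-injective
  ; index = λ { zero k₀ → contradiction k₀ ¬k₀
              ; (suc v) kv → let i , p = index v kv in i , cong suc p } }
  where open Enumeration E

-- Common source of the graphs built on a subset of vertices: `s` rewires the edges that leave K,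
-- around a deleted pair in `smooth` and into the collapsed vertex in `collapse`.
record Restriction (Ω : Graph) (K : V Ω → Set) (s : Colour → V Ω → V Ω) : Set where
  field
    Γ       : CGraph
    pro     : V Ω → Fin (size Γ)
    emb     : Fin (size Γ) → V Ω
    emb-K   : ∀ i → K (emb i)
    pro-emb : ∀ i → pro (emb i) ≡ i
    emb-pro : ∀ {v} → K v → emb (pro v) ≡ v
    σ-pro   : ∀ c {v} → K v → σ Γ c (pro v) ≡ pro (s c v)

restrict : (Ω : Graph) {K : V Ω → Set} (K? : Decidable K) (s : Colour → V Ω → V Ω) →
           (∀ c {v} → K v → K (s c v)) → (∀ c {v} → K v → s c (s c v) ≡ v) →
           (∀ c {v} → K v → s c v ≢ v) → ∃ K → Restriction Ω K s
restrict Ω {K} K? s s-K s-invol s-loopless (d , dK) = record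
  { Γ = record
    { size = count
    ; σ = λ c → pro ∘ s c ∘ emb
    ; invol = λ c i → trans (cong (pro ∘ s c) (emb-pro (s-K c (emb-K i))))
                            (trans (cong pro (s-invol c (emb-K i))) (pro-emb i))
    ; loopless = λ c i p → s-loopless c (emb-K i)
        (trans (sym (emb-pro (s-K c (emb-K i)))) (cong emb p)) }
  ; pro = pro; emb = emb; emb-K = emb-K; pro-emb = pro-emb; emb-pro = emb-pro
  ; σ-pro = λ c kv → cong (pro ∘ s c) (emb-pro kv) }
  where
  open Enumeration (enumerate {K = K ∘ decode Ω} (K? ∘ decode Ω))

  emb : Fin count → V Ω
  emb = decode Ω ∘ elem

  emb-K : ∀ i → K (emb i)
  emb-K = elem-K

  find : ∀ {v} → K v → ∃[ i ] emb i ≡ v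
  find {v} kv with i , p ← index (code Ω v) (subst K (sym (decode-code Ω v)) kv) =
    i , trans (cong (decode Ω) p) (decode-code Ω v)

  pro : V Ω → Fin count
  pro v with K? v
  ... | yes kv = proj₁ (find kv)
  -- A default value outside K; the witness of `∃ K` makes `pro` total.
  ... | no _   = proj₁ (find dK)

  emb-pro : ∀ {v} → K v → emb (pro v) ≡ v
  emb-pro {v} kv with K? v
  ... | yes kv′ = proj₂ (find kv′)
  ... | no ¬kv  = contradiction kv ¬kv

  pro-emb : ∀ i → pro (emb i) ≡ i
  pro-emb i = elem-inj (trans (sym (code-decode Ω _))
    (trans (cong (code Ω) (emb-pro (emb-K i))) (code-decode Ω _)))

off? : (Ω : Graph) (a : Bool → V Ω) → Decidable (Off a)
off? Ω a x = map′ (λ (p , q) → λ { true → p ; false → q }) (λ h → h true , h false)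
                  (¬? (_≟_ Ω x (a true)) ×-dec ¬? (_≟_ Ω x (a false)))

opaque
  -- One jump suffices: by `ς-partner-off` an edge that enters at `a i` leaves from `a (not i)`
  -- towards a survivor. The way back enters at `a (not i)` and leaves from `a i`, so the rewired
  -- `s` is again an involution.
  smooth : (Ω : Graph) (a : Bool → V Ω) → a true ≢ a false → ∃ (Off a) →
           ∃[ Γ ] Smoothing Ω a ⌊ Γ ⌋
  smooth Ω a a≢ d = Γ , record
    { distinct = a≢
    ; g = pro
    ; g-inj = λ x∉ y∉ p → trans (sym (emb-pro x∉)) (trans (cong emb p) (emb-pro y∉))
    ; lift = emb
    ; lift-off = emb-K
    ; g-lift = pro-emb
    ; edge = λ c x∉ y∉ → trans (σ-pro c x∉) (cong pro (s-edge y∉))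
    ; join = λ c i x∉ p → trans (σ-pro c x∉) (cong pro (s-join p)) }
    where
    s : Colour → V Ω → V Ω
    s c x with locate Ω a (ς Ω c x)
    ... | inj₁ (i , _) = ς Ω c (a (not i))
    ... | inj₂ _       = ς Ω c x

    s-edge : ∀ {c x} → Off a (ς Ω c x) → s c x ≡ ς Ω c x
    s-edge {c} {x} y∉ with locate Ω a (ς Ω c x)
    ... | inj₁ (i , p) = contradiction p (y∉ i)
    ... | inj₂ _       = refl

    s-join : ∀ {c i x} → ς Ω c x ≡ a i → s c x ≡ ς Ω c (a (not i))
    s-join {c} {i} {x} p with locate Ω a (ς Ω c x)
    ... | inj₁ (j , q) = cong (ς Ω c ∘ a ∘ not) (pair-injective a a≢ j i (trans (sym q) p))
    ... | inj₂ y∉      = contradiction p (y∉ i)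

    s-off : ∀ c {x} → Off a x → Off a (s c x)
    s-off c {x} x∉ with locate Ω a (ς Ω c x)
    ... | inj₁ (i , p) = ς-partner-off Ω a≢ x∉ p
    ... | inj₂ y∉      = y∉

    s-invol : ∀ c {x} → Off a x → s c (s c x) ≡ x
    s-invol c {x} x∉ = case locate Ω a (ς Ω c x) of λ
      { (inj₁ (i , p)) → trans (cong (s c) (s-join p))
          (trans (s-join (ς-invol Ω c _)) (trans (cong (ς Ω c ∘ a) (not-involutive i)) (ς-flip Ω p)))
      ; (inj₂ y∉) → trans (cong (s c) (s-edge y∉))
          (trans (s-edge (subst (Off a) (sym (ς-invol Ω c x)) x∉)) (ς-invol Ω c x)) }

    s-loopless : ∀ c {x} → Off a x → s c x ≢ x
    s-loopless c {x} x∉ q = case locate Ω a (ς Ω c x) of λ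
      { (inj₁ (i , p)) → not-¬ {i} refl (sym (pair-injective a a≢ (not i) i
          (trans (sym (ς-flip Ω (trans (sym (s-join p)) q))) p)))
      ; (inj₂ y∉) → ς-loopless Ω c x (trans (sym (s-edge y∉)) q) }

    open Restriction (restrict Ω (off? Ω a) s s-off s-invol s-loopless d)

smoothing-⊔ʳ : (Ξ : Graph) {Ω Γ : Graph} {a : Bool → V Ω} →
               Smoothing Ω a Γ → Smoothing (Ξ ⊔ Ω) (inj₂ ∘ a) (Ξ ⊔ Γ)
smoothing-⊔ʳ Ξ {Ω} {Γ} {a} s = record
  { distinct = distinct s ∘ inj₂-injective
  ; g = g′
  ; g-inj = λ { {inj₁ x} {inj₁ y} _ _ p → cong inj₁ (inj₁-injective p)
              ; {inj₁ x} {inj₂ y} _ _ ()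
              ; {inj₂ x} {inj₁ y} _ _ ()
              ; {inj₂ x} {inj₂ y} x∉ y∉ p → cong inj₂ (g-inj s (off x∉) (off y∉) (inj₂-injective p)) }
  ; lift = [ inj₁ , inj₂ ∘ lift s ]′
  ; lift-off = λ { (inj₁ x) i () ; (inj₂ x) i p → lift-off s x i (inj₂-injective p) }
  ; g-lift = λ { (inj₁ x) → refl ; (inj₂ x) → cong inj₂ (g-lift s x) }
  ; edge = λ { c {inj₁ x} _ _ → refl ; c {inj₂ x} x∉ y∉ → cong inj₂ (edge s c (off x∉) (off y∉)) }
  ; join = λ { c i {inj₁ x} _ () ; c i {inj₂ x} x∉ p → cong inj₂ (join s c i (off x∉) (inj₂-injective p)) } }
  where
  g′ : V Ξ ⊎ V Ω → V Ξ ⊎ V Γ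
  g′ = [ inj₁ , inj₂ ∘ g s ]′
  off : ∀ {x} → Off (inj₂ ∘ a) (inj₂ {A = V Ξ} x) → Off a x
  off x∉ i p = x∉ i (cong inj₂ p)

-- The union is bracketed as Ω ⊔ (Ξ ⊔ Ψ), the shape that `smoothing-⊔ʳ` also produces, so that
-- `sum-assoc` can commute the two.
smoothing-⊔ˡ : (Ψ : Graph) {Ω Ξ Γ : Graph} {a : Bool → V Ω ⊎ V Ξ} → Smoothing (Ω ⊔ Ξ) a Γ →
               Smoothing (Ω ⊔ (Ξ ⊔ Ψ)) ([ inj₁ , inj₂ ∘ inj₁ ]′ ∘ a) (Γ ⊔ Ψ)
smoothing-⊔ˡ Ψ {Ω} {Ξ} {Γ} {a} s = record
  { distinct = distinct s ∘ α-inj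
  ; g = g′
  ; g-inj = λ {x} {y} x∉ y∉ → g′-inj x y x∉ y∉
  ; lift = [ α ∘ lift s , inj₂ ∘ inj₂ ]′
  ; lift-off = λ { (inj₁ w) i p → lift-off s w i (α-inj p)
                 ; (inj₂ y) i p → Ψ∉α (a i) p }
  ; g-lift = λ { (inj₁ w) → trans (g′-α (lift s w)) (cong inj₁ (g-lift s w)) ; (inj₂ y) → refl }
  ; edge = λ c {x} → edge′ c x
  ; join = λ c i {x} → join′ c i x }
  where
  α : V Ω ⊎ V Ξ → V Ω ⊎ (V Ξ ⊎ V Ψ)
  α = [ inj₁ , inj₂ ∘ inj₁ ]′

  α-inj : ∀ {x y} → α x ≡ α y → x ≡ y
  α-inj {inj₁ x} {inj₁ .x} refl = refl
  α-inj {inj₁ x} {inj₂ y} ()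
  α-inj {inj₂ x} {inj₁ y} ()
  α-inj {inj₂ x} {inj₂ .x} refl = refl

  Ψ∉α : ∀ x {y} → inj₂ (inj₂ y) ≢ α x
  Ψ∉α (inj₁ x) ()
  Ψ∉α (inj₂ x) ()

  g′ : V Ω ⊎ (V Ξ ⊎ V Ψ) → V Γ ⊎ V Ψ
  g′ (inj₁ x)        = inj₁ (g s (inj₁ x))
  g′ (inj₂ (inj₁ x)) = inj₁ (g s (inj₂ x))
  g′ (inj₂ (inj₂ y)) = inj₂ y

  g′-α : ∀ x → g′ (α x) ≡ inj₁ (g s x)
  g′-α (inj₁ x) = refl
  g′-α (inj₂ x) = refl

  α-ς : ∀ c x → ς (Ω ⊔ (Ξ ⊔ Ψ)) c (α x) ≡ α (ς (Ω ⊔ Ξ) c x)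
  α-ς c (inj₁ x) = refl
  α-ς c (inj₂ x) = refl

  off : ∀ {x} → Off (α ∘ a) (α x) → Off a x
  off x∉ i p = x∉ i (cong α p)

  view : ∀ v → (∃[ x ] v ≡ α x) ⊎ (∃[ y ] v ≡ inj₂ (inj₂ y))
  view (inj₁ x) = inj₁ (inj₁ x , refl)
  view (inj₂ (inj₁ x)) = inj₁ (inj₂ x , refl)
  view (inj₂ (inj₂ y)) = inj₂ (y , refl)

  g′-inj : ∀ x y → Off (α ∘ a) x → Off (α ∘ a) y → g′ x ≡ g′ y → x ≡ y
  g′-inj x y x∉ y∉ p with view x | view y
  ... | inj₁ (x , refl) | inj₁ (y , refl) rewrite g′-α x | g′-α y =
    cong α (g-inj s (off x∉) (off y∉) (inj₁-injective p))
  ... | inj₁ (x , refl) | inj₂ (y , refl) rewrite g′-α x = case p of λ ()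
  ... | inj₂ (x , refl) | inj₁ (y , refl) rewrite g′-α y = case p of λ ()
  ... | inj₂ (x , refl) | inj₂ (y , refl) = cong (inj₂ ∘ inj₂) (inj₂-injective p)

  edge′ : ∀ c x → Off (α ∘ a) x → Off (α ∘ a) (ς (Ω ⊔ (Ξ ⊔ Ψ)) c x) →
          ς (Γ ⊔ Ψ) c (g′ x) ≡ g′ (ς (Ω ⊔ (Ξ ⊔ Ψ)) c x)
  edge′ c x x∉ y∉ with view x
  ... | inj₁ (x , refl) rewrite g′-α x | α-ς c x | g′-α (ς (Ω ⊔ Ξ) c x) =
    cong inj₁ (edge s c (off x∉) (off y∉))
  ... | inj₂ (y , refl) = refl

  join′ : ∀ c i x → Off (α ∘ a) x → ς (Ω ⊔ (Ξ ⊔ Ψ)) c x ≡ α (a i) →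
          ς (Γ ⊔ Ψ) c (g′ x) ≡ g′ (ς (Ω ⊔ (Ξ ⊔ Ψ)) c (α (a (not i))))
  join′ c i x x∉ p with view x
  ... | inj₁ (x , refl) rewrite g′-α x | α-ς c x | α-ς c (a (not i)) | g′-α (ς (Ω ⊔ Ξ) c (a (not i))) =
    cong inj₁ (join s c i (off x∉) (α-inj p))
  ... | inj₂ (y , refl) = ⊥-elim (Ψ∉α (a i) p)

Sum : (Γ₁ Γ₂ : CGraph) → Fin (size Γ₁) → Fin (size Γ₂) → CGraph → Set
Sum Γ₁ Γ₂ v₁ v₂ Γ = Smoothing (⌊ Γ₁ ⌋ ⊔ ⌊ Γ₂ ⌋) ⟪ inj₁ v₁ , inj₂ v₂ ⟫ ⌊ Γ ⌋

off₁ : {A B : Set} {v x : A} {w : B} → x ≢ v → Off ⟪ inj₁ v , inj₂ w ⟫ (inj₁ x)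
off₁ x≢ = off-⟪⟫ (x≢ ∘ inj₁-injective) (λ ())

off₂ : {A B : Set} {v : A} {w y : B} → y ≢ w → Off ⟪ inj₁ v , inj₂ w ⟫ (inj₂ y)
off₂ y≢ = off-⟪⟫ (λ ()) (y≢ ∘ inj₂-injective)

Sum⇒IsConnSum : ∀ {Γ₁ Γ₂ v₁ v₂ Γ} → Sum Γ₁ Γ₂ v₁ v₂ Γ → IsConnSum Γ Γ₁ Γ₂ v₁ v₂
Sum⇒IsConnSum s = record
  { f₁ = g s ∘ inj₁
  ; f₂ = g s ∘ inj₂
  ; inj₁ = λ x y x≢ y≢ p → inj₁-injective (g-inj s (off₁ x≢) (off₁ y≢) p)
  ; inj₂ = λ x y x≢ y≢ p → inj₂-injective (g-inj s (off₂ x≢) (off₂ y≢) p)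
  ; disj = λ x y x≢ y≢ p → case g-inj s (off₁ x≢) (off₂ y≢) p of λ ()
  ; surj = elim s _ λ { (inj₁ x) x∉ → inj₁ (x , (λ p → x∉ true (cong inj₁ p)) , refl)
                      ; (inj₂ y) y∉ → inj₂ (y , (λ p → y∉ false (cong inj₂ p)) , refl) }
  ; edge₁ = λ c x x≢ y≢ → edge s c (off₁ x≢) (off₁ y≢)
  ; join₁ = λ c x x≢ p → join s c true (off₁ x≢) (cong inj₁ p)
  ; edge₂ = λ c y y≢ z≢ → edge s c (off₂ y≢) (off₂ z≢)
  ; join₂ = λ c y y≢ p → join s c false (off₂ y≢) (cong inj₂ p) }

opaque
  connectedSum : ∀ Γ₁ Γ₂ v₁ v₂ → ∃ (Sum Γ₁ Γ₂ v₁ v₂)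
  connectedSum Γ₁ Γ₂ v₁ v₂ =
    smooth (⌊ Γ₁ ⌋ ⊔ ⌊ Γ₂ ⌋) ⟪ inj₁ v₁ , inj₂ v₂ ⟫ (λ ()) (inj₁ (σ Γ₁ c0 v₁) , off₁ (loopless Γ₁ c0 v₁))

-- All vertex counts come from here: recutting preserves `size` because both ends have two vertices
-- fewer than Γ̄, and splitting off B costs |B| - 2 vertices.
card-smoothing : ∀ {Ω a Γ} → Smoothing Ω a Γ → card Ω ≡ 2 + card Γ
card-smoothing {Ω} {a} {Γ} s =
  ℕ.≤-antisym (Fin.injective⇒≤ {f = to ∘ decode Ω} (λ p → decode-inj (to-inj p)))
              (Fin.injective⇒≤ {f = code Ω ∘ from} (λ p → from-inj (code-inj p)))
  where
  code-inj : ∀ {x y} → code Ω x ≡ code Ω y → x ≡ y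
  code-inj p = trans (sym (decode-code Ω _)) (trans (cong (decode Ω) p) (decode-code Ω _))

  decode-inj : ∀ {i j} → decode Ω i ≡ decode Ω j → i ≡ j
  decode-inj p = trans (sym (code-decode Ω _)) (trans (cong (code Ω) p) (code-decode Ω _))

  from : Fin (2 + card Γ) → V Ω
  from zero          = a true
  from (suc zero)    = a false
  from (suc (suc i)) = lift s (decode Γ i)

  to : V Ω → Fin (2 + card Γ)
  to x with locate Ω a x
  ... | inj₁ (true , _)  = zero
  ... | inj₁ (false , _) = suc zero
  ... | inj₂ _           = suc (suc (code Γ (g s x)))

  from-to : ∀ x → from (to x) ≡ x
  from-to x with locate Ω a x
  ... | inj₁ (true , p)  = sym p
  ... | inj₁ (false , p) = sym p
  ... | inj₂ x∉          = trans (cong (lift s) (decode-code Γ _)) (lift-g s x∉)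

  to-inj : ∀ {x y} → to x ≡ to y → x ≡ y
  to-inj p = trans (sym (from-to _)) (trans (cong from p) (from-to _))

  from-inj : ∀ {i j} → from i ≡ from j → i ≡ j
  from-inj {zero}        {zero}        _ = refl
  from-inj {zero}        {suc zero}    p = contradiction p (distinct s)
  from-inj {zero}        {suc (suc j)} p = contradiction (sym p) (lift-off s _ true)
  from-inj {suc zero}    {zero}        p = contradiction (sym p) (distinct s)
  from-inj {suc zero}    {suc zero}    _ = refl
  from-inj {suc zero}    {suc (suc j)} p = contradiction (sym p) (lift-off s _ false)
  from-inj {suc (suc i)} {zero}        p = contradiction p (lift-off s _ true)
  from-inj {suc (suc i)} {suc zero}    p = contradiction p (lift-off s _ false)
  from-inj {suc (suc i)} {suc (suc j)} p = cong (λ k → suc (suc k))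
    (trans (sym (code-decode Γ i)) (trans (cong (code Γ)
      (trans (sym (g-lift s _)) (trans (cong (g s) p) (g-lift s _)))) (code-decode Γ j)))

-- Collapsing the copy f (B - t) inside Γ to a single vertex exhibits Γ as B # Γ₂.
module _ (Γ B : CGraph) (t : Fin (size B)) (f : Fin (size B) → Fin (size Γ))
         (f-inj : ∀ x y → x ≢ t → y ≢ t → f x ≡ f y → x ≡ y)
         (f-edge : ∀ c x → x ≢ t → σ B c x ≢ t → σ Γ c (f x) ≡ f (σ B c x)) where
  private
    Img : Fin (size Γ) → Set
    Img v = ∃[ x ] (x ≢ t × f x ≡ v)

    img? : Decidable Img
    img? v = Fin.any? λ x → ¬? (x Fin.≟ t) ×-dec (f x Fin.≟ v)

    u : Colour → Fin (size Γ)
    u c = f (σ B c t)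

    u∈ : ∀ c → Img (u c)
    u∈ c = σ B c t , loopless B c t , refl

    -- The collapsed vertex is represented by a vertex of the image itself, so that the new vertex
    -- set is a subset of V(Γ) and `restrict` applies.
    y : Fin (size Γ)
    y = u c0

    out∉ : ∀ c → ¬ Img (σ Γ c (u c))
    out∉ c (x , x≢ , p) with σ B c x Fin.≟ t
    ... | yes q = loopless Γ c (u c) (trans (sym p) (cong f (sym (ς-flip ⌊ B ⌋ q))))
    ... | no q  = x≢ (ς-injective ⌊ B ⌋ (f-inj _ _ q (loopless B c t)
                    (trans (sym (f-edge c x x≢ q)) (ς-flip ⌊ Γ ⌋ (sym p)))))

    -- By `f-edge`, only a vertex whose colour-c neighbour in B is `t` can have its colour-c edge
    -- leave the image, and that vertex is `u c`. So exactly three edges, one per colour, attach the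
    -- copy to the rest.
    boundary : ∀ {c v} → ¬ Img v → Img (σ Γ c v) → σ Γ c v ≡ u c
    boundary {c} v∉ (x , x≢ , p) with σ B c x Fin.≟ t
    ... | yes q = trans (sym p) (cong f (sym (ς-flip ⌊ B ⌋ q)))
    ... | no q  = contradiction (_ , q , trans (sym (f-edge c x x≢ q)) (ς-flip ⌊ Γ ⌋ (sym p))) v∉

    K : Fin (size Γ) → Set
    K v = ¬ Img v ⊎ v ≡ y

    s : Colour → Fin (size Γ) → Fin (size Γ)
    s c v with img? v | img? (σ Γ c v)
    ... | yes _ | _     = σ Γ c (u c)
    ... | no _  | yes _ = y
    ... | no _  | no _  = σ Γ c v

    s-y : ∀ c → s c y ≡ σ Γ c (u c)
    s-y c with img? y
    ... | yes _ = refl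
    ... | no y∉ = contradiction (u∈ c0) y∉

    s-in : ∀ {c v} → ¬ Img v → Img (σ Γ c v) → s c v ≡ y
    s-in {c} {v} v∉ w∈ with img? v | img? (σ Γ c v)
    ... | yes v∈ | _     = contradiction v∈ v∉
    ... | no _   | yes _ = refl
    ... | no _   | no w∉ = contradiction w∈ w∉

    s-out : ∀ {c v} → ¬ Img v → ¬ Img (σ Γ c v) → s c v ≡ σ Γ c v
    s-out {c} {v} v∉ w∉ with img? v | img? (σ Γ c v)
    ... | yes v∈ | _      = contradiction v∈ v∉
    ... | no _   | yes w∈ = contradiction w∈ w∉
    ... | no _   | no _   = refl

    s-K : ∀ c {v} → K v → K (s c v)
    s-K c (inj₂ refl) = inj₁ (subst (¬_ ∘ Img) (sym (s-y c)) (out∉ c))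
    s-K c {v} (inj₁ v∉) = case img? (σ Γ c v) of λ
      { (yes w∈) → inj₂ (s-in v∉ w∈)
      ; (no w∉)  → inj₁ (subst (¬_ ∘ Img) (sym (s-out v∉ w∉)) w∉) }

    s-invol : ∀ c {v} → K v → s c (s c v) ≡ v
    s-invol c (inj₂ refl) = trans (cong (s c) (s-y c))
      (s-in (out∉ c) (subst Img (sym (invol Γ c (u c))) (u∈ c)))
    s-invol c {v} (inj₁ v∉) = case img? (σ Γ c v) of λ
      { (yes w∈) → trans (cong (s c) (s-in v∉ w∈)) (trans (s-y c) (ς-flip ⌊ Γ ⌋ (boundary v∉ w∈)))
      ; (no w∉)  → trans (cong (s c) (s-out v∉ w∉))
                     (trans (s-out w∉ (subst (¬_ ∘ Img) (sym (invol Γ c v)) v∉)) (invol Γ c v)) }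

    s-loopless : ∀ c {v} → K v → s c v ≢ v
    s-loopless c (inj₂ refl) p = out∉ c (subst Img (trans (sym p) (s-y c)) (u∈ c0))
    s-loopless c {v} (inj₁ v∉) p = case img? (σ Γ c v) of λ
      { (yes w∈) → v∉ (subst Img (trans (sym (s-in v∉ w∈)) p) (u∈ c0))
      ; (no w∉)  → loopless Γ c v (trans (sym (s-out v∉ w∉)) p) }

    open Restriction (restrict ⌊ Γ ⌋ {K} (λ v → ¬? (img? v) ⊎-dec (v Fin.≟ y)) s s-K s-invol s-loopless
                                (y , inj₂ refl)) renaming (Γ to Γ₂)

    emb-∉ : ∀ {i} → i ≢ pro y → ¬ Img (emb i)
    emb-∉ {i} i≢ with emb-K i
    ... | inj₁ v∉ = v∉
    ... | inj₂ p  = contradiction (trans (sym (pro-emb i)) (cong pro p)) i≢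

    embed : Fin (size B) ⊎ Fin (size Γ₂) → Fin (size Γ)
    embed = [ f , emb ]′

    preimage : ∀ v → ∃[ x ] (Off ⟪ inj₁ t , inj₂ (pro y) ⟫ x × embed x ≡ v)
    preimage v with img? v
    ... | yes (x , x≢ , p) = inj₁ x , off₁ x≢ , p
    ... | no v∉ = inj₂ (pro v) , off₂ (λ p → v∉ (subst Img (trans (sym (emb-pro (inj₂ refl)))
                    (trans (cong emb (sym p)) (emb-pro (inj₁ v∉)))) (u∈ c0))) , emb-pro (inj₁ v∉)

    emb-y : ∀ c → emb (σ Γ₂ c (pro y)) ≡ σ Γ c (u c)
    emb-y c = trans (cong emb (trans (σ-pro c (inj₂ refl)) (cong pro (s-y c)))) (emb-pro (inj₁ (out∉ c)))

    σ-emb : ∀ c {i} → emb (σ Γ₂ c i) ≡ s c (emb i)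
    σ-emb c {i} = trans (cong (emb ∘ σ Γ₂ c) (sym (pro-emb i)))
                    (trans (cong emb (σ-pro c (emb-K i))) (emb-pro (s-K c (emb-K i))))

    edge′ : ∀ c {x} → Off ⟪ inj₁ t , inj₂ (pro y) ⟫ x →
            Off ⟪ inj₁ t , inj₂ (pro y) ⟫ (ς (⌊ B ⌋ ⊔ ⌊ Γ₂ ⌋) c x) →
            σ Γ c (embed x) ≡ embed (ς (⌊ B ⌋ ⊔ ⌊ Γ₂ ⌋) c x)
    edge′ c {inj₁ x} x∉ w∉ = f-edge c x (x∉ true ∘ cong inj₁) (w∉ true ∘ cong inj₁)
    edge′ c {inj₂ i} i∉ w∉ = case img? (σ Γ c (emb i)) of λ
      { (yes w∈) → contradiction
          (trans (sym (pro-emb _)) (cong pro (trans (σ-emb c) (s-in (emb-∉ (i∉ false ∘ cong inj₂)) w∈))))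
          (w∉ false ∘ cong inj₂)
      ; (no w∉′) → sym (trans (σ-emb c) (s-out (emb-∉ (i∉ false ∘ cong inj₂)) w∉′)) }

    join′ : ∀ c i {x} → Off ⟪ inj₁ t , inj₂ (pro y) ⟫ x →
            ς (⌊ B ⌋ ⊔ ⌊ Γ₂ ⌋) c x ≡ ⟪ inj₁ t , inj₂ (pro y) ⟫ i →
            σ Γ c (embed x) ≡ embed (ς (⌊ B ⌋ ⊔ ⌊ Γ₂ ⌋) c (⟪ inj₁ t , inj₂ (pro y) ⟫ (not i)))
    join′ c true {inj₁ x} x∉ p =
      trans (cong (σ Γ c ∘ f) (sym (ς-flip ⌊ B ⌋ (inj₁-injective p)))) (sym (emb-y c))
    join′ c true {inj₂ i} i∉ ()
    join′ c false {inj₁ x} x∉ ()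
    join′ c false {inj₂ i} i∉ p = ς-flip ⌊ Γ ⌋ (trans (sym (emb-y c)) (cong emb (ς-flip ⌊ Γ₂ ⌋ (inj₂-injective p))))

  opaque
    collapse : ∃[ Γ₂ ] ∃[ v ] Σ (Sum B Γ₂ t v Γ) λ s → ∀ x → g s (inj₁ x) ≡ f x
    collapse = Γ₂ , pro y , record
      { distinct = λ ()
      ; g = embed
      ; g-inj = λ
        { {inj₁ x} {inj₁ x′} x∉ x′∉ p →
            cong inj₁ (f-inj x x′ (x∉ true ∘ cong inj₁) (x′∉ true ∘ cong inj₁) p)
        ; {inj₁ x} {inj₂ i} x∉ i∉ p →
            contradiction (x , x∉ true ∘ cong inj₁ , p) (emb-∉ (i∉ false ∘ cong inj₂))
        ; {inj₂ i} {inj₁ x} i∉ x∉ p →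
            contradiction (x , x∉ true ∘ cong inj₁ , sym p) (emb-∉ (i∉ false ∘ cong inj₂))
        ; {inj₂ i} {inj₂ j} _ _ p →
            cong inj₂ (trans (sym (pro-emb i)) (trans (cong pro p) (pro-emb j))) }
      ; lift = proj₁ ∘ preimage
      ; lift-off = proj₁ ∘ proj₂ ∘ preimage
      ; g-lift = proj₂ ∘ proj₂ ∘ preimage
      ; edge = edge′
      ; join = join′ } , λ _ → refl

-- Connectivity and cut-and-glue moves

-- Connectedness as constancy of closed Boolean predicates: such predicates are pulled back and
-- pushed forward along smoothings, with no path to reroute.
Conn : Graph → Colour → Colour → Set
Conn Ω i j = (P : V Ω → Bool) → (∀ v → P (ς Ω i v) ≡ P v) → (∀ v → P (ς Ω j v) ≡ P v) →
             ∀ x y → P x ≡ P y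

Contracted⇒Conn : ∀ {Γ} → Contracted Γ → ∀ {i j} → i ≢ j → Conn ⌊ Γ ⌋ i j
Contracted⇒Conn con i≢j P Pi Pj x y = along (con _ _ i≢j x y)
  where
  along : ∀ {y} → Reach _ _ _ x y → P x ≡ P y
  along here      = refl
  along (stepi r) = trans (along r) (sym (Pi _))
  along (stepj r) = trans (along r) (sym (Pj _))

-- With φ = id this transfers closed predicates, with φ = not bipartitions.
descend : ∀ {Ω a Γ} (s : Smoothing Ω a Γ) (φ : Bool → Bool) (R : V Ω → Bool) {c : Colour} →
          (∀ x → R (ς Ω c x) ≡ φ (R x)) → (∀ i → R (a (not i)) ≡ φ (R (a i))) →
          ∀ v → R (lift s (ς Γ c v)) ≡ φ (R (lift s v))
descend {Ω} {a} {Γ} s φ R {c} R-ς R-a = elim s _ λ x x∉ → trans (go x x∉) (cong (φ ∘ R) (sym (lift-g s x∉)))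
  where
  go : ∀ x → Off a x → R (lift s (ς Γ c (g s x))) ≡ φ (R x)
  go x x∉ with locate Ω a (ς Ω c x)
  ... | inj₁ (i , p) =
    trans (cong (R ∘ lift s) (join s c i x∉ p))
    (trans (cong R (lift-g s (joined-off s x∉ p)))
    (trans (R-ς _) (cong φ (trans (R-a i) (trans (sym (R-ς (a i))) (cong R (ς-flip Ω p)))))))
  ... | inj₂ y∉ =
    trans (cong (R ∘ lift s) (edge s c x∉ y∉)) (trans (cong R (lift-g s y∉)) (R-ς x))

does-closed : (Γ : CGraph) (c : Colour) {Q : Fin (size Γ) → Set} (Q? : Decidable Q) →
              (∀ {v} → Q v → Q (σ Γ c v)) → ∀ v → does (Q? (σ Γ c v)) ≡ does (Q? v)
does-closed Γ c {Q} Q? Q-σ v with Q? v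
... | yes q = dec-true (Q? _) (Q-σ q)
... | no ¬q = dec-false (Q? _) (¬q ∘ subst Q (invol Γ c v) ∘ Q-σ)

-- A closed predicate on Γ₂ extends over Γ₁ by the constant `P v₂`, as if Γ₁ were shrunk to `v₂`;
-- the extension descends to the sum, where it is constant.
Sum-conn : ∀ {Γ₁ Γ₂ v₁ v₂ Γ i j} → Sum Γ₁ Γ₂ v₁ v₂ Γ → Conn ⌊ Γ ⌋ i j → Conn ⌊ Γ₂ ⌋ i j
Sum-conn {Γ₁} {Γ₂} {v₁} {v₂} {Γ} s conn P Pi Pj x y = trans (at-v₂ x) (sym (at-v₂ y))
  where
  R : Fin (size Γ₁) ⊎ Fin (size Γ₂) → Bool
  R = [ (λ _ → P v₂) , P ]′

  const : ∀ v w → R (lift s v) ≡ R (lift s w)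
  const = conn (R ∘ lift s)
    (descend s id R (λ { (inj₁ _) → refl ; (inj₂ v) → Pi v }) λ { true → refl ; false → refl })
    (descend s id R (λ { (inj₁ _) → refl ; (inj₂ v) → Pj v }) λ { true → refl ; false → refl })

  at-v₂ : ∀ x → P x ≡ P v₂
  at-v₂ x with x Fin.≟ v₂
  ... | yes refl = refl
  ... | no x≢ = trans (cong R (sym (lift-g s (off₂ x≢))))
                  (trans (const _ _) (cong R (lift-g s (off₁ (loopless Γ₁ c0 v₁)))))

module _ {Ω Γ a} (s : Smoothing Ω a Γ) {i j : Colour} (chord : ς Ω j (a true) ≡ a false) where
  private
    chord′ : ∀ k → ς Ω j (a k) ≡ a (not k)
    chord′ true  = chord
    chord′ false = ς-flip Ω chord

  module _ (split : ∀ k → Off a (ς Ω i (a k))) where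

    -- In the {i,j}-subgraph the chord together with the two i-edges at its ends is a path of length
    -- three, which the smoothing replaces by a single i-edge. Connectedness therefore passes both
    -- ways.
    conn-lift : Conn Γ i j → Conn Ω i j
    conn-lift conn P Pi Pj x y = trans (at x) (sym (at y))
      where
      Pa : ∀ k → P (a (not k)) ≡ P (a k)
      Pa k = trans (cong P (sym (chord′ k))) (Pj (a k))

      at-off : ∀ x y → Off a x → Off a y → P x ≡ P y
      at-off x y x∉ y∉ = trans (cong P (sym (lift-g s x∉)))
        (trans (conn (P ∘ lift s) (descend s id P Pi Pa) (descend s id P Pj Pa) _ _)
               (cong P (lift-g s y∉)))

      at : ∀ x → P x ≡ P (ς Ω i (a true))
      at x with locate Ω a x
      ... | inj₁ (k , refl) = trans (sym (Pi (a k))) (at-off _ _ (split k) (split true))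
      ... | inj₂ x∉         = at-off _ _ x∉ (split true)

    conn-descend : Conn Ω i j → Conn Γ i j
    conn-descend conn P Pi Pj x y = trans (sym (P̄-lift x)) (trans (conn P̄ P̄i P̄j _ _) (P̄-lift y))
      where
      P̄ : V Ω → Bool
      P̄ x with locate Ω a x
      -- Both deleted vertices take the value at the far end of one i-edge. The far end of the other
      -- gives the same value, because the smoothing joins the two by an i-edge (`P̄-a`).
      ... | inj₁ _ = P (g s (ς Ω i (a true)))
      ... | inj₂ _ = P (g s x)

      P̄-off : ∀ {x} → Off a x → P̄ x ≡ P (g s x)
      P̄-off {x} x∉ with locate Ω a x
      ... | inj₁ (k , p) = contradiction p (x∉ k)
      ... | inj₂ _       = refl

      P̄-a : ∀ k → P̄ (a k) ≡ P (g s (ς Ω i (a k)))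
      P̄-a k with locate Ω a (a k)
      ... | inj₂ p       = contradiction refl (p k)
      P̄-a true  | inj₁ _ = refl
      P̄-a false | inj₁ _ = trans (sym (Pi _)) (cong P (join s i true (split true) (ς-invol Ω i _)))

      P̄-lift : ∀ w → P̄ (lift s w) ≡ P w
      P̄-lift w = trans (P̄-off (lift-off s w)) (cong P (g-lift s w))

      P̄i : ∀ x → P̄ (ς Ω i x) ≡ P̄ x
      P̄i x = case locate Ω a x of λ
        { (inj₁ (k , refl)) → trans (P̄-off (split k)) (sym (P̄-a k))
        ; (inj₂ x∉) → case locate Ω a (ς Ω i x) of λ
          { (inj₁ (k , p)) → trans (cong P̄ p) (trans (P̄-a k)
              (trans (cong (P ∘ g s) (ς-flip Ω p)) (sym (P̄-off x∉))))
          ; (inj₂ y∉) → trans (P̄-off y∉) (trans (cong P (sym (edge s i x∉ y∉)))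
              (trans (Pi _) (sym (P̄-off x∉)))) } }

      P̄-const : ∀ k l → P̄ (a k) ≡ P̄ (a l)
      P̄-const k l with locate Ω a (a k) | locate Ω a (a l)
      ... | inj₁ _ | inj₁ _ = refl
      ... | inj₂ p | _      = contradiction refl (p k)
      ... | inj₁ _ | inj₂ p = contradiction refl (p l)

      P̄j : ∀ x → P̄ (ς Ω j x) ≡ P̄ x
      P̄j x = case locate Ω a x of λ
        { (inj₁ (k , refl)) → trans (cong P̄ (chord′ k)) (P̄-const (not k) k)
        ; (inj₂ x∉) → case locate Ω a (ς Ω j x) of λ
          { (inj₁ (k , p)) → contradiction (trans (sym (ς-flip Ω p)) (chord′ k)) (x∉ (not k))
          ; (inj₂ y∉) → trans (P̄-off y∉) (trans (cong P (sym (edge s j x∉ y∉)))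
              (trans (Pj _) (sym (P̄-off x∉)))) } }

col : Bool → Colour
col false = c0
col true  = c1

col≢c2 : ∀ b → col b ≢ c2
col≢c2 false ()
col≢c2 true  ()

-- Γ̄ is cut from Γ at the pair z and glued to Γ′ at the pair w; S separates the
-- {0,1}-components of Γ̄ for both.
record Recut (Γ Γ′ : CGraph) : Set where
  field
    Γ̄        : CGraph
    S        : Fin (size Γ̄) → Bool
    S-closed : ∀ b x → S (σ Γ̄ (col b) x) ≡ S x
    z w      : Bool → Fin (size Γ̄)
    S-z      : ∀ i → S (z i) ≡ i
    S-w      : ∀ i → S (w i) ≡ i
    z-edge   : σ Γ̄ c2 (z true) ≡ z false
    w-edge   : σ Γ̄ c2 (w true) ≡ w false
    sz       : Smoothing ⌊ Γ̄ ⌋ z ⌊ Γ ⌋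
    sw       : Smoothing ⌊ Γ̄ ⌋ w ⌊ Γ′ ⌋

module _ {Γ Γ′ : CGraph} (r : Recut Γ Γ′) where
  open Recut r
  private
    split : (a : Bool → Fin (size Γ̄)) → (∀ i → S (a i) ≡ i) → ∀ b i → Off a (σ Γ̄ (col b) (a i))
    split a S-a b i j p with i 𝔹.≟ j
    ... | yes refl = loopless Γ̄ (col b) _ p
    ... | no i≢j = i≢j (trans (sym (S-a i)) (trans (sym (S-closed b _)) (trans (cong S p) (S-a j))))

    simpleCut : ∀ {Δ} (a : Bool → Fin (size Γ̄)) → (∀ i → S (a i) ≡ i) → σ Γ̄ c2 (a true) ≡ a false →
                Smoothing ⌊ Γ̄ ⌋ a ⌊ Δ ⌋ → SimpleCut Δ Γ̄ (a true) (a false)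
    simpleCut a S-a a-edge s = record
      { S = S
      ; S-closed = λ { zero x _ → S-closed false x
                     ; (suc zero) x _ → S-closed true x
                     ; (suc (suc zero)) x p → contradiction refl p }
      ; S-z₁ = S-a true
      ; S-z₂ = S-a false
      ; z-edge = a-edge
      ; g = g s
      ; g-inj = λ x y x≢ x≢′ y≢ y≢′ → g-inj s (off x≢ x≢′) (off y≢ y≢′)
      ; g-surj = elim s _ λ x x∉ → x , x∉ true , x∉ false , refl
      ; col2 = λ x x≢ x≢′ → edge s c2 (off x≢ x≢′)
          (off (λ p → x≢′ (trans (sym (ς-flip ⌊ Γ̄ ⌋ p)) a-edge))
               (λ p → x≢ (trans (sym (ς-flip ⌊ Γ̄ ⌋ p)) (ς-flip ⌊ Γ̄ ⌋ a-edge))))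
      ; col01 = λ c x _ x≢ x≢′ y≢ y≢′ → edge s c (off x≢ x≢′) (off y≢ y≢′)
      ; join₁ = λ c x _ x≢ x≢′ → join s c true (off x≢ x≢′)
      ; join₂ = λ c x _ x≢ x≢′ → join s c false (off x≢ x≢′) }
      where
      off : ∀ {x} → x ≢ a true → x ≢ a false → Off a x
      off p q true  = p
      off p q false = q

  Recut⇒CutGlue : CutGlue Γ Γ′
  Recut⇒CutGlue = Γ̄ , z true , z false , w true , w false ,
                  simpleCut z S-z z-edge sz , simpleCut w S-w w-edge sw

  recut-size : size Γ ≡ size Γ′
  recut-size = ℕ.+-cancelˡ-≡ 2 _ _ (trans (sym (card-smoothing sz)) (card-smoothing sw))

  -- The pairs `z` and `w` are chords of colour 2, and `S` keeps the `col b` neighbour of either end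
  -- away from the other end. Hence connectedness goes up from Γ to Γ̄ and down to Γ′.
  recut-conn₂ : ∀ b → Conn ⌊ Γ ⌋ (col b) c2 → Conn ⌊ Γ′ ⌋ (col b) c2
  recut-conn₂ b = conn-descend sw w-edge (split w S-w b) ∘ conn-lift sz z-edge (split z S-z b)

-- Walks on {0,1}-cycles

least : {P : ℕ → Set} → Decidable P → ∀ n → P n → ∃[ m ] (P m × (∀ k → k < m → ¬ P k))
least {P} P? = <-rec _ λ n rec pn → case ℕ.anyUpTo? P? n of λ
  { (yes (k , k<n , pk)) → rec k<n pk
  ; (no none) → n , pn , λ k k<n pk → none (k , k<n , pk) }

odd : ℕ → Bool
odd zero    = false
odd (suc i) = not (odd i)

odd-+ : ∀ i j → odd (i + j) ≡ odd i xor odd j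
odd-+ zero    j = refl
odd-+ (suc i) j with odd i | odd j | odd (i + j) | odd-+ i j
... | false | _ | _ | refl = refl
... | true  | _ | _ | refl = not-involutive _

odd-double : ∀ i → odd (i + i) ≡ false
odd-double i = trans (odd-+ i i) (𝔹.xor-same (odd i))

half : ∀ n → ∃[ d ] (n ≡ d + d ⊎ n ≡ suc (d + d))
half zero = 0 , inj₁ refl
half (suc n) with half n
... | d , inj₁ refl = d , inj₂ refl
... | d , inj₂ refl = suc d , inj₁ (cong suc (sym (ℕ.+-suc d d)))

module Walk (Γ : CGraph) (r : Fin (size Γ)) where

  walk : ℕ → Fin (size Γ)
  walk zero    = r
  walk (suc i) = σ Γ (col (odd i)) (walk i)

  walk-back : ∀ i → σ Γ (col (odd i)) (walk (suc i)) ≡ walk i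
  walk-back i = invol Γ _ _

  -- A coincidence at odd distance could be folded up, step by step, to a loop.
  walk-≢-odd : ∀ d i → walk i ≢ walk (suc (d + d + i))
  walk-≢-odd zero    i p = loopless Γ _ _ (sym p)
  walk-≢-odd (suc d) i p = walk-≢-odd d (suc i) (trans
    (cong (σ Γ (col (odd i))) p)
    (trans (cong (λ b → σ Γ (col b) (walk (suc (suc (d + suc d + i))))) parity)
      (trans (walk-back (suc (d + suc d + i))) (cong walk shuffle))))
    where
    shuffle : suc (d + suc d + i) ≡ suc (d + d + suc i)
    shuffle = cong suc (trans (ℕ.+-assoc d (suc d) i) (trans (cong (d +_) (sym (ℕ.+-suc d i))) (sym (ℕ.+-assoc d d (suc i)))))
    parity : odd i ≡ odd (suc (d + suc d + i))
    parity = sym (trans (cong odd shuffle) (trans (cong not (trans (odd-+ (d + d) (suc i))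
      (cong (_xor odd (suc i)) (odd-double d)))) (not-involutive (odd i))))

  walk-unshift : ∀ d i → walk i ≡ walk (d + d + i) → walk 0 ≡ walk (d + d)
  walk-unshift d zero    p = trans p (cong walk (ℕ.+-identityʳ (d + d)))
  walk-unshift d (suc i) p = walk-unshift d i (trans (sym (walk-back i))
    (trans (cong (σ Γ (col (odd i))) (trans p (cong walk (ℕ.+-suc (d + d) i))))
    (trans (cong (λ b → σ Γ (col b) (walk (suc (d + d + i))))
                 (sym (trans (odd-+ (d + d) i) (cong (_xor odd i) (odd-double d)))))
           (walk-back (d + d + i)))))

  walk-collision : ∀ {i j} → i < j → walk i ≡ walk j →
                   ∃[ d ] (0 < d × i + (d + d) ≡ j × walk (d + d) ≡ walk 0)
  walk-collision {i} {j} i<j p with k , q ← ℕ.m≤n⇒∃[o]m+o≡n (ℕ.<⇒≤ i<j) with half k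
  ... | zero , inj₁ refl = contradiction (trans (sym (ℕ.+-identityʳ i)) q) (ℕ.<⇒≢ i<j)
  ... | d@(suc _) , inj₁ refl =
    d , s≤s z≤n , q , sym (walk-unshift d i (trans p (cong walk (trans (sym q) (ℕ.+-comm i _)))))
  ... | d , inj₂ refl =
    contradiction (trans p (cong walk (trans (sym q) (ℕ.+-comm i _)))) (walk-≢-odd d i)

  private
    Returns : ℕ → Set
    Returns d = 0 < d × walk (d + d) ≡ walk 0

    opaque
      -- Coincidences occur only at even distance, so the period is sought in the form d + d, and
      -- `odd-N` then holds by construction. The pigeonhole principle on size Γ + 1 steps supplies a
      -- first candidate.
      half-period : ∃[ h ] (Returns h × (∀ k → k < h → ¬ Returns k))
      half-period with i , j , i<j , p ← Fin.pigeonhole (ℕ.n<1+n (size Γ)) (walk ∘ Fin.toℕ)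
        with d , 0<d , _ , q ← walk-collision i<j p =
        least (λ d → (0 ℕ.<? d) ×-dec (walk (d + d) Fin.≟ walk 0)) d (0<d , q)

  N : ℕ
  N = proj₁ half-period + proj₁ half-period

  odd-N : odd N ≡ false
  odd-N = odd-double (proj₁ half-period)

  0<N : 0 < N
  0<N = ℕ.≤-trans (proj₁ (proj₁ (proj₂ half-period))) (ℕ.m≤m+n _ _)

  walk-N : walk N ≡ r
  walk-N = proj₂ (proj₁ (proj₂ half-period))

  walk-≢ : ∀ {i j} → i < j → j < N → walk i ≢ walk j
  walk-≢ {i} {j} i<j j<N p with d , 0<d , q , eq ← walk-collision i<j p =
    proj₂ (proj₂ half-period) d (ℕ.≰⇒> (λ h≤d → ℕ.<⇒≱ j<N
      (ℕ.≤-trans (ℕ.+-mono-≤ h≤d h≤d) (subst (d + d ≤_) q (ℕ.m≤n+m (d + d) i))))) (0<d , eq)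

  walk-inj : ∀ {i j} → i < N → j < N → walk i ≡ walk j → i ≡ j
  walk-inj {i} {j} i<N j<N p with ℕ.<-cmp i j
  ... | tri< i<j _ _ = contradiction p (walk-≢ i<j j<N)
  ... | tri≈ _ i≡j _ = i≡j
  ... | tri> _ _ j<i = contradiction (sym p) (walk-≢ j<i i<N)

  walk-last : ∀ {i} → suc i ≡ N → odd i ≡ true × walk i ≡ σ Γ c1 r
  walk-last {i} p = o , sym (ς-flip ⌊ Γ ⌋ (trans (cong (λ b → σ Γ (col b) (walk i)) (sym o)) (trans (cong walk p) walk-N)))
    where
    o : odd i ≡ true
    o = trans (sym (not-involutive _)) (cong not (trans (cong odd p) odd-N))

-- The {0,1}-cycle through r, without r, is a path between the two neighbours of r.
around : ∀ Γ r (P : Fin (size Γ) → Bool) →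
         (∀ b v → v ≢ r → σ Γ (col b) v ≢ r → P (σ Γ (col b) v) ≡ P v) →
         P (σ Γ c0 r) ≡ P (σ Γ c1 r)
around Γ r P P-closed = last-step (ℕ.suc-pred N {{>-nonZero 0<N}})
  where
  open Walk Γ r
  along : ∀ i → suc i < N → P (walk (suc i)) ≡ P (σ Γ c0 r)
  along zero    _ = refl
  along (suc i) p = trans (P-closed (odd (suc i)) (walk (suc i)) (walk-≢ (s≤s z≤n) (ℕ.<⇒≤ p) ∘ sym)
                             (walk-≢ (s≤s z≤n) p ∘ sym))
                          (along i (ℕ.<⇒≤ p))
  last-step : ∀ {n} → suc n ≡ N → P (σ Γ c0 r) ≡ P (σ Γ c1 r)
  last-step {zero}  p = case trans (sym odd-N) (cong odd (sym p)) of λ ()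
  last-step {suc n} p = trans (sym (along n (subst (suc n <_) p (ℕ.n<1+n _))))
                              (cong P (proj₂ (walk-last p)))

module _ {Γ Γ′ : CGraph} (r : Recut Γ Γ′) where
  open Recut r

  -- Connectedness of Γ makes each side of Γ̄ connected (`side-const`). A cycle without the vertex
  -- `w k` is still connected (`around`), and glueing at one vertex on each side joins the two paths
  -- into one cycle.
  recut-conn₀₁ : Conn ⌊ Γ ⌋ c0 c1 → Conn ⌊ Γ′ ⌋ c0 c1
  recut-conn₀₁ conn P P0 P1 = λ x y → trans (sym (P̄-lift x)) (trans (P̄-const (lift sw x) (lift sw y)) (P̄-lift y))
    where
    side-const : (P : Fin (size Γ̄) → Bool) → (∀ b v → P (σ Γ̄ (col b) v) ≡ P v) →
                 ∀ i x → S x ≡ i → P x ≡ P (z i)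
    side-const P P-closed i x Sx = trans (sym (Q-in Sx)) (Q-const x)
      where
      -- Outside side `i` the value is the constant `P (z i)`. Thus Q agrees on both vertices of `z`
      -- and descends to Γ.
      Q : Fin (size Γ̄) → Bool
      Q v with S v 𝔹.≟ i
      ... | yes _ = P v
      ... | no _  = P (z i)

      Q-in : ∀ {v} → S v ≡ i → Q v ≡ P v
      Q-in {v} p with S v 𝔹.≟ i
      ... | yes _ = refl
      ... | no ¬p = contradiction p ¬p

      Q-out : ∀ {v} → S v ≢ i → Q v ≡ P (z i)
      Q-out {v} p with S v 𝔹.≟ i
      ... | yes q = contradiction q p
      ... | no _  = refl

      Q-z : ∀ k → Q (z k) ≡ P (z i)
      Q-z k = case k 𝔹.≟ i of λ
        { (yes refl) → Q-in (S-z k) ; (no p) → Q-out (p ∘ trans (sym (S-z k))) }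

      Q-closed : ∀ b v → Q (σ Γ̄ (col b) v) ≡ Q v
      Q-closed b v = case S v 𝔹.≟ i of λ
        { (yes p) → trans (Q-in (trans (S-closed b v) p)) (trans (P-closed b v) (sym (Q-in p)))
        ; (no p) → trans (Q-out (p ∘ trans (sym (S-closed b v)))) (sym (Q-out p)) }

      o : Fin (size Γ̄)
      o = σ Γ̄ c0 (z i)

      o-off : Off z o
      o-off k p with i 𝔹.≟ k
      ... | yes refl = loopless Γ̄ c0 _ p
      ... | no i≢k = i≢k (trans (sym (S-z i)) (trans (sym (S-closed false _)) (trans (cong S p) (S-z k))))

      Q-descends : ∀ b v → Q (lift sz (σ Γ (col b) v)) ≡ Q (lift sz v)
      Q-descends b = descend sz id Q (Q-closed b) (λ k → trans (Q-z (not k)) (sym (Q-z k)))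

      Q-const : ∀ x → Q x ≡ P (z i)
      Q-const x with locate ⌊ Γ̄ ⌋ z x
      ... | inj₁ (k , refl) = Q-z k
      ... | inj₂ x∉ = trans (cong Q (sym (lift-g sz x∉)))
        (trans (conn (Q ∘ lift sz) (Q-descends false) (Q-descends true) _ _)
        (trans (cong Q (lift-g sz o-off)) (trans (Q-closed false (z i)) (Q-z i))))

    P̄ : Fin (size Γ̄) → Bool
    P̄ x with locate ⌊ Γ̄ ⌋ w x
    ... | inj₁ (k , _) = P (g sw (σ Γ̄ c0 (w k)))
    ... | inj₂ _       = P (g sw x)

    P̄-off : ∀ {x} → Off w x → P̄ x ≡ P (g sw x)
    P̄-off {x} x∉ with locate ⌊ Γ̄ ⌋ w x
    ... | inj₁ (k , p) = contradiction p (x∉ k)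
    ... | inj₂ _       = refl

    P̄-w : ∀ k → P̄ (w k) ≡ P (g sw (σ Γ̄ c0 (w k)))
    P̄-w k with locate ⌊ Γ̄ ⌋ w (w k)
    ... | inj₁ (l , p) = cong (P ∘ g sw ∘ σ Γ̄ c0) (sym p)
    ... | inj₂ p       = contradiction refl (p k)

    P̄-lift : ∀ v → P̄ (lift sw v) ≡ P v
    P̄-lift v = trans (P̄-off (lift-off sw v)) (cong P (g-lift sw v))

    P-closed : ∀ b v → P (σ Γ′ (col b) v) ≡ P v
    P-closed false = P0
    P-closed true  = P1

    P̄-edge : ∀ b {x} → Off w x → Off w (σ Γ̄ (col b) x) → P̄ (σ Γ̄ (col b) x) ≡ P̄ x
    P̄-edge b x∉ y∉ = trans (P̄-off y∉) (trans (cong P (sym (edge sw (col b) x∉ y∉)))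
                       (trans (P-closed b _) (sym (P̄-off x∉))))

    nbr-off : ∀ b k → Off w (σ Γ̄ (col b) (w k))
    nbr-off b k l p with k 𝔹.≟ l
    ... | yes refl = loopless Γ̄ (col b) _ p
    ... | no k≢l = k≢l (trans (sym (S-w k)) (trans (sym (S-closed b _)) (trans (cong S p) (S-w l))))

    P̄-around : ∀ k → P̄ (σ Γ̄ c0 (w k)) ≡ P̄ (σ Γ̄ c1 (w k))
    P̄-around k = trans (sym (R-in (trans (S-closed false _) (S-w k))))
      (trans (around Γ̄ (w k) R R-closed) (R-in (trans (S-closed true _) (S-w k))))
      where
      -- At this stage P̄ is not known to be closed around the other deleted vertex `w (not k)`; the
      -- restriction to side `k` hides that vertex.
      R : Fin (size Γ̄) → Bool
      R v with S v 𝔹.≟ k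
      ... | yes _ = P̄ v
      ... | no _  = false

      R-in : ∀ {v} → S v ≡ k → R v ≡ P̄ v
      R-in {v} p with S v 𝔹.≟ k
      ... | yes _ = refl
      ... | no ¬p = contradiction p ¬p

      R-out : ∀ {v} → S v ≢ k → R v ≡ false
      R-out {v} p with S v 𝔹.≟ k
      ... | yes q = contradiction q p
      ... | no _  = refl

      side-off : ∀ {v} → S v ≡ k → v ≢ w k → Off w v
      side-off Sv v≢ l p with trans (sym Sv) (trans (cong S p) (S-w l))
      ... | refl = v≢ p

      R-closed : ∀ b v → v ≢ w k → σ Γ̄ (col b) v ≢ w k → R (σ Γ̄ (col b) v) ≡ R v
      R-closed b v v≢ y≢ = case S v 𝔹.≟ k of λ
        { (yes p) → let q = trans (S-closed b v) p in
            trans (R-in q) (trans (P̄-edge b (side-off p v≢) (side-off q y≢)) (sym (R-in p)))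
        ; (no p) → trans (R-out (p ∘ trans (sym (S-closed b v)))) (sym (R-out p)) }

    P̄-nbr : ∀ b k → P̄ (σ Γ̄ (col b) (w k)) ≡ P̄ (w k)
    P̄-nbr false k = trans (P̄-off (nbr-off false k)) (sym (P̄-w k))
    P̄-nbr true  k = trans (sym (P̄-around k)) (P̄-nbr false k)

    P̄-closed : ∀ b x → P̄ (σ Γ̄ (col b) x) ≡ P̄ x
    P̄-closed b x = case locate ⌊ Γ̄ ⌋ w x of λ
      { (inj₁ (k , refl)) → P̄-nbr b k
      ; (inj₂ x∉) → case locate ⌊ Γ̄ ⌋ w (σ Γ̄ (col b) x) of λ
        { (inj₁ (k , p)) → trans (cong P̄ p) (trans (sym (P̄-nbr b k)) (cong P̄ (ς-flip ⌊ Γ̄ ⌋ p)))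
        ; (inj₂ y∉) → P̄-edge b x∉ y∉ } }

    P̄-side : ∀ k x → S x ≡ k → P̄ x ≡ P̄ (w k)
    P̄-side k x Sx = trans (side-const P̄ P̄-closed k x Sx) (sym (side-const P̄ P̄-closed k (w k) (S-w k)))

    P̄-w-const : P̄ (w true) ≡ P̄ (w false)
    P̄-w-const = trans (P̄-w true) (trans (sym (P0 _)) (trans
      (cong P (join sw c0 true (nbr-off false true) (invol Γ̄ c0 _))) (sym (P̄-w false))))

    P̄-const : ∀ x y → P̄ x ≡ P̄ y
    P̄-const x y = trans (at x) (sym (at y))
      where
      at : ∀ x → P̄ x ≡ P̄ (w true)
      at x with S x in eq
      ... | true  = P̄-side true x eq
      ... | false = trans (P̄-side false x eq) (sym P̄-w-const)

-- Polygon coordinates and cuts along arcs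

data Neighbours (N : ℕ) : Bool → ℕ → ℕ → Set where
  up    : ∀ {b i} → b ≡ odd i → suc i < N → Neighbours N b i (suc i)
  down  : ∀ {b i} → b ≡ odd i → suc i < N → Neighbours N b (suc i) i
  -- The period is even, so the edge that closes the polygon, from N - 1 to 0, has colour 1.
  over  : ∀ {i} → suc i ≡ N → Neighbours N true i 0
  under : ∀ {i} → suc i ≡ N → Neighbours N true 0 i

module Cycle (Γ : CGraph) (r : Fin (size Γ)) (conn : Conn ⌊ Γ ⌋ c0 c1) where
  open Walk Γ r public

  private
    Hit : Fin (size Γ) → Set
    Hit v = ∃[ i ] (i < N × walk i ≡ v)

    hit? : Decidable Hit
    hit? v = ℕ.anyUpTo? (λ i → walk i Fin.≟ v) N

    N-1 : ∃[ n ] suc n ≡ N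
    N-1 = _ , ℕ.suc-pred N {{>-nonZero 0<N}}

    hit-σ : ∀ b {v} → Hit v → Hit (σ Γ (col b) v)
    hit-σ b (i , i<N , refl) with b 𝔹.≟ odd i
    ... | yes refl = case ℕ.m≤n⇒m<n∨m≡n i<N of λ
      { (inj₁ p) → suc i , p , refl
      ; (inj₂ p) → 0 , 0<N , trans (sym walk-N) (cong walk (sym p)) }
    hit-σ false (zero , i<N , refl) | no b≢ = contradiction refl b≢
    hit-σ true  (zero , i<N , refl) | no b≢ with n , p ← N-1 =
      n , subst (n <_) p (ℕ.n<1+n n) , proj₂ (walk-last p)
    hit-σ b (suc i , i<N , refl) | no b≢ with refl ← trans (¬-not b≢) (not-involutive (odd i)) =
      i , ℕ.<⇒≤ i<N , sym (walk-back i)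

    hit-closed : ∀ b v → does (hit? (σ Γ (col b) v)) ≡ does (hit? v)
    hit-closed b = does-closed Γ (col b) hit? (hit-σ b)

    opaque
      -- The vertices met by the walk are closed under colours 0 and 1, hence are all vertices.
      hit : ∀ v → Hit v
      hit v with hit? v in eq
      ... | yes h = h
      ... | no _ = case trans (sym (dec-true (hit? r) (0 , 0<N , refl)))
                     (trans (conn (does ∘ hit?) (hit-closed false) (hit-closed true) r v) (cong does eq)) of λ ()

  pos : Fin (size Γ) → ℕ
  pos v = proj₁ (hit v)

  pos<N : ∀ v → pos v < N
  pos<N v = proj₁ (proj₂ (hit v))

  walk-pos : ∀ v → walk (pos v) ≡ v
  walk-pos v = proj₂ (proj₂ (hit v))

  pos-walk : ∀ {i} → i < N → pos (walk i) ≡ i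
  pos-walk i<N = walk-inj (pos<N _) i<N (walk-pos _)

  pos-injective : ∀ {u v} → pos u ≡ pos v → u ≡ v
  pos-injective p = trans (sym (walk-pos _)) (trans (cong walk p) (walk-pos _))

  pos-r : pos r ≡ 0
  pos-r = pos-walk 0<N

  neighbours : ∀ b v → Neighbours N b (pos v) (pos (σ Γ (col b) v))
  neighbours b v = subst (λ u → Neighbours N b (pos v) (pos (σ Γ (col b) u))) (walk-pos v) (go b (pos v) (pos<N v))
    where
    go : ∀ b i → i < N → Neighbours N b i (pos (σ Γ (col b) (walk i)))
    go b i i<N with b 𝔹.≟ odd i
    ... | yes refl = case ℕ.m≤n⇒m<n∨m≡n i<N of λ
      { (inj₁ p) → subst (Neighbours N (odd i) i) (sym (pos-walk p)) (up refl p)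
      ; (inj₂ p) → subst (Neighbours N (odd i) i)
          (sym (trans (cong pos (trans (cong walk p) walk-N)) pos-r))
          (subst (λ b → Neighbours N b i 0) (sym (proj₁ (walk-last p))) (over p)) }
    go false zero i<N | no b≢ = contradiction refl b≢
    go true  zero i<N | no b≢ with n , p ← N-1 =
      subst (Neighbours N true 0)
        (sym (trans (cong pos (sym (proj₂ (walk-last p)))) (pos-walk (subst (n <_) p (ℕ.n<1+n n)))))
        (under p)
    go b (suc i) i<N | no b≢ with refl ← trans (¬-not b≢) (not-involutive (odd i)) =
      subst (Neighbours N (odd i) (suc i))
        (sym (trans (cong pos (walk-back i)) (pos-walk (ℕ.<⇒≤ i<N)))) (down refl i<N)

  -- Parity of position is the 2-colouring of the polygon; it is consistent across the closing edge
  -- because N is even.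
  odd-pos : ∀ b v → odd (pos (σ Γ (col b) v)) ≡ not (odd (pos v))
  odd-pos b v = flips (neighbours b v)
    where
    odd-last : ∀ {i} → suc i ≡ N → odd i ≡ true
    odd-last p = proj₁ (walk-last p)
    flips : ∀ {b i j} → Neighbours N b i j → odd j ≡ not (odd i)
    flips (up _ _)    = refl
    flips (down _ _)  = sym (not-involutive _)
    flips (over p)  = cong not (sym (odd-last p))
    flips (under p) = odd-last p

  -- Any colouring of the polygon is parity up to a global swap, so parities of positions counted
  -- from a new base point can be read off a colouring fixed beforehand.
  walk-alternates : (f : Fin (size Γ) → Bool) → (∀ b v → f (σ Γ (col b) v) ≡ not (f v)) →
                    ∀ i → f (walk i) ≡ odd i xor f r
  walk-alternates f alt zero    = refl
  walk-alternates f alt (suc i) =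
    trans (alt _ _) (trans (cong not (walk-alternates f alt i)) (𝔹.not-distribˡ-xor (odd i) (f r)))

-- A set S of vertices whose boundary consists of one edge of colour 0 and one
-- of colour 1; pt b i is the end on side i of the edge of colour b.
record Cutting (Γ : CGraph) : Set where
  field
    S       : Fin (size Γ) → Bool
    pt      : Bool → Bool → Fin (size Γ)
    pt-edge : ∀ b → σ Γ (col b) (pt b true) ≡ pt b false
    S-pt    : ∀ b i → S (pt b i) ≡ i
    cross   : ∀ b v → S (σ Γ (col b) v) ≢ S v → v ≡ pt b (S v)

  pt-edge′ : ∀ b i → σ Γ (col b) (pt b i) ≡ pt b (not i)
  pt-edge′ b true  = pt-edge b
  pt-edge′ b false = ς-flip ⌊ Γ ⌋ (pt-edge b)

module _ {Γ : CGraph} {r : Fin (size Γ)} (conn : Conn ⌊ Γ ⌋ c0 c1) where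
  open Cycle Γ r conn

  record Arc (k : ℕ) : Set where
    field
      cutting : Cutting Γ
    open Cutting cutting public
    field
      S-in     : ∀ {v} → pos v ≤ k → S v ≡ true
      S-out    : ∀ {v} → k < pos v → S v ≡ false
      pt-start : pt true true ≡ r
      pt-last  : pt false true ≡ walk k
      pt-next  : pt false false ≡ walk (suc k)

  opaque
   -- The arc is `r`, ..., `walk k`. Evenness of `k` makes its outgoing edge at `walk k` one of
   -- colour 0, while at `r` the closing edge of colour 1 leaves it. With `suc k < N` the complement
   -- contains `walk (suc k)`.
   arc : ∀ k → odd k ≡ false → suc k < N → Arc k
   arc k even-k k<N = record
    { S-in = S-in; S-out = S-out; pt-start = refl; pt-last = refl; pt-next = refl; cutting = record
    { S = S; pt = pt
    ; pt-edge = λ { false → cong (λ b → σ Γ (col b) (walk k)) (sym even-k) ; true → refl }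
    ; S-pt = λ { false true  → S-in (ℕ.≤-reflexive (pos-walk (ℕ.<⇒≤ k<N)))
               ; false false → S-out (ℕ.≤-reflexive (sym (pos-walk k<N)))
               ; true  true  → S-in (subst (_≤ k) (sym pos-r) z≤n)
               ; true  false → S-out (far (neighbours true r) pos-r) }
    ; cross = λ b v → cross b v (neighbours b v) } }
    where
    S : Fin (size Γ) → Bool
    S v = does (pos v ℕ.≤? k)

    S-in : ∀ {v} → pos v ≤ k → S v ≡ true
    S-in p = dec-true (_ ℕ.≤? k) p

    S-out : ∀ {v} → k < pos v → S v ≡ false
    S-out p = dec-false (_ ℕ.≤? k) (ℕ.<⇒≱ p)

    pt : Bool → Bool → Fin (size Γ)
    pt false true  = walk k
    pt false false = walk (suc k)
    pt true  true  = r
    pt true  false = σ Γ c1 r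

    far : ∀ {i j} → Neighbours N true i j → i ≡ 0 → k < j
    far (up () _)   refl
    far (over p)  refl = contradiction (subst (suc k <_) (sym p) k<N) λ { (s≤s ()) }
    far (under p)   refl = ℕ.≤-pred (subst (suc k <_) (sym p) k<N)

    cross : ∀ b v → Neighbours N b (pos v) (pos (σ Γ (col b) v)) → S (σ Γ (col b) v) ≢ S v → v ≡ pt b (S v)
    cross b v nb d = pos-injective (go nb refl refl)
      where
      go : ∀ {i j} → Neighbours N b i j → pos v ≡ i → pos (σ Γ (col b) v) ≡ j → pos v ≡ pos (pt b (S v))
      go (up refl p) refl q with ℕ.<-cmp (pos v) k
      ... | tri< v<k _ _ = contradiction (trans (S-in (subst (_≤ k) (sym q) v<k)) (sym (S-in (ℕ.<⇒≤ v<k)))) d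
      ... | tri> _ _ v>k = contradiction (trans (S-out (subst (k <_) (sym q) (ℕ.<-trans v>k (ℕ.n<1+n _)))) (sym (S-out v>k))) d
      ... | tri≈ _ v≡k _ = trans v≡k (sym (trans (cong₂ (λ b i → pos (pt b i))
              (trans (cong odd v≡k) even-k) (S-in (ℕ.≤-reflexive v≡k))) (pos-walk (ℕ.<⇒≤ k<N))))
      go {suc i} (down refl p) pv q with ℕ.<-cmp i k
      ... | tri< i<k _ _ = contradiction (trans (S-in (subst (_≤ k) (sym q) (ℕ.<⇒≤ i<k))) (sym (S-in (subst (_≤ k) (sym pv) i<k)))) d
      ... | tri> _ _ i>k = contradiction (trans (S-out (subst (k <_) (sym q) i>k)) (sym (S-out (subst (k <_) (sym pv) (ℕ.<-trans i>k (ℕ.n<1+n _)))))) d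
      ... | tri≈ _ refl _ = trans pv (sym (trans (cong₂ (λ b i → pos (pt b i)) even-k
              (S-out (ℕ.≤-reflexive (sym pv)))) (pos-walk k<N)))
      go {i} (over p) refl q = cong pos (trans v≡last (cong (pt true) (sym (S-out (ℕ.≤-pred (subst (suc k <_) (sym p) k<N))))))
        where
        v≡last : v ≡ σ Γ c1 r
        v≡last = trans (sym (walk-pos v)) (proj₂ (walk-last p))
      go (under p) pv q = trans pv (sym (trans (cong (pos ∘ pt true) (S-in (subst (_≤ k) (sym pv) z≤n))) pos-r))

-- The inverse of smoothing: the two boundary edges on side `i` are redirected to a new vertex
-- `z i`, so both sides close up separately. The new vertices are joined by a chord of colour 2.
module CutAlong {Γ : CGraph} (C : Cutting Γ) where
  open Cutting C

  old : Fin (size Γ) → Fin (2 + size Γ)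
  old v = suc (suc v)

  z : Bool → Fin (2 + size Γ)
  z true  = zero
  z false = suc zero

  private
    cut : Bool → Fin (2 + size Γ) → Fin (2 + size Γ)
    cut b zero          = old (pt b true)
    cut b (suc zero)    = old (pt b false)
    cut b (suc (suc v)) with S (σ Γ (col b) v) 𝔹.≟ S v
    ... | yes _ = old (σ Γ (col b) v)
    ... | no _  = z (S v)

    cut₂ : Fin (2 + size Γ) → Fin (2 + size Γ)
    cut₂ zero          = suc zero
    cut₂ (suc zero)    = zero
    cut₂ (suc (suc v)) = old (σ Γ c2 v)

    cut-inside : ∀ b {v} → S (σ Γ (col b) v) ≡ S v → cut b (old v) ≡ old (σ Γ (col b) v)
    cut-inside b {v} p with S (σ Γ (col b) v) 𝔹.≟ S v
    ... | yes _ = refl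
    ... | no ¬p = contradiction p ¬p

    cut-across : ∀ b {v} → S (σ Γ (col b) v) ≢ S v → cut b (old v) ≡ z (S v)
    cut-across b {v} p with S (σ Γ (col b) v) 𝔹.≟ S v
    ... | yes q = contradiction q p
    ... | no _  = refl

    cut-z : ∀ b i → cut b (z i) ≡ old (pt b i)
    cut-z b true  = refl
    cut-z b false = refl

    cut-pt : ∀ b i → cut b (old (pt b i)) ≡ z i
    cut-pt b i = trans (cut-across b λ p → not-¬ {i} refl (sym
      (trans (sym (S-pt b (not i))) (trans (cong S (sym (pt-edge′ b i))) (trans p (S-pt b i))))))
      (cong z (S-pt b i))

    cut-invol : ∀ b x → cut b (cut b x) ≡ x
    cut-invol b zero          = cut-pt b true
    cut-invol b (suc zero)    = cut-pt b false
    cut-invol b (suc (suc v)) = case S (σ Γ (col b) v) 𝔹.≟ S v of λ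
      { (yes p) → trans (cong (cut b) (cut-inside b p))
          (trans (cut-inside b (trans (cong S (invol Γ _ v)) (sym p))) (cong old (invol Γ _ v)))
      ; (no p) → trans (cong (cut b) (cut-across b p)) (trans (cut-z b (S v)) (cong old (sym (cross b v p)))) }

    cut-loopless : ∀ b x → cut b x ≢ x
    cut-loopless b zero          ()
    cut-loopless b (suc zero)    ()
    cut-loopless b (suc (suc v)) p = case S (σ Γ (col b) v) 𝔹.≟ S v of λ
      { (yes q) → loopless Γ _ v (Fin.suc-injective (Fin.suc-injective (trans (sym (cut-inside b q)) p)))
      ; (no q) → z≢old (S v) (trans (sym (cut-across b q)) p) }
      where
      z≢old : ∀ i → z i ≢ old v
      z≢old true  ()
      z≢old false ()

    cut₂-invol : ∀ x → cut₂ (cut₂ x) ≡ x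
    cut₂-invol zero          = refl
    cut₂-invol (suc zero)    = refl
    cut₂-invol (suc (suc v)) = cong old (invol Γ c2 v)

    cut₂-loopless : ∀ x → cut₂ x ≢ x
    cut₂-loopless zero          ()
    cut₂-loopless (suc zero)    ()
    cut₂-loopless (suc (suc v)) = loopless Γ c2 v ∘ Fin.suc-injective ∘ Fin.suc-injective

  Γ̄ : CGraph
  Γ̄ = record
    { size = 2 + size Γ
    ; σ = λ { zero → cut false ; (suc zero) → cut true ; (suc (suc zero)) → cut₂ }
    ; invol = λ { zero → cut-invol false ; (suc zero) → cut-invol true ; (suc (suc zero)) → cut₂-invol }
    ; loopless = λ { zero → cut-loopless false ; (suc zero) → cut-loopless true
                   ; (suc (suc zero)) → cut₂-loopless } }

  private
    σ≡cut : ∀ b x → σ Γ̄ (col b) x ≡ cut b x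
    σ≡cut false x = refl
    σ≡cut true  x = refl

  σ̄-inside : ∀ b {v} → S (σ Γ (col b) v) ≡ S v → σ Γ̄ (col b) (old v) ≡ old (σ Γ (col b) v)
  σ̄-inside b p = trans (σ≡cut b _) (cut-inside b p)

  σ̄-pt : ∀ b i → σ Γ̄ (col b) (old (pt b i)) ≡ z i
  σ̄-pt b i = trans (σ≡cut b _) (cut-pt b i)

  σ̄-z : ∀ b i → σ Γ̄ (col b) (z i) ≡ old (pt b i)
  σ̄-z b i = ς-flip ⌊ Γ̄ ⌋ {col b} (σ̄-pt b i)

  z≢old : ∀ i {v} → z i ≢ old v
  z≢old true  ()
  z≢old false ()

  old-off : ∀ {v} → Off z (old v)
  old-off i p = z≢old i (sym p)

  old-injective : ∀ {u v} → old u ≡ old v → u ≡ v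
  old-injective = Fin.suc-injective ∘ Fin.suc-injective

  S̄ : Fin (size Γ̄) → Bool
  S̄ zero          = true
  S̄ (suc zero)    = false
  S̄ (suc (suc v)) = S v

  S̄-z : ∀ i → S̄ (z i) ≡ i
  S̄-z true  = refl
  S̄-z false = refl

  data View : Fin (size Γ̄) → Set where
    isZ   : ∀ i → View (z i)
    isOld : ∀ v → View (old v)

  view : ∀ x → View x
  view zero          = isZ true
  view (suc zero)    = isZ false
  view (suc (suc v)) = isOld v

  S̄-closed : ∀ b x → S̄ (σ Γ̄ (col b) x) ≡ S̄ x
  S̄-closed b x with view x
  ... | isZ i = trans (cong S̄ (σ̄-z b i)) (trans (S-pt b i) (sym (S̄-z i)))
  ... | isOld v with S (σ Γ (col b) v) 𝔹.≟ S v
  ...   | yes p = trans (cong S̄ (σ̄-inside b p)) p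
  ...   | no p  = trans (cong S̄ (trans (σ≡cut b _) (cut-across b p))) (S̄-z (S v))

  sz : Smoothing ⌊ Γ̄ ⌋ z ⌊ Γ ⌋
  sz = record
    { distinct = λ ()
    ; g = g̃
    ; g-inj = λ {x} {y} → inj x y
    ; lift = old
    ; lift-off = λ v → old-off
    ; g-lift = λ v → refl
    ; edge = λ c {x} → edge′ c x
    ; join = λ c i {x} → join′ c i x }
    where
    g̃ : Fin (size Γ̄) → Fin (size Γ)
    -- The values at the two new vertices are placeholders; `pt false true` is merely a vertex at
    -- hand.
    g̃ zero          = pt false true
    g̃ (suc zero)    = pt false true
    g̃ (suc (suc v)) = v

    inj : ∀ x y → Off z x → Off z y → g̃ x ≡ g̃ y → x ≡ y
    inj x y x∉ y∉ p with view x | view y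
    ... | isZ i   | _       = contradiction refl (x∉ i)
    ... | isOld u | isZ j   = contradiction refl (y∉ j)
    ... | isOld u | isOld v = cong old p

    edge-col : ∀ b v → Off z (σ Γ̄ (col b) (old v)) → σ Γ (col b) v ≡ g̃ (σ Γ̄ (col b) (old v))
    edge-col b v y∉ = case S (σ Γ (col b) v) 𝔹.≟ S v of λ
      { (yes p) → sym (cong g̃ (σ̄-inside b p))
      ; (no p) → contradiction (trans (σ≡cut b _) (cut-across b p)) (y∉ (S v)) }

    edge′ : ∀ c x → Off z x → Off z (σ Γ̄ c x) → σ Γ c (g̃ x) ≡ g̃ (σ Γ̄ c x)
    edge′ c x x∉ y∉ with view x
    ... | isZ i = contradiction refl (x∉ i)
    edge′ zero x x∉ y∉ | isOld v = edge-col false v y∉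
    edge′ (suc zero) x x∉ y∉ | isOld v = edge-col true v y∉
    edge′ (suc (suc zero)) x x∉ y∉ | isOld v = refl

    join-col : ∀ b i v → σ Γ̄ (col b) (old v) ≡ z i → σ Γ (col b) v ≡ g̃ (σ Γ̄ (col b) (z (not i)))
    join-col b i v p = trans (cong (σ Γ (col b)) (old-injective (trans (sym (ς-flip ⌊ Γ̄ ⌋ {col b} p)) (σ̄-z b i))))
      (trans (pt-edge′ b i) (cong g̃ (sym (σ̄-z b (not i)))))

    join′ : ∀ c i x → Off z x → σ Γ̄ c x ≡ z i → σ Γ c (g̃ x) ≡ g̃ (σ Γ̄ c (z (not i)))
    join′ c i x x∉ p with view x
    ... | isZ i = contradiction refl (x∉ i)
    join′ zero i x x∉ p | isOld v = join-col false i v p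
    join′ (suc zero) i x x∉ p | isOld v = join-col true i v p
    join′ (suc (suc zero)) i x x∉ p | isOld v = contradiction (sym p) (z≢old i)

  -- The new vertex `z true` is adjacent to both ends of the arc, so a colouring of Γ extends to Γ̄
  -- as soon as these ends have equal colours. An arc that stops at an even position satisfies this.
  module _ (β : Fin (size Γ) → Bool) (β-alt : ∀ c v → β (σ Γ c v) ≡ not (β v))
           (same : β (pt false true) ≡ β (pt true true)) where

    β̄ : Fin (size Γ̄) → Bool
    β̄ zero          = not (β (pt false true))
    β̄ (suc zero)    = β (pt false true)
    β̄ (suc (suc v)) = β v

    private
      β-false : ∀ b → β (pt b false) ≡ not (β (pt b true))
      β-false b = trans (cong β (sym (pt-edge b))) (β-alt _ _)

      β-z : ∀ b i → β̄ (z i) ≡ not (β (pt b i))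
      β-z false true  = refl
      β-z true  true  = cong not same
      β-z false false = sym (trans (cong not (β-false false)) (not-involutive _))
      β-z true  false = trans same (sym (trans (cong not (β-false true)) (not-involutive _)))

      alt-col : ∀ b x → β̄ (σ Γ̄ (col b) x) ≡ not (β̄ x)
      alt-col b x with view x
      ... | isZ i = trans (cong β̄ (σ̄-z b i)) (trans (sym (not-involutive _)) (cong not (sym (β-z b i))))
      ... | isOld v with S (σ Γ (col b) v) 𝔹.≟ S v
      ...   | yes p = trans (cong β̄ (σ̄-inside b p)) (β-alt _ v)
      ...   | no p  = trans (cong β̄ (trans (σ≡cut b _) (cut-across b p)))
                            (trans (β-z b (S v)) (cong (not ∘ β) (sym (cross b v p))))

    β̄-alt : ∀ c x → β̄ (σ Γ̄ c x) ≡ not (β̄ x)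
    β̄-alt zero = alt-col false
    β̄-alt (suc zero) = alt-col true
    β̄-alt (suc (suc zero)) x with view x
    ... | isZ true  = sym (not-involutive _)
    ... | isZ false = refl
    ... | isOld v   = β-alt c2 v

-- The chord at `a` has to cross the cut, since a simple cut pairs one vertex from each side.
module Glue {Γ : CGraph} (C : Cutting Γ) (a : Fin (size Γ))
            (Sa : Cutting.S C a ≡ true) (Sa′ : Cutting.S C (σ Γ c2 a) ≡ false) where
  open CutAlong C public

  w : Bool → Fin (size Γ̄)
  w = old ∘ ⟪ a , σ Γ c2 a ⟫

  private opaque
    glued : ∃[ Γ′ ] Smoothing ⌊ Γ̄ ⌋ w ⌊ Γ′ ⌋
    glued = smooth ⌊ Γ̄ ⌋ w (loopless Γ c2 a ∘ sym ∘ old-injective) (z true , λ i → z≢old true)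

  Γ′ : CGraph
  Γ′ = proj₁ glued

  sw : Smoothing ⌊ Γ̄ ⌋ w ⌊ Γ′ ⌋
  sw = proj₂ glued

  recut : Recut Γ Γ′
  recut = record
    { Γ̄ = Γ̄; S = S̄; S-closed = S̄-closed; z = z; w = w; S-z = S̄-z
    ; S-w = λ { true → Sa ; false → Sa′ }
    ; z-edge = refl; w-edge = refl; sz = sz; sw = sw }

  z-off : ∀ i → Off w (z i)
  z-off i j = z≢old i

  old-off-w : ∀ {v} → v ≢ a → v ≢ σ Γ c2 a → Off w (old v)
  old-off-w p q true  = p ∘ old-injective
  old-off-w p q false = q ∘ old-injective

-- Splitting off a crosscap

Alternating : (Γ : CGraph) → (Fin (size Γ) → Bool) → Set
Alternating Γ β = ∀ b v → β (σ Γ (col b) v) ≡ not (β v)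

Colouring : (Γ : CGraph) → (Fin (size Γ) → Bool) → Set
Colouring Γ β = ∀ c v → β (σ Γ c v) ≡ not (β v)

xor-cancel : ∀ {x y} → x xor y ≡ y → x ≡ false
xor-cancel {false} _ = refl
xor-cancel {true} {true} ()
xor-cancel {true} {false} ()

pair-size : ∀ {Γ : CGraph} {x y} → (∀ v → v ≡ x ⊎ v ≡ y) → size Γ ≤ 2
pair-size {Γ} {x} {y} cover = Fin.injective⇒≤ {f = f} f-inj
  where
  f : Fin (size Γ) → Fin 2
  f v = [ (λ _ → zero) , (λ _ → suc zero) ]′ (cover v)
  f-inj : ∀ {u v} → f u ≡ f v → u ≡ v
  f-inj {u} {v} p with cover u | cover v
  ... | inj₁ q | inj₁ r = trans q (sym r)
  ... | inj₂ q | inj₂ r = trans q (sym r)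
  f-inj () | inj₁ _ | inj₂ _
  f-inj () | inj₂ _ | inj₁ _

-- The two ends of a double edge in colours `col b` and 2 form a set closed under both, which would
-- be the whole graph.
no-double-edge : ∀ {Γ} b → Conn ⌊ Γ ⌋ (col b) c2 → 3 ≤ size Γ → ∀ x → σ Γ (col b) x ≢ σ Γ c2 x
no-double-edge {Γ} b conn 3≤ x p = ℕ.<⇒≱ 3≤ (pair-size {Γ} cover)
  where
  Q : Fin (size Γ) → Set
  Q v = v ≡ x ⊎ v ≡ σ Γ c2 x

  Q? : Decidable Q
  Q? v = (v Fin.≟ x) ⊎-dec (v Fin.≟ σ Γ c2 x)

  cover : ∀ v → Q v
  cover v with Q? v in eq
  ... | yes q = q
  ... | no _ = case trans (sym (dec-true (Q? x) (inj₁ refl)))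
      (trans (conn (does ∘ Q?)
        (does-closed Γ (col b) Q? λ { (inj₁ refl) → inj₂ p ; (inj₂ refl) → inj₁ (ς-flip ⌊ Γ ⌋ p) })
        (does-closed Γ c2 Q? λ { (inj₁ refl) → inj₂ refl ; (inj₂ refl) → inj₁ (invol Γ c2 x) }) x v)
        (cong does eq)) of λ ()

-- The vertex x sits in a copy of 𝒫₁ minus a vertex, a triangle with its two
-- neighbours along colours 0 and 1.
Crosscap : (Γ : CGraph) → Fin (size Γ) → Set
Crosscap Γ x = σ Γ c2 (σ Γ c1 x) ≡ σ Γ c0 x

-- The two base vertices without the apex `x`, indexed so that index `b` is the neighbour of `x`
-- along `col b`. This is the pair whose deletion removes the crosscap.
triangle : (Γ : CGraph) → Fin (size Γ) → Bool → Fin (size Γ)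
triangle Γ x = ⟪ σ Γ c1 x , σ Γ c0 x ⟫

module _ {Γ Γ₂ : CGraph} {x} (cap : Crosscap Γ x) (s : Smoothing ⌊ Γ ⌋ (triangle Γ x) ⌊ Γ₂ ⌋) where
  private
    pattern v₁ = zero
    pattern v₂ = suc zero
    pattern v₃ = suc (suc zero)
    pattern v₄ = suc (suc (suc zero))

    c c′ : Fin (size Γ)
    c  = σ Γ c1 x
    c′ = σ Γ c0 x

    x-off : Off (triangle Γ x) x
    x-off = off-⟪⟫ (loopless Γ c1 x ∘ sym) (loopless Γ c0 x ∘ sym)

    c≢c′ : c ≢ c′
    c≢c′ = distinct s

    a : Bool → Fin 4 ⊎ Fin (size Γ₂)
    a = ⟪ inj₁ v₄ , inj₂ (g s x) ⟫

    embed : Fin 4 ⊎ Fin (size Γ₂) → Fin (size Γ)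
    embed (inj₁ v₁) = x
    embed (inj₁ v₂) = c′
    embed (inj₁ v₃) = c
    embed (inj₁ v₄) = x
    embed (inj₂ i)  = lift s i

    lift-≢x : ∀ {i} → Off a (inj₂ i) → lift s i ≢ x
    lift-≢x i∉ p = i∉ false (cong inj₂ (trans (sym (g-lift s _)) (cong (g s) p)))

    embed-inj : ∀ {u v} → Off a u → Off a v → embed u ≡ embed v → u ≡ v
    embed-inj {inj₁ v₄} u∉ _ _ = contradiction refl (u∉ true)
    embed-inj {_} {inj₁ v₄} _ v∉ _ = contradiction refl (v∉ true)
    embed-inj {inj₁ v₁} {inj₁ v₁} _ _ _ = refl
    embed-inj {inj₁ v₁} {inj₁ v₂} _ _ p = contradiction (sym p) (loopless Γ c0 x)
    embed-inj {inj₁ v₁} {inj₁ v₃} _ _ p = contradiction (sym p) (loopless Γ c1 x)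
    embed-inj {inj₁ v₂} {inj₁ v₁} _ _ p = contradiction p (loopless Γ c0 x)
    embed-inj {inj₁ v₂} {inj₁ v₂} _ _ _ = refl
    embed-inj {inj₁ v₂} {inj₁ v₃} _ _ p = contradiction (sym p) c≢c′
    embed-inj {inj₁ v₃} {inj₁ v₁} _ _ p = contradiction p (loopless Γ c1 x)
    embed-inj {inj₁ v₃} {inj₁ v₂} _ _ p = contradiction p c≢c′
    embed-inj {inj₁ v₃} {inj₁ v₃} _ _ _ = refl
    embed-inj {inj₁ v₁} {inj₂ i} _ i∉ p = contradiction (sym p) (lift-≢x i∉)
    embed-inj {inj₁ v₂} {inj₂ i} _ _ p = contradiction (sym p) (lift-off s i false)
    embed-inj {inj₁ v₃} {inj₂ i} _ _ p = contradiction (sym p) (lift-off s i true)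
    embed-inj {inj₂ i} {inj₁ v₁} i∉ _ p = contradiction p (lift-≢x i∉)
    embed-inj {inj₂ i} {inj₁ v₂} _ _ p = contradiction p (lift-off s i false)
    embed-inj {inj₂ i} {inj₁ v₃} _ _ p = contradiction p (lift-off s i true)
    embed-inj {inj₂ i} {inj₂ j} _ _ p =
      cong inj₂ (trans (sym (g-lift s i)) (trans (cong (g s) p) (g-lift s j)))

    preimage : ∀ v → ∃[ u ] (Off a u × embed u ≡ v)
    preimage v with locate ⌊ Γ ⌋ (triangle Γ x) v
    ... | inj₁ (true , p)  = inj₁ v₃ , off₁ (λ ()) , sym p
    ... | inj₁ (false , p) = inj₁ v₂ , off₁ (λ ()) , sym p
    ... | inj₂ v∉ with v Fin.≟ x
    ...   | yes p  = inj₁ v₁ , off₁ (λ ()) , sym p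
    ...   | no v≢x = inj₂ (g s v) , off₂ (v≢x ∘ g-inj s v∉ x-off) , lift-g s v∉

    σ₂ : ∀ c {i} → Off (triangle Γ x) (σ Γ c (lift s i)) → lift s (σ Γ₂ c i) ≡ σ Γ c (lift s i)
    σ₂ c {i} y∉ = trans (cong (lift s ∘ σ Γ₂ c) (sym (g-lift s i)))
      (trans (cong (lift s) (edge s c (lift-off s i) y∉)) (lift-g s y∉))

    σ₂-join : ∀ c k {i} → σ Γ c (lift s i) ≡ triangle Γ x k →
              lift s (σ Γ₂ c i) ≡ σ Γ c (triangle Γ x (not k))
    σ₂-join c k {i} p = trans (cong (lift s ∘ σ Γ₂ c) (sym (g-lift s i)))
      (trans (cong (lift s) (join s c k (lift-off s i) p)) (lift-g s (joined-off s (lift-off s i) p)))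

    flip : ∀ {c u v} → σ Γ c u ≡ v → σ Γ c v ≡ u
    flip = ς-flip ⌊ Γ ⌋

    attached : Colour → Fin (size Γ)
    attached c = embed (inj₁ (K4-σ c v₄))

    exits : ∀ c i → lift s i ≢ x →
            (lift s (σ Γ₂ c i) ≡ σ Γ c (lift s i) × lift s (σ Γ₂ c i) ≢ x) ⊎
            (σ Γ c (lift s i) ≡ attached c × lift s (σ Γ₂ c i) ≡ x)
    exits c i i≢ with locate ⌊ Γ ⌋ (triangle Γ x) (σ Γ c (lift s i)) | σ Γ c (lift s i) Fin.≟ x
    exits zero i i≢ | inj₁ (true , p) | _ = inj₂ (p , trans (σ₂-join c0 true p) (invol Γ c0 x))
    exits zero i i≢ | inj₁ (false , p) | _ = contradiction (trans (sym (flip p)) (invol Γ c0 x)) i≢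
    exits zero i i≢ | inj₂ y∉ | yes p = contradiction (sym (flip p)) (lift-off s i false)
    exits zero i i≢ | inj₂ y∉ | no y≢ = inj₁ (σ₂ c0 y∉ , y≢ ∘ trans (sym (σ₂ c0 y∉)))
    exits (suc zero) i i≢ | inj₁ (true , p) | _ = contradiction (trans (sym (flip p)) (invol Γ c1 x)) i≢
    exits (suc zero) i i≢ | inj₁ (false , p) | _ = inj₂ (p , trans (σ₂-join c1 false p) (invol Γ c1 x))
    exits (suc zero) i i≢ | inj₂ y∉ | yes p = contradiction (sym (flip p)) (lift-off s i true)
    exits (suc zero) i i≢ | inj₂ y∉ | no y≢ = inj₁ (σ₂ c1 y∉ , y≢ ∘ trans (sym (σ₂ c1 y∉)))
    exits (suc (suc zero)) i i≢ | inj₁ (true , p) | _ = contradiction (trans (sym (flip p)) cap) (lift-off s i false)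
    exits (suc (suc zero)) i i≢ | inj₁ (false , p) | _ =
      contradiction (trans (sym (flip p)) (flip cap)) (lift-off s i true)
    exits (suc (suc zero)) i i≢ | inj₂ y∉ | yes p = inj₂ (p , trans (σ₂ c2 y∉) p)
    exits (suc (suc zero)) i i≢ | inj₂ y∉ | no y≢ = inj₁ (σ₂ c2 y∉ , y≢ ∘ trans (sym (σ₂ c2 y∉)))

    σ₂-x : ∀ c → lift s (σ Γ₂ c (g s x)) ≡ σ Γ c (attached c)
    σ₂-x zero = σ₂-join c0 false (cong (σ Γ c0) (lift-g s x-off))
    σ₂-x (suc zero) = σ₂-join c1 true (cong (σ Γ c1) (lift-g s x-off))
    σ₂-x (suc (suc zero)) =
      trans (σ₂ c2 (off-⟪⟫ (λ p → loopless Γ c0 x (sym (trans (sym (flip (trans (sym p′) p))) cap)))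
                           (λ p → loopless Γ c1 x (sym (trans (sym (flip (trans (sym p′) p))) (flip cap))))))
            p′
      where
      p′ : σ Γ c2 (lift s (g s x)) ≡ σ Γ c2 x
      p′ = cong (σ Γ c2) (lift-g s x-off)

    embed-edge : ∀ c {u} → Off a u → Off a (ς (⌊ 𝒫₁ ⌋ ⊔ ⌊ Γ₂ ⌋) c u) →
                 σ Γ c (embed u) ≡ embed (ς (⌊ 𝒫₁ ⌋ ⊔ ⌊ Γ₂ ⌋) c u)
    embed-edge c {inj₁ v₄} u∉ _ = contradiction refl (u∉ true)
    embed-edge zero             {inj₁ v₁} _ _  = refl
    embed-edge zero             {inj₁ v₂} _ _  = invol Γ c0 x
    embed-edge zero             {inj₁ v₃} _ y∉ = contradiction refl (y∉ true)
    embed-edge (suc zero)       {inj₁ v₁} _ _  = refl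
    embed-edge (suc zero)       {inj₁ v₂} _ y∉ = contradiction refl (y∉ true)
    embed-edge (suc zero)       {inj₁ v₃} _ _  = invol Γ c1 x
    embed-edge (suc (suc zero)) {inj₁ v₁} _ y∉ = contradiction refl (y∉ true)
    embed-edge (suc (suc zero)) {inj₁ v₂} _ _  = flip cap
    embed-edge (suc (suc zero)) {inj₁ v₃} _ _  = cap
    embed-edge c {inj₂ i} i∉ y∉ with exits c i (lift-≢x i∉)
    ... | inj₁ (p , _) = sym p
    ... | inj₂ (_ , p) = contradiction p (lift-≢x y∉)

    embed-join : ∀ c k {u} → Off a u → ς (⌊ 𝒫₁ ⌋ ⊔ ⌊ Γ₂ ⌋) c u ≡ a k →
                 σ Γ c (embed u) ≡ embed (ς (⌊ 𝒫₁ ⌋ ⊔ ⌊ Γ₂ ⌋) c (a (not k)))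
    embed-join c true {inj₁ v} _ p with refl ← ς-flip ⌊ 𝒫₁ ⌋ {c} {v} (inj₁-injective p) = sym (σ₂-x c)
    embed-join c false {inj₂ i} i∉ p with exits c i (lift-≢x i∉)
    ... | inj₁ (_ , q) = contradiction (trans (cong (lift s) (inj₂-injective p)) (lift-g s x-off)) q
    ... | inj₂ (q , _) = q

  -- The edges leaving the triangle have colour 2 at `x`, colour 0 at `c` and colour 1 at `c′`.
  -- After the base is deleted all three end at `x`, so `x` in Γ₂ is the vertex to which the
  -- triangle shrinks; `v₄` of 𝒫₁ stands for the outside.
  crosscap-sum : Sum 𝒫₁ Γ₂ (suc (suc (suc zero))) (g s x) Γ
  crosscap-sum = record
    { distinct = λ ()
    ; g = embed
    ; g-inj = embed-inj
    ; lift = proj₁ ∘ preimage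
    ; lift-off = proj₁ ∘ proj₂ ∘ preimage
    ; g-lift = proj₂ ∘ proj₂ ∘ preimage
    ; edge = embed-edge
    ; join = embed-join }

-- Glueing along the chord at a after cutting off the arc from a to the second
-- vertex before its partner creates a crosscap and deletes the chord.
record CrosscapSplit (Γ : CGraph) (a : Fin (size Γ)) : Set where
  field
    {Γ′ Γ₂} : CGraph
    recut   : Recut Γ Γ′
    x       : Fin (size Γ′)
    cap     : Crosscap Γ′ x
    s′      : Smoothing ⌊ Γ′ ⌋ (triangle Γ′ x) ⌊ Γ₂ ⌋
    s       : Smoothing ⌊ Γ ⌋ ⟪ a , σ Γ c2 a ⟫ ⌊ Γ₂ ⌋

module _ {Γ : CGraph} (C : Cutting Γ) where
  open Cutting C
  private
    a x : Fin (size Γ)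
    a = pt true true
    x = pt false false

  module _ (Sa′ : S (σ Γ c2 a) ≡ false) (σ-x : σ Γ c1 x ≡ σ Γ c2 a) where
    open Glue C a (S-pt true true) Sa′

    private
      p : Fin (size Γ̄) → Fin (size Γ′)
      p = g sw

      x-off : Off w (old x)
      x-off = old-off-w
        (λ q → case trans (sym (S-pt true true)) (trans (cong S (sym q)) (S-pt false false)) of λ ())
        (λ q → loopless Γ c1 x (trans σ-x (sym q)))

      σ′₀ : σ Γ′ c0 (p (old x)) ≡ p (z false)
      σ′₀ = trans (edge sw c0 x-off (subst (Off w) (sym (σ̄-pt false false)) (z-off false)))
                  (cong p (σ̄-pt false false))

      σ̄-x : σ Γ̄ c1 (old x) ≡ w false
      σ̄-x = trans (σ̄-inside true (trans (cong S σ-x) (trans Sa′ (sym (S-pt false false))))) (cong old σ-x)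

      σ′₁ : σ Γ′ c1 (p (old x)) ≡ p (z true)
      σ′₁ = trans (join sw c1 false x-off σ̄-x) (cong p (σ̄-pt true true))

      cap : Crosscap Γ′ (p (old x))
      cap = trans (cong (σ Γ′ c2) σ′₁) (trans (edge sw c2 (z-off true) (z-off false)) (sym σ′₀))

      p-z : p ∘ z ≗ triangle Γ′ (p (old x))
      p-z true  = sym σ′₁
      p-z false = sym σ′₀

      smoothed : ∃[ Γ₂ ] Smoothing ⌊ Γ′ ⌋ (p ∘ z) ⌊ Γ₂ ⌋
      smoothed = smooth ⌊ Γ′ ⌋ (p ∘ z)
        (λ q → case g-inj sw (z-off true) (z-off false) q of λ ())
        (p (old x) , λ k q → z≢old k (sym (g-inj sw x-off (z-off k) q)))

    -- In Γ̄ the vertex `x` has neighbours `z false` along colour 0 and `a′`, the partner of `a`,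
    -- along colour 1. Glueing at `a`, `a′` turns the latter edge into one to `z true`, giving the
    -- triangle. As its base is the pair `z`, `smoothing-comm` equates deleting it from Γ′ with
    -- deleting `a`, `a′` from Γ.
    crosscap-glue : CrosscapSplit Γ a
    crosscap-glue = record
      { recut = recut; x = p (old x); cap = cap
      ; s′ = smoothing-≗ p-z (proj₂ smoothed)
      ; s = smoothing-≗ (λ { true → refl ; false → refl })
              (smoothing-comm sw sz (λ k i → z-off k i) (proj₂ smoothed)) }

opaque
  -- Counted from `a`, the partner sits at an even position j ≥ 2. The arc stops at j - 2, again
  -- even, and `x` is the vertex at j - 1, whose edge to position j has colour 1.
  crosscap-split : ∀ {Γ} → Conn ⌊ Γ ⌋ c0 c1 → ∀ {β} → Alternating Γ β →
                   ∀ a → β (σ Γ c2 a) ≡ β a → CrosscapSplit Γ a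
  crosscap-split {Γ} conn {β} β-alt a same = go (pos a′) refl even
    where
    open Cycle Γ a conn
    a′ : Fin (size Γ)
    a′ = σ Γ c2 a

    even : odd (pos a′) ≡ false
    even = xor-cancel (trans (sym (walk-alternates β β-alt (pos a′))) (trans (cong β (walk-pos a′)) same))

    go : ∀ j → pos a′ ≡ j → odd j ≡ false → CrosscapSplit Γ a
    go zero p _ = contradiction (pos-injective (trans p (sym pos-r))) (loopless Γ c2 a)
    go (suc zero) _ ()
    go (suc (suc i)) pos-a′ even-j = subst (CrosscapSplit Γ) pt-start
      (crosscap-glue cutting
        (S-out (subst (i <_) (sym (trans (cong (pos ∘ σ Γ c2) pt-start) pos-a′)) (ℕ.m≤n+m (suc i) 1)))
        (trans (cong (σ Γ c1) pt-next)
          (trans (cong (λ b → σ Γ (col b) (walk (suc i))) (sym (cong not even-i)))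
          (trans (cong walk (sym pos-a′)) (trans (walk-pos a′) (cong (σ Γ c2) (sym pt-start)))))))
      where
      even-i : odd i ≡ false
      even-i = trans (sym (not-involutive _)) even-j

      open Arc (arc conn i even-i (ℕ.<⇒≤ (subst (_< N) pos-a′ (pos<N a′))))

-- A crosscap next to an orientable piece can be absorbed: if Γ₂ is bipartite,
-- deleting the chord at x instead of the crosscap's own chord leaves a
-- non-bipartite graph.  Two colourings β₂, β₃ would make their difference T
-- constant along colours 1 and 2 of Γ₂, but it changes between the two
-- neighbours of x.
module _ {Γ Γ₂ Γ₃ : CGraph} {x} (cap : Crosscap Γ x)
         (s : Smoothing ⌊ Γ ⌋ (triangle Γ x) ⌊ Γ₂ ⌋)
         (conn : ∀ b → Conn ⌊ Γ₂ ⌋ (col b) c2) (3≤ : 3 ≤ size Γ₂)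
         {β₂} (β₂-col : Colouring Γ₂ β₂)
         (h : Smoothing ⌊ Γ ⌋ ⟪ x , σ Γ c2 x ⟫ ⌊ Γ₃ ⌋)
         {β₃} (β₃-col : Colouring Γ₃ β₃) where
  private
    flip : ∀ {c u v} → σ Γ c u ≡ v → σ Γ c v ≡ u
    flip = ς-flip ⌊ Γ ⌋

    k : Fin (size Γ) → Fin (size Γ₂)
    k = g s

    tri : Bool → Fin (size Γ)
    tri = triangle Γ x

    x′ c c′ : Fin (size Γ)
    x′ = σ Γ c2 x
    c  = σ Γ c1 x
    c′ = σ Γ c0 x

    x-off : Off tri x
    x-off = off-⟪⟫ (loopless Γ c1 x ∘ sym) (loopless Γ c0 x ∘ sym)

    x′-off : Off tri x′
    x′-off = off-⟪⟫ (λ p → loopless Γ c0 x (sym (trans (sym (flip p)) cap)))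
                    (λ p → loopless Γ c1 x (sym (trans (sym (flip p)) (flip cap))))

    X X′ : Fin (size Γ₂)
    X  = k x
    X′ = σ Γ₂ c2 X

    k-x′ : k x′ ≡ X′
    k-x′ = sym (edge s c2 x-off x′-off)

    Pair : Fin (size Γ₂) → Set
    Pair = Off ⟪ X , X′ ⟫

    n m : Bool → Fin (size Γ₂)
    n b = σ Γ₂ (col b) X
    m b = σ Γ₂ (col b) X′

    n-off : ∀ b → Pair (n b)
    n-off b = off-⟪⟫ (loopless Γ₂ (col b) X) (no-double-edge {Γ₂} b (conn b) 3≤ X)

    m-off : ∀ b → Pair (m b)
    m-off b = off-⟪⟫ (λ p → no-double-edge {Γ₂} b (conn b) 3≤ X (ς-flip ⌊ Γ₂ ⌋ p)) (loopless Γ₂ (col b) X′)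

    outside : ∀ {v} → Pair v → Off ⟪ x , x′ ⟫ (lift s v)
    outside v∉ = off-⟪⟫ (λ p → v∉ true (trans (sym (g-lift s _)) (cong k p)))
                        (λ p → v∉ false (trans (sym (g-lift s _)) (trans (cong k p) k-x′)))

    c-outside : ∀ i → Off ⟪ x , x′ ⟫ (tri i)
    c-outside i = off-⟪⟫ (λ p → x-off i (sym p)) (λ p → x′-off i (sym p))

    γ : Fin (size Γ) → Bool
    γ v = β₃ (g h v)

    γ-flip : ∀ e {v} → Off ⟪ x , x′ ⟫ v → Off ⟪ x , x′ ⟫ (σ Γ e v) → γ (σ Γ e v) ≡ not (γ v)
    γ-flip e v∉ y∉ = trans (cong β₃ (sym (edge h e v∉ y∉))) (β₃-col e _)

    lift-n₀ : lift s (n false) ≡ σ Γ c0 c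
    lift-n₀ = trans (cong (lift s) (join s c0 false x-off refl)) (lift-g s (joined-off s {c0} {false} x-off refl))

    lift-n₁ : lift s (n true) ≡ σ Γ c1 c′
    lift-n₁ = trans (cong (lift s) (join s c1 true x-off refl)) (lift-g s (joined-off s {c1} {true} x-off refl))

    lift-m : ∀ b → lift s (m b) ≡ σ Γ (col b) x′
    lift-m b = trans (cong (lift s ∘ σ Γ₂ (col b)) (sym k-x′))
      (trans (cong (lift s) (edge s (col b) x′-off (y∉ b))) (lift-g s (y∉ b)))
      where
      y∉ : ∀ b → Off tri (σ Γ (col b) x′)
      y∉ false false p = loopless Γ c2 x (sym (trans (sym (invol Γ c0 x)) (flip p)))
      y∉ true  true  p = loopless Γ c2 x (sym (trans (sym (invol Γ c1 x)) (flip p)))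
      y∉ false true  p = n-off false false
        (trans (sym (g-lift s _)) (trans (cong k (trans lift-n₀ (flip p))) k-x′))
      y∉ true  false p = n-off true false
        (trans (sym (g-lift s _)) (trans (cong k (trans lift-n₁ (flip p))) k-x′))

    γ-c′ : γ c′ ≡ not (γ c)
    γ-c′ = trans (cong γ (sym cap)) (γ-flip c2 (c-outside true) (subst (Off _) (sym cap) (c-outside false)))

    γ-n₀ : γ (lift s (n false)) ≡ not (γ c)
    γ-n₀ = trans (cong γ lift-n₀) (γ-flip c0 (c-outside true) (subst (Off _) lift-n₀ (outside (n-off false))))

    γ-n₁ : γ (lift s (n true)) ≡ γ c
    γ-n₁ = trans (cong γ lift-n₁) (trans
      (γ-flip c1 (c-outside false) (subst (Off _) lift-n₁ (outside (n-off true))))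
      (trans (cong not γ-c′) (not-involutive _)))

    γ-m₁ : γ (lift s (m true)) ≡ not (γ c)
    γ-m₁ = trans (cong γ (lift-m true)) (trans
      (cong β₃ (sym (join h c1 true (c-outside true) (invol Γ c1 x)))) (β₃-col c1 _))

    β-n : ∀ b → β₂ (n b) ≡ not (β₂ X)
    β-n b = β₂-col (col b) X

    β-m : ∀ b → β₂ (m b) ≡ β₂ X
    β-m b = trans (β₂-col (col b) X′) (trans (cong not (β₂-col c2 X)) (not-involutive _))

    T₀ T : Fin (size Γ₂) → Bool
    T₀ v = β₂ v xor γ (lift s v)
    T v with off? ⌊ Γ₂ ⌋ ⟪ X , X′ ⟫ v
    ... | yes _ = T₀ v
    -- On the pair X, X′ the value is forced by the colour-1 neighbour `m true` of X′; by `T₀-n₁`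
    -- the colour-1 neighbour of X agrees with it.
    ... | no _  = T₀ (m true)

    T-off : ∀ {v} → Pair v → T v ≡ T₀ v
    T-off {v} v∉ with off? ⌊ Γ₂ ⌋ ⟪ X , X′ ⟫ v
    ... | yes _ = refl
    ... | no ¬v = contradiction v∉ ¬v

    T-pair : ∀ i → T (⟪ X , X′ ⟫ i) ≡ T₀ (m true)
    T-pair i with off? ⌊ Γ₂ ⌋ ⟪ X , X′ ⟫ (⟪ X , X′ ⟫ i)
    ... | yes v∉ = contradiction refl (v∉ i)
    ... | no _   = refl

    xor-not-not : ∀ y z → not y xor not z ≡ y xor z
    xor-not-not false z = not-involutive z
    xor-not-not true  z = refl

    T₀-flip : ∀ e {v} → Pair v → Pair (σ Γ₂ e v) → lift s (σ Γ₂ e v) ≡ σ Γ e (lift s v) →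
              T₀ (σ Γ₂ e v) ≡ T₀ v
    T₀-flip e {v} v∉ y∉ p = trans
      (cong₂ _xor_ (β₂-col e v) (trans (cong γ p) (γ-flip e (outside v∉) (subst (Off _) p (outside y∉)))))
      (xor-not-not (β₂ v) _)

    -- Both colourings separate `n true` from `m true`: β₂ because X and X′ are adjacent, γ because
    -- `m true` is joined to `c` in Γ₃, while `n true` lies two edges beyond `c`. The two
    -- differences cancel.
    T₀-n₁ : T₀ (n true) ≡ T₀ (m true)
    T₀-n₁ = trans (cong₂ _xor_ (β-n true) γ-n₁)
      (trans (sym (xor-not-not (not (β₂ X)) (γ c)))
             (sym (cong₂ _xor_ (trans (β-m true) (sym (not-involutive _))) γ-m₁)))

    -- Under β₂ the two neighbours of X agree. Under γ they differ, being the ends of a path of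
    -- three edges through `c` and `c′`.
    T₀-n₀ : T₀ (n false) ≡ not (T₀ (n true))
    T₀-n₀ = trans (cong₂ _xor_ (β-n false) γ-n₀)
      (trans (sym (𝔹.not-distribʳ-xor (not (β₂ X)) (γ c))) (cong not (sym (cong₂ _xor_ (β-n true) γ-n₁))))

    lift-σ : ∀ e {v} → Off tri (σ Γ e (lift s v)) → lift s (σ Γ₂ e v) ≡ σ Γ e (lift s v)
    lift-σ e {v} y∉ = trans (cong (lift s ∘ σ Γ₂ e) (sym (g-lift s v)))
      (trans (cong (lift s) (edge s e (lift-off s v) y∉)) (lift-g s y∉))

    lift-≢x : ∀ {v} → Pair v → lift s v ≢ x
    lift-≢x v∉ = outside v∉ true

    lift-σ₁ : ∀ {v} → Pair v → Pair (σ Γ₂ c1 v) → lift s (σ Γ₂ c1 v) ≡ σ Γ c1 (lift s v)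
    lift-σ₁ {v} v∉ y∉ with locate ⌊ Γ ⌋ tri (σ Γ c1 (lift s v))
    ... | inj₂ z∉ = lift-σ c1 z∉
    ... | inj₁ (true , p) = contradiction (trans (sym (flip p)) (invol Γ c1 x)) (lift-≢x v∉)
    ... | inj₁ (false , p) = contradiction
      (trans (cong (σ Γ₂ c1) (sym (g-lift s v)))
        (trans (join s c1 false (lift-off s v) p) (cong k (invol Γ c1 x)))) (y∉ true)

    lift-σ₂ : ∀ {v} → lift s (σ Γ₂ c2 v) ≡ σ Γ c2 (lift s v)
    lift-σ₂ {v} = lift-σ c2 λ
      { true p → lift-off s v false (trans (sym (flip p)) cap)
      ; false p → lift-off s v true (trans (sym (flip p)) (flip cap)) }

    T₁ : ∀ v → T (σ Γ₂ c1 v) ≡ T v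
    T₁ v = case locate ⌊ Γ₂ ⌋ ⟪ X , X′ ⟫ v of λ
      { (inj₁ (true , refl)) → trans (T-off (n-off true)) (trans T₀-n₁ (sym (T-pair true)))
      ; (inj₁ (false , refl)) → trans (T-off (m-off true)) (sym (T-pair false))
      ; (inj₂ v∉) → case locate ⌊ Γ₂ ⌋ ⟪ X , X′ ⟫ (σ Γ₂ c1 v) of λ
        { (inj₁ (true , p)) → trans (cong T p) (trans (T-pair true) (trans (sym T₀-n₁)
            (trans (cong T₀ (ς-flip ⌊ Γ₂ ⌋ p)) (sym (T-off v∉)))))
        ; (inj₁ (false , p)) → trans (cong T p) (trans (T-pair false)
            (trans (cong T₀ (ς-flip ⌊ Γ₂ ⌋ p)) (sym (T-off v∉))))
        ; (inj₂ y∉) → trans (T-off y∉) (trans (T₀-flip c1 v∉ y∉ (lift-σ₁ v∉ y∉)) (sym (T-off v∉))) } }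

    T₂ : ∀ v → T (σ Γ₂ c2 v) ≡ T v
    T₂ v = case locate ⌊ Γ₂ ⌋ ⟪ X , X′ ⟫ v of λ
      { (inj₁ (true , refl)) → trans (T-pair false) (sym (T-pair true))
      ; (inj₁ (false , refl)) → trans (cong T (invol Γ₂ c2 X)) (trans (T-pair true) (sym (T-pair false)))
      ; (inj₂ v∉) → let y∉ = off-⟪⟫ (λ p → v∉ false (sym (ς-flip ⌊ Γ₂ ⌋ p)))
                                    (λ p → v∉ true (ς-injective ⌊ Γ₂ ⌋ p)) in
          trans (T-off y∉) (trans (T₀-flip c2 v∉ y∉ lift-σ₂) (sym (T-off v∉))) }

  dyck : ⊥
  dyck = not-¬ {T₀ (n true)} refl (sym (trans (sym T₀-n₀)
    (trans (sym (T-off (n-off false))) (trans (conn true T T₁ T₂ (n false) (n true)) (T-off (n-off true))))))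

-- With Γ₂ bipartite, the chord at x is orientable in Γ₂ but not in Γ.
module _ {Γ Γ₂ : CGraph} {x} (cap : Crosscap Γ x)
         (s : Smoothing ⌊ Γ ⌋ (triangle Γ x) ⌊ Γ₂ ⌋) {β₂} (β₂-col : Colouring Γ₂ β₂) where
  private
    X : Fin (size Γ₂)
    X = g s x

    x-off : Off (triangle Γ x) x
    x-off = off-⟪⟫ (loopless Γ c1 x ∘ sym) (loopless Γ c0 x ∘ sym)

  -- Along the polygon the single vertex X of Γ₂ becomes the three vertices `c`, `x`, `c′`.
  -- Alternation gives the outer two the colour of X and `x` the opposite one, so the chord at `x`
  -- now joins equal colours.
  twisted : Fin (size Γ) → Bool
  twisted v with locate ⌊ Γ ⌋ (triangle Γ x) v | v Fin.≟ x
  ... | inj₁ _ | _     = β₂ X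
  ... | inj₂ _ | yes _ = not (β₂ X)
  ... | inj₂ _ | no _  = β₂ (g s v)

  private
    tw-tri : ∀ i → twisted (triangle Γ x i) ≡ β₂ X
    tw-tri i with locate ⌊ Γ ⌋ (triangle Γ x) (triangle Γ x i)
    ... | inj₁ _  = refl
    ... | inj₂ v∉ = contradiction refl (v∉ i)

    tw-x : twisted x ≡ not (β₂ X)
    tw-x with locate ⌊ Γ ⌋ (triangle Γ x) x | x Fin.≟ x
    ... | inj₁ (i , p) | _     = contradiction p (x-off i)
    ... | inj₂ _       | yes _ = refl
    ... | inj₂ _       | no p  = contradiction refl p

    tw-off : ∀ {v} → Off (triangle Γ x) v → v ≢ x → twisted v ≡ β₂ (g s v)
    tw-off {v} v∉ v≢ with locate ⌊ Γ ⌋ (triangle Γ x) v | v Fin.≟ x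
    ... | inj₁ (i , p) | _     = contradiction p (v∉ i)
    ... | inj₂ _       | yes p = contradiction p v≢
    ... | inj₂ _       | no _  = refl

    at-x : ∀ b → triangle Γ x b ≡ σ Γ (col b) x
    at-x false = refl
    at-x true  = refl

    flip : ∀ {c u v} → σ Γ c u ≡ v → σ Γ c v ≡ u
    flip = ς-flip ⌊ Γ ⌋

    outer : ∀ b {v} → Off (triangle Γ x) v → σ Γ (col b) v ≡ triangle Γ x (not b) → β₂ (g s v) ≡ not (β₂ X)
    outer b v∉ p = trans (sym (not-involutive _)) (cong not
      (trans (sym (β₂-col (col b) _)) (cong β₂ (trans (join s (col b) (not b) v∉ p)
        (cong (g s) (trans (cong (σ Γ (col b)) (trans (cong (triangle Γ x) (not-involutive b)) (at-x b))) (invol Γ _ x)))))))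

    tw-edge : ∀ b v → Off (triangle Γ x) v → twisted (σ Γ (col b) v) ≡ not (twisted v)
    tw-edge b v v∉ = case v Fin.≟ x of λ
      { (yes refl) → trans (cong twisted (sym (at-x b)))
          (trans (tw-tri b) (trans (sym (not-involutive _)) (cong not (sym tw-x))))
      ; (no v≢) → case locate ⌊ Γ ⌋ (triangle Γ x) (σ Γ (col b) v) of λ
        { (inj₁ (i , p)) → case b 𝔹.≟ i of λ
          { (yes refl) → contradiction
              (trans (sym (flip p)) (trans (cong (σ Γ (col b)) (at-x b)) (invol Γ _ x))) v≢
          ; (no b≢i) → trans (cong twisted p) (trans (tw-tri i) (trans (sym (not-involutive _))
              (cong not (sym (trans (tw-off v∉ v≢)
                (outer b v∉ (trans p (cong (triangle Γ x) (¬-not (b≢i ∘ sym))))))))))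
          }
        ; (inj₂ y∉) → trans (tw-off y∉ λ p → v∉ b (trans (sym (flip p)) (sym (at-x b))))
            (trans (cong β₂ (sym (edge s (col b) v∉ y∉)))
              (trans (β₂-col _ _) (cong not (sym (tw-off v∉ v≢))))) } }

  twisted-alternating : Alternating Γ twisted
  twisted-alternating b v = case locate ⌊ Γ ⌋ (triangle Γ x) v of λ
    { (inj₂ v∉) → tw-edge b v v∉
    ; (inj₁ (i , p)) → trans (sym (not-involutive _)) (cong not (sym
        (trans (cong twisted (sym (invol Γ (col b) v))) (tw-edge b _ (away i p))))) }
    where
    away : ∀ i → v ≡ triangle Γ x i → Off (triangle Γ x) (σ Γ (col b) v)
    away i refl j p with b 𝔹.≟ i | b 𝔹.≟ j
    ... | yes refl | _ = x-off j (trans (sym (trans (cong (σ Γ (col b)) (at-x b)) (invol Γ _ x))) p)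
    ... | no _ | yes refl = x-off i (sym (ς-injective ⌊ Γ ⌋ {col b} (trans p (at-x b))))
    ... | no b≢i | no b≢j = loopless Γ (col b) _
      (trans p (cong (triangle Γ x) (trans (sym (not-involutive j)) (trans (cong not (sym (¬-not b≢j)))
        (trans (cong not (¬-not b≢i)) (not-involutive i))))))

  twisted-chord : twisted (σ Γ c2 x) ≡ twisted x
  twisted-chord = trans (tw-off x′-off (loopless Γ c2 x))
    (trans (cong β₂ (sym (edge s c2 x-off x′-off))) (trans (β₂-col c2 X) (sym tw-x)))
    where
    x′-off : Off (triangle Γ x) (σ Γ c2 x)
    x′-off = off-⟪⟫ (λ p → loopless Γ c0 x (sym (trans (sym (flip p)) cap)))
                    (λ p → loopless Γ c1 x (sym (trans (sym (flip p)) (flip cap))))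

-- Splitting off a handle

-- The colouring lives on Γ̄, from which it restricts to both ends. `lift-bipartite` needs it there,
-- to choose a vertex of prescribed colour away from both pairs.
BiRecut : CGraph → CGraph → Set
BiRecut Γ Γ′ = Σ (Recut Γ Γ′) λ r → ∃[ β ] Colouring (Recut.Γ̄ r) β

-- The ends of a chord have opposite colours, and so have their neighbours along any one other
-- colour, which are the vertices that get joined.
chord-colouring : ∀ {Γ̄ Γ a} (s : Smoothing ⌊ Γ̄ ⌋ a ⌊ Γ ⌋) → σ Γ̄ c2 (a true) ≡ a false →
                  ∀ {β} → Colouring Γ̄ β → Colouring Γ (β ∘ lift s)
chord-colouring {Γ̄} s chord {β} β-col c = descend s not β (β-col c) λ
  { true  → trans (cong β (sym chord)) (β-col c2 _)
  ; false → trans (cong β (sym (ς-flip ⌊ Γ̄ ⌋ chord))) (β-col c2 _) }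

recut-colouring : ∀ {Γ Γ′} ((r , β , _) : BiRecut Γ Γ′) → Colouring Γ′ (β ∘ lift (Recut.sw r))
recut-colouring (r , β , β-col) = chord-colouring (Recut.sw r) (Recut.w-edge r) β-col

-- Each neighbour of `v` is joined in Γ to a neighbour of `t`, which has the colour opposite to
-- `βB t`. Thus all neighbours of `v` have colour `βB t`, and `v` may take the other one.
sum-colouring : ∀ {B Γ₂ t v Γ} (s : Sum B Γ₂ t v Γ) {β βB} → Colouring Γ β → Colouring B βB →
                (∀ x → x ≢ t → β (g s (inj₁ x)) ≡ βB x) →
                ∃[ β₂ ] (Colouring Γ₂ β₂ × β₂ v ≡ not (βB t))
sum-colouring {B} {Γ₂} {t} {v} {Γ} s {β} {βB} β-col βB-col agree = β₂ , β₂-col , β₂-v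
  where
  β₂ : Fin (size Γ₂) → Bool
  β₂ i with i Fin.≟ v
  ... | yes _ = not (βB t)
  ... | no _  = β (g s (inj₂ i))

  β₂-v : β₂ v ≡ not (βB t)
  β₂-v with v Fin.≟ v
  ... | yes _ = refl
  ... | no p  = contradiction refl p

  β₂-off : ∀ {i} → i ≢ v → β₂ i ≡ β (g s (inj₂ i))
  β₂-off {i} i≢ with i Fin.≟ v
  ... | yes p = contradiction p i≢
  ... | no _  = refl

  β-nbr : ∀ c → β (g s (inj₂ (σ Γ₂ c v))) ≡ βB t
  β-nbr c = trans (cong β (sym (join s c true (off₁ (loopless B c t)) (cong inj₁ (invol B c t)))))
    (trans (β-col c _) (trans (cong not (agree _ (loopless B c t)))
      (trans (sym (βB-col c _)) (cong βB (invol B c t)))))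

  β₂-col : Colouring Γ₂ β₂
  β₂-col c i = case i Fin.≟ v of λ
    { (yes refl) → trans (β₂-off (loopless Γ₂ c i))
        (trans (β-nbr c) (trans (sym (not-involutive _)) (cong not (sym β₂-v))))
    ; (no i≢) → case σ Γ₂ c i Fin.≟ v of λ
      { (yes p) → trans (cong β₂ p) (trans β₂-v (cong not (sym
          (trans (β₂-off i≢) (trans (cong (β ∘ g s ∘ inj₂) (sym (ς-flip ⌊ Γ₂ ⌋ p))) (β-nbr c))))))
      ; (no y≢) → trans (β₂-off y≢) (trans (cong β (sym (edge s c (off₂ i≢) (off₂ y≢))))
          (trans (β-col c _) (cong not (sym (β₂-off i≢))))) } }

-- A four-cycle through `b` with colours 0, 1, 2, 1. On the polygon it is a chord that spans three
-- consecutive edges, with `b` and its colour-0 neighbour between its ends.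
Square : (Γ : CGraph) → Fin (size Γ) → Set
Square Γ b = σ Γ c2 (σ Γ c1 (σ Γ c0 b)) ≡ σ Γ c1 b

SquareSplit : CGraph → Set
SquareSplit Γ = ∃[ Γ′ ] (BiRecut Γ Γ′ × ∃ (Square Γ′))

module _ {Γ : CGraph} (C : Cutting Γ) where
  open Cutting C
  private
    a u : Fin (size Γ)
    a = pt true true
    u = pt false true

  module _ (σ-u : σ Γ c1 u ≡ σ Γ c2 a) (Sa′ : S (σ Γ c2 a) ≡ true)
           {v} (Sv : S v ≡ true) (Sv′ : S (σ Γ c2 v) ≡ false)
           (v≢a : v ≢ a) (v≢u : v ≢ u) (v≢a′ : v ≢ σ Γ c2 a)
           {β} (β-col : Colouring Γ β) (same : β u ≡ β a) where
    open Glue C v Sv Sv′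

    private
      p : Fin (size Γ̄) → Fin (size Γ′)
      p = g sw

      in-off : ∀ {x} → S x ≡ true → v ≢ x → Off w (old x)
      in-off Sx v≢x = old-off-w (v≢x ∘ sym) λ q → case trans (sym Sx) (trans (cong S q) Sv′) of λ ()

      a-off : Off w (old a)
      a-off = in-off (S-pt true true) v≢a

      a′-off : Off w (old (σ Γ c2 a))
      a′-off = in-off Sa′ v≢a′

      u-off : Off w (old u)
      u-off = in-off (S-pt false true) v≢u

      σ′-edge : ∀ c {x y} → Off w x → Off w y → σ Γ̄ c x ≡ y → σ Γ′ c (p x) ≡ p y
      σ′-edge c x∉ y∉ refl = edge sw c x∉ y∉

      square : Square Γ′ (p (z true))
      square = trans (cong (σ Γ′ c2) (trans (cong (σ Γ′ c1) (σ′-edge c0 (z-off true) u-off (σ̄-z false true)))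
          (σ′-edge c1 u-off a′-off (trans (σ̄-inside true (trans (cong S σ-u) (trans Sa′ (sym (S-pt false true)))))
                                          (cong old σ-u)))))
        (trans (σ′-edge c2 a′-off a-off (cong old (invol Γ c2 a)))
               (sym (σ′-edge c1 (z-off true) a-off (σ̄-z true true))))

    -- The arc runs from `a` to the vertex just past its partner, so that `z true`, `u`, the partner
    -- and `a` form a square in Γ̄. The chord at `v` crosses the cut and touches none of the four,
    -- so glueing along it keeps the square.
    square-glue : SquareSplit Γ
    square-glue = Γ′ , (recut , β̄ β β-col same , β̄-alt β β-col same) , p (z true) , square

record TorusSplit (Γ : CGraph) : Set where
  field
    {Γ′ Γ₂} : CGraph
    recut   : BiRecut Γ Γ′
    {v}     : Fin (size Γ₂)
    s       : Sum 𝒯₁ Γ₂ zero v Γ′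
    {β}     : Fin 6 → Bool
    β-col   : Colouring 𝒯₁ β
    {β₂}    : Fin (size Γ₂) → Bool
    β₂-col  : Colouring Γ₂ β₂
    β₂-v    : β₂ v ≡ not (β zero)

parity₆ : Bool → Fin 6 → Bool
parity₆ κ 0F = not κ
parity₆ κ 1F = κ
parity₆ κ 2F = not κ
parity₆ κ 3F = κ
parity₆ κ 4F = not κ
parity₆ κ 5F = κ

parity₆-col : ∀ κ → Colouring 𝒯₁ (parity₆ κ)
parity₆-col κ 0F 0F = sym (not-involutive κ)
parity₆-col κ 0F 1F = refl
parity₆-col κ 0F 2F = sym (not-involutive κ)
parity₆-col κ 0F 3F = refl
parity₆-col κ 0F 4F = sym (not-involutive κ)
parity₆-col κ 0F 5F = refl
parity₆-col κ 1F 0F = sym (not-involutive κ)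
parity₆-col κ 1F 1F = refl
parity₆-col κ 1F 2F = sym (not-involutive κ)
parity₆-col κ 1F 3F = refl
parity₆-col κ 1F 4F = sym (not-involutive κ)
parity₆-col κ 1F 5F = refl
parity₆-col κ 2F 0F = sym (not-involutive κ)
parity₆-col κ 2F 1F = refl
parity₆-col κ 2F 2F = sym (not-involutive κ)
parity₆-col κ 2F 3F = refl
parity₆-col κ 2F 4F = sym (not-involutive κ)
parity₆-col κ 2F 5F = refl

module _ {Γ : CGraph} (C : Cutting Γ) where
  open Cutting C
  private
    b b′ u a a′ : Fin (size Γ)
    b  = pt false false
    b′ = pt true true
    u  = pt false true
    a  = σ Γ c1 u
    a′ = σ Γ c2 a

  module _ (chord-b : σ Γ c2 b ≡ b′) (square : σ Γ c1 b ≡ a′) (b′≢u : b′ ≢ u)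
           (Sa : S a ≡ true) (Sa′ : S a′ ≡ false)
           {β} (β-col : Colouring Γ β) (same : β u ≡ β b′) where
    open Glue C a Sa Sa′

    private
      p : Fin (size Γ̄) → Fin (size Γ′)
      p = g sw

      S-≢ : ∀ {x y} → S x ≡ true → S y ≡ false → x ≢ y
      S-≢ Sx Sy refl = case trans (sym Sx) Sy of λ ()

      b′≢a : b′ ≢ a
      b′≢a q = S-≢ (S-pt false true) (S-pt true false)
        (trans (sym (invol Γ c1 u)) (trans (cong (σ Γ c1) (sym q)) (pt-edge true)))

      b′-off : Off w (old b′)
      b′-off = old-off-w b′≢a (S-≢ (S-pt true true) Sa′)

      u-off : Off w (old u)
      u-off = old-off-w (loopless Γ c1 u ∘ sym) (S-≢ (S-pt false true) Sa′)

      b-off : Off w (old b)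
      b-off = old-off-w (S-≢ Sa (S-pt false false) ∘ sym)
                        (λ q → loopless Γ c1 b (trans square (sym q)))

      path : Fin 6 → Fin (size Γ̄)
      -- A placeholder: v₁ of 𝒯₁ is the vertex at which the sum is taken.
      path 0F = old b′
      path 1F = old b′
      path 2F = z true
      path 3F = old u
      path 4F = old b
      path 5F = z false

      path-off : ∀ x → Off w (path x)
      path-off 0F = b′-off
      path-off 1F = b′-off
      path-off 2F = z-off true
      path-off 3F = u-off
      path-off 4F = b-off
      path-off 5F = z-off false

      b′≢b : b′ ≢ b
      b′≢b = S-≢ (S-pt true true) (S-pt false false)

      u≢b : u ≢ b
      u≢b = S-≢ (S-pt false true) (S-pt false false)

      path-inj : ∀ x y → x ≢ 0F → y ≢ 0F → path x ≡ path y → x ≡ y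
      path-inj 0F _ x≢ _ _ = contradiction refl x≢
      path-inj _ 0F _ y≢ _ = contradiction refl y≢
      path-inj 1F 1F _ _ _ = refl
      path-inj 1F 2F _ _ ()
      path-inj 1F 3F _ _ q = contradiction (old-injective q) b′≢u
      path-inj 1F 4F _ _ q = contradiction (old-injective q) b′≢b
      path-inj 1F 5F _ _ ()
      path-inj 2F 1F _ _ ()
      path-inj 2F 2F _ _ _ = refl
      path-inj 2F 3F _ _ ()
      path-inj 2F 4F _ _ ()
      path-inj 2F 5F _ _ ()
      path-inj 3F 1F _ _ q = contradiction (sym (old-injective q)) b′≢u
      path-inj 3F 2F _ _ ()
      path-inj 3F 3F _ _ _ = refl
      path-inj 3F 4F _ _ q = contradiction (old-injective q) u≢b
      path-inj 3F 5F _ _ ()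
      path-inj 4F 1F _ _ q = contradiction (sym (old-injective q)) b′≢b
      path-inj 4F 2F _ _ ()
      path-inj 4F 3F _ _ q = contradiction (sym (old-injective q)) u≢b
      path-inj 4F 4F _ _ _ = refl
      path-inj 4F 5F _ _ ()
      path-inj 5F 1F _ _ ()
      path-inj 5F 2F _ _ ()
      path-inj 5F 3F _ _ ()
      path-inj 5F 4F _ _ ()
      path-inj 5F 5F _ _ _ = refl

      f : Fin 6 → Fin (size Γ′)
      f = p ∘ path

      f-inj : ∀ x y → x ≢ 0F → y ≢ 0F → f x ≡ f y → x ≡ y
      f-inj x y x≢ y≢ q = path-inj x y x≢ y≢ (g-inj sw (path-off x) (path-off y) q)

      σ′-edge : ∀ c x y → σ Γ̄ c (path x) ≡ path y → σ Γ′ c (f x) ≡ f y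
      σ′-edge c x y q = trans (edge sw c (path-off x) (subst (Off w) (sym q) (path-off y))) (cong p q)

      e₂₃ : σ Γ′ c1 (f 1F) ≡ f 2F
      e₂₃ = σ′-edge c1 1F 2F (σ̄-pt true true)

      e₃₄ : σ Γ′ c0 (f 2F) ≡ f 3F
      e₃₄ = σ′-edge c0 2F 3F (σ̄-z false true)

      e₄₅ : σ Γ′ c1 (f 3F) ≡ f 4F
      e₄₅ = trans (join sw c1 true u-off (σ̄-inside true (trans Sa (sym (S-pt false true)))))
        (cong p (ς-flip ⌊ Γ̄ ⌋ {c1} (trans
          (σ̄-inside true (trans (cong S square) (trans Sa′ (sym (S-pt false false))))) (cong old square))))

      e₅₆ : σ Γ′ c0 (f 4F) ≡ f 5F
      e₅₆ = σ′-edge c0 4F 5F (σ̄-pt false false)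

      e₂₅ : σ Γ′ c2 (f 1F) ≡ f 4F
      e₂₅ = σ′-edge c2 1F 4F (cong old (ς-flip ⌊ Γ ⌋ chord-b))

      e₃₆ : σ Γ′ c2 (f 2F) ≡ f 5F
      e₃₆ = σ′-edge c2 2F 5F refl

      flip : ∀ {c x y} → σ Γ′ c x ≡ y → σ Γ′ c y ≡ x
      flip = ς-flip ⌊ Γ′ ⌋

      f-edge : ∀ c x → x ≢ 0F → σ 𝒯₁ c x ≢ 0F → σ Γ′ c (f x) ≡ f (σ 𝒯₁ c x)
      f-edge c  0F x≢ _ = contradiction refl x≢
      f-edge 0F 1F _ y≢ = contradiction refl y≢
      f-edge 0F 2F _ _  = e₃₄
      f-edge 0F 3F _ _  = flip e₃₄
      f-edge 0F 4F _ _  = e₅₆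
      f-edge 0F 5F _ _  = flip e₅₆
      f-edge 1F 1F _ _  = e₂₃
      f-edge 1F 2F _ _  = flip e₂₃
      f-edge 1F 3F _ _  = e₄₅
      f-edge 1F 4F _ _  = flip e₄₅
      f-edge 1F 5F _ y≢ = contradiction refl y≢
      f-edge 2F 1F _ _  = e₂₅
      f-edge 2F 2F _ _  = e₃₆
      f-edge 2F 3F _ y≢ = contradiction refl y≢
      f-edge 2F 4F _ _  = flip e₂₅
      f-edge 2F 5F _ _  = flip e₃₆

      β′ : Fin (size Γ′) → Bool
      β′ = β̄ β β-col same ∘ lift sw

      β′-col : Colouring Γ′ β′
      β′-col = recut-colouring (recut , β̄ β β-col same , β̄-alt β β-col same)

      along : ∀ {c x y κ} → σ Γ′ c x ≡ y → β′ x ≡ κ → β′ y ≡ not κ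
      along refl refl = β′-col _ _

      agree : ∀ x → x ≢ 0F → β′ (f x) ≡ parity₆ (β′ (f 1F)) x
      agree 0F x≢ = contradiction refl x≢
      agree 1F _ = refl
      agree 2F _ = along e₂₃ refl
      agree 3F _ = trans (along e₃₄ (agree 2F λ ())) (not-involutive _)
      agree 4F _ = along e₂₅ refl
      agree 5F _ = trans (along e₅₆ (agree 4F λ ())) (not-involutive _)

    -- The vertices v₂, ..., v₆ of 𝒯₁ appear as `b′`, `z true`, `u`, `b`, `z false`. All their edges
    -- are present in Γ̄ except that from `u` to `b`, which arises when `a` and `a′` are deleted:
    -- `u` precedes `a`, and the square makes `b` precede `a′`, both along colour 1.
    torus-glue : TorusSplit Γ
    torus-glue with Γ₂ , v , s , s-f ← collapse Γ′ 𝒯₁ 0F f f-inj f-edge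
      with β₂ , β₂-col , β₂-v ← sum-colouring s β′-col (parity₆-col (β′ (f 1F)))
                                  (λ x x≢ → trans (cong β′ (s-f x)) (agree x x≢)) = record
      { recut = recut , β̄ β β-col same , β̄-alt β β-col same
      ; s = s; β-col = parity₆-col (β′ (f 1F)); β₂-col = β₂-col; β₂-v = β₂-v }

xor-not-cancel : ∀ {x y} → x xor y ≡ not y → x ≡ true
xor-not-cancel {true}         _  = refl
xor-not-cancel {false} {true} ()
xor-not-cancel {false} {false} ()

opaque
  -- Counted from its partner, `b` is at an odd position k + 1, so the arc ends at k with
  -- `σ Γ c0 b`. If k were 0, colours 0 and 2 would be parallel at `b`; if k + 2 were N, colours 1
  -- and 2 would be. `simple` excludes both.
  torus-split : ∀ {Γ} → Conn ⌊ Γ ⌋ c0 c1 → (∀ b x → σ Γ (col b) x ≢ σ Γ c2 x) →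
                ∀ {β} → Colouring Γ β → ∃ (Square Γ) → TorusSplit Γ
  torus-split {Γ} conn simple {β} β-col (b , square) = go (pos b) refl odd-b
    where
    open Cycle Γ (σ Γ c2 b) conn

    odd-b : odd (pos b) ≡ true
    odd-b = xor-not-cancel (trans (sym (walk-alternates β (β-col ∘ col) (pos b)))
      (trans (cong β (walk-pos b)) (trans (cong β (sym (invol Γ c2 b))) (β-col c2 _))))

    go : ∀ j → pos b ≡ j → odd j ≡ true → TorusSplit Γ
    go (suc k) pos-b odd-j = go′ k refl
      where
      even-k : odd k ≡ false
      even-k = trans (sym (not-involutive _)) (cong not odd-j)

      walk-j : walk (suc k) ≡ b
      walk-j = trans (cong walk (sym pos-b)) (walk-pos b)

      walk-k : walk k ≡ σ Γ c0 b
      walk-k = sym (ς-flip ⌊ Γ ⌋ (trans (cong (λ e → σ Γ (col e) (walk k)) (sym even-k)) walk-j))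

      j<N : suc k < N
      j<N = subst (_< N) pos-b (pos<N b)

      walk-next : walk (suc (suc k)) ≡ σ Γ c1 b
      walk-next = trans (cong (λ e → σ Γ (col e) (walk (suc k))) odd-j) (cong (σ Γ c1) walk-j)

      next<N : suc (suc k) < N
      next<N = case ℕ.m≤n⇒m<n∨m≡n j<N of λ
        { (inj₁ p) → p
        ; (inj₂ p) → contradiction (trans (sym walk-next) (trans (cong walk p) walk-N)) (simple true b) }

      go′ : ∀ l → l ≡ k → TorusSplit Γ
      go′ zero refl = contradiction (sym walk-k) (simple false b)
      go′ (suc l) refl = torus-glue cutting
        (trans (cong (σ Γ c2) (trans pt-next walk-j)) (sym pt-start))
        (trans (cong (σ Γ c1) b-pt) (trans (sym square) (cong (σ Γ c2 ∘ σ Γ c1) (sym u-pt))))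
        (λ p → simple false b (trans (sym u-pt) (trans (sym p) pt-start)))
        (S-in (subst (_≤ suc l) (sym (trans (cong pos (trans (cong (σ Γ c1) pt-last) a-walk))
          (pos-walk (ℕ.<-trans (ℕ.n<1+n l) (ℕ.<-trans (ℕ.n<1+n (suc l)) j<N))))) (ℕ.n≤1+n l)))
        (S-out (subst (suc l <_) (sym (trans (cong pos (trans (cong (σ Γ c2 ∘ σ Γ c1) u-pt)
          (trans square (sym walk-next)))) (pos-walk next<N))) (ℕ.m≤n+m (suc (suc l)) 1)))
        β-col
        (trans (cong β pt-last) (trans (walk-alternates β (β-col ∘ col) (suc l))
          (trans (cong (_xor β (σ Γ c2 b)) even-k) (cong β (sym pt-start)))))
        where
        open Arc (arc conn (suc l) even-k j<N)
        b-pt : pt false false ≡ b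
        b-pt = trans pt-next walk-j
        u-pt : pt false true ≡ σ Γ c0 b
        u-pt = trans pt-last walk-k
        a-walk : σ Γ c1 (walk (suc l)) ≡ walk l
        a-walk = trans (cong (λ e → σ Γ (col e) (walk (suc l))) (sym (trans (sym (not-involutive _)) (cong not even-k))))
                       (walk-back l)

module _ {Γ : CGraph} (conn : Conn ⌊ Γ ⌋ c0 c1) {β} (β-col : Colouring Γ β) where

  private
    odd-chord : ∀ r → let open Cycle Γ r conn in ∀ v → odd (pos (σ Γ c2 v)) ≡ not (odd (pos v))
    odd-chord r v = xor-cancelʳ (β r) (trans (at (σ Γ c2 v)) (trans (β-col c2 v)
      (trans (cong not (sym (at v))) (𝔹.not-distribˡ-xor (odd (pos v)) (β r)))))
      where
      open Cycle Γ r conn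
      at : ∀ v → odd (pos v) xor β r ≡ β v
      at v = trans (sym (walk-alternates β (β-col ∘ col) (pos v))) (cong β (walk-pos v))
      xor-cancelʳ : ∀ z {x y} → x xor z ≡ y xor z → x ≡ y
      xor-cancelʳ z {false} {false} _ = refl
      xor-cancelʳ z {true}  {true}  _ = refl
      xor-cancelʳ false {false} {true} ()
      xor-cancelʳ true  {false} {true} ()
      xor-cancelʳ false {true} {false} ()
      xor-cancelʳ true  {true} {false} ()

    -- The arc from `r` must include the vertex at q + 1, so the partner of `v` has to lie beyond q
    -- + 1. It is beyond q and at an odd position, because `v` is at an even one, whereas q + 1 is
    -- even.
    cross-even : ∀ r → let open Cycle Γ r conn; q = pos (σ Γ c2 r) in
                 ∀ v → 0 < pos v → pos v < q → odd (pos v) ≡ false → q < pos (σ Γ c2 v) → SquareSplit Γ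
    cross-even r v 0<i i<q even-i q<v′ = square-glue cutting
      (trans (cong (σ Γ c1) pt-last) (trans (ς-flip ⌊ Γ ⌋ walk-next) (cong (σ Γ c2) (sym pt-start))))
      (S-in (subst (_≤ suc q) (cong (pos ∘ σ Γ c2) (sym pt-start)) (ℕ.n≤1+n q)))
      (S-in (ℕ.≤-trans (ℕ.<⇒≤ i<q) (ℕ.n≤1+n q)))
      (S-out suc-q<v′)
      (λ p → ℕ.<⇒≢ 0<i (sym (trans (cong pos (trans p pt-start)) pos-r)))
      (λ p → ℕ.<⇒≢ (ℕ.<-trans i<q (ℕ.n<1+n q)) (trans (cong pos (trans p pt-last)) (pos-walk (ℕ.<-trans (ℕ.n<1+n _) suc-q<N))))
      (λ p → ℕ.<⇒≢ i<q (cong pos (trans p (cong (σ Γ c2) pt-start))))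
      β-col
      (trans (cong β pt-last) (trans (walk-alternates β (β-col ∘ col) (suc q))
        (trans (cong (_xor β r) even-q) (cong β (sym pt-start)))))
      where
      open Cycle Γ r conn
      q = pos (σ Γ c2 r)

      odd-q : odd q ≡ true
      odd-q = trans (odd-chord r r) (cong (not ∘ odd) pos-r)

      even-q : odd (suc q) ≡ false
      even-q = cong not odd-q

      suc-q<v′ : suc q < pos (σ Γ c2 v)
      suc-q<v′ = ℕ.≤∧≢⇒< q<v′ λ p → case trans (sym even-q)
        (trans (cong odd p) (trans (odd-chord r v) (cong not even-i))) of λ ()

      suc-q<N : suc (suc q) < N
      suc-q<N = ℕ.≤-<-trans suc-q<v′ (pos<N _)

      walk-next : σ Γ c1 (σ Γ c2 r) ≡ walk (suc q)
      walk-next = trans (cong (σ Γ c1) (sym (walk-pos _))) (cong (λ e → σ Γ (col e) (walk q)) (sym odd-q))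

      open Arc (arc conn (suc q) even-q suc-q<N)

    -- Walking the arc from r to its partner backwards flips the parity of positions.
    cross : ∀ r → let open Cycle Γ r conn; q = pos (σ Γ c2 r) in
            ∀ v → 0 < pos v → pos v < q → q < pos (σ Γ c2 v) → SquareSplit Γ
    cross r v 0<j j<q q<v′ with odd (Cycle.pos Γ r conn v) in odd-j
    ... | false = cross-even r v 0<j j<q odd-j q<v′
    ... | true = cross-even r′ v
        (subst (0 <_) (sym pos′-v) (ℕ.m<n⇒0<n∸m j<q))
        (subst₂ _<_ (sym pos′-v) (sym q′≡q) (ℕ.∸-monoʳ-< 0<j (ℕ.<⇒≤ j<q)))
        even-i
        (subst (_< W′.pos (σ Γ c2 v)) (sym q′≡q) (ℕ.≰⇒> beyond))
      where
      r′ = σ Γ c2 r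
      open Cycle Γ r conn
      module W′ = Cycle Γ r′ conn
      q = pos r′
      j = pos v

      odd-q : odd q ≡ true
      odd-q = trans (odd-chord r r) (cong (not ∘ odd) pos-r)

      reverse : ∀ i k → i + k ≡ q → W′.walk i ≡ walk k
      reverse zero    k p = trans (sym (walk-pos r′)) (cong walk (sym p))
      reverse (suc i) k p = trans (cong (σ Γ (col (odd i))) (reverse i (suc k) (trans (ℕ.+-suc i k) p)))
        (trans (cong (λ e → σ Γ (col e) (walk (suc k))) (same-parity i k p)) (walk-back k))
        where
        same-parity : ∀ i k → suc (i + k) ≡ q → odd i ≡ odd k
        same-parity i k p = xor-false (trans (sym (odd-+ i k))
          (trans (sym (not-involutive _)) (cong not (trans (cong odd p) odd-q))))
          where
          xor-false : ∀ {x y} → x xor y ≡ false → x ≡ y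
          xor-false {false} {false} _ = refl
          xor-false {true}  {true}  _ = refl
          xor-false {false} {true} ()
          xor-false {true} {false} ()

      q<N′ : q < W′.N
      q<N′ = ℕ.≰⇒> λ N′≤q → walk-≢ (ℕ.∸-monoʳ-< W′.0<N N′≤q) (pos<N r′)
        (trans (sym (reverse W′.N (q ∸ W′.N) (ℕ.m+[n∸m]≡n N′≤q))) (trans W′.walk-N (sym (walk-pos r′))))

      q′≡q : W′.pos (σ Γ c2 r′) ≡ q
      q′≡q = trans (cong W′.pos (trans (invol Γ c2 r) (sym (reverse q 0 (ℕ.+-identityʳ q))))) (W′.pos-walk q<N′)

      i+j : q ∸ j + j ≡ q
      i+j = ℕ.m∸n+n≡m (ℕ.<⇒≤ j<q)

      pos′-v : W′.pos v ≡ q ∸ j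
      pos′-v = trans (cong W′.pos (trans (sym (walk-pos v)) (sym (reverse (q ∸ j) j i+j))))
        (W′.pos-walk (ℕ.≤-<-trans (ℕ.m∸n≤m q j) q<N′))

      even-i : odd (W′.pos v) ≡ false
      even-i = trans (cong odd pos′-v) (xor-true (trans (cong (odd (q ∸ j) xor_) (sym odd-j))
        (trans (sym (odd-+ (q ∸ j) j)) (trans (cong odd i+j) odd-q))))
        where
        xor-true : ∀ {x} → x xor true ≡ true → x ≡ false
        xor-true {false} _ = refl
        xor-true {true} ()

      beyond : ¬ W′.pos (σ Γ c2 v) ≤ q
      beyond p = ℕ.<⇒≱ q<v′ (subst (_≤ q)
        (sym (trans (cong pos (trans (sym (W′.walk-pos _)) (reverse m (q ∸ m) (ℕ.m+[n∸m]≡n p))))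
                    (pos-walk (ℕ.≤-<-trans (ℕ.m∸n≤m q m) (pos<N r′)))))
        (ℕ.m∸n≤m q m))
        where m = W′.pos (σ Γ c2 v)

  opaque
    -- If no chord crossed the one at `r`, the positions strictly between 0 and q would be closed
    -- under colour 2. They are closed under colour 1 as well, since q is odd and colour 1 pairs 1
    -- with 2, ..., q - 2 with q - 1. This contradicts `conn₁₂` unless q = 1, which would be a
    -- double edge.
    square-split : Conn ⌊ Γ ⌋ c1 c2 → (∀ b x → σ Γ (col b) x ≢ σ Γ c2 x) → Fin (size Γ) → SquareSplit Γ
    square-split conn₁₂ simple r = case Fin.any? (λ v → inside? v ×-dec ¬? (inside? (σ Γ c2 v))) of λ
      { (yes (v , (0<i , i<q) , out)) → cross r v 0<i i<q (after v 0<i i<q out)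
      ; (no none) → ⊥-elim (case ℕ.<-cmp q 1 of λ
          { (tri< q<1 _ _) → loopless Γ c2 r (pos-injective (trans (ℕ.n<1⇒n≡0 q<1) (sym pos-r)))
          ; (tri≈ _ q≡1 _) → simple false r (sym (trans (sym (walk-pos r′)) (cong walk q≡1)))
          ; (tri> _ _ 1<q) → case trans (sym (dec-true (inside? (walk 1)) (in-1 1<q)))
              (trans (conn₁₂ (does ∘ inside?) (does-closed Γ c1 inside? inside-1) (does-closed Γ c2 inside? (inside-2 none)) (walk 1) r)
                     (dec-false (inside? r) λ (0<p , _) → ℕ.<⇒≢ 0<p (sym pos-r))) of λ () }) }
      where
      open Cycle Γ r conn
      r′ : Fin (size Γ)
      r′ = σ Γ c2 r
      q : ℕ
      q = pos r′

      odd-q : odd q ≡ true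
      odd-q = trans (odd-chord r r) (cong (not ∘ odd) pos-r)

      Inside : Fin (size Γ) → Set
      Inside v = 0 < pos v × pos v < q

      inside? : Decidable Inside
      inside? v = (0 ℕ.<? pos v) ×-dec (pos v ℕ.<? q)

      in-1 : 1 < q → Inside (walk 1)
      in-1 1<q with p ← pos-walk (ℕ.<-trans 1<q (pos<N r′)) = subst (0 <_) (sym p) (s≤s z≤n) , subst (_< q) (sym p) 1<q

      inside-1 : ∀ {v} → Inside v → Inside (σ Γ c1 v)
      inside-1 {v} (0<i , i<q) = next (neighbours true v) 0<i i<q
        where
        next : ∀ {i j} → Neighbours N true i j → 0 < i → i < q → 0 < j × j < q
        next (up o _) _ i<q = s≤s z≤n , ℕ.≤∧≢⇒< i<q λ p → case trans (sym odd-q) (trans (cong odd (sym p)) (cong not (sym o))) of λ ()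
        next {j = zero}  (down () _) _ _
        next {j = suc _} (down _ _) _ i<q = s≤s z≤n , ℕ.<⇒≤ i<q
        next (over p) _ i<q = contradiction (subst (_≤ q) p i<q) (ℕ.<⇒≱ (pos<N r′))
        next (under _) () _

      inside-2 : ¬ (∃[ v ] (Inside v × ¬ Inside (σ Γ c2 v))) → ∀ {v} → Inside v → Inside (σ Γ c2 v)
      inside-2 none {v} v∈ with inside? (σ Γ c2 v)
      ... | yes p = p
      ... | no p  = contradiction (v , v∈ , p) none

      after : ∀ v → 0 < pos v → pos v < q → ¬ Inside (σ Γ c2 v) → q < pos (σ Γ c2 v)
      after v 0<i i<q out with ℕ.<-cmp (pos (σ Γ c2 v)) q
      ... | tri> _ _ p = p
      ... | tri≈ _ p _ = contradiction (trans (cong pos (ς-injective ⌊ Γ ⌋ (pos-injective p))) pos-r) (ℕ.<⇒≢ 0<i ∘ sym)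
      ... | tri< p _ _ with pos (σ Γ c2 v) in eq
      ...   | zero  = contradiction (cong pos (sym (ς-flip ⌊ Γ ⌋ (pos-injective (trans eq (sym pos-r)))))) (ℕ.<⇒≢ i<q)
      ...   | suc _ = contradiction (s≤s z≤n , p) out

-- Moves inside a summand

colouring⇒bipartition : ∀ {Γ β} → Colouring Γ β → IsBipartition Γ β
colouring⇒bipartition β-col c x p = not-¬ refl (sym (trans (sym (β-col c x)) p))

recolour : ∀ {Γ β} → Colouring Γ β → ∀ y κ → ∃[ β′ ] (Colouring Γ β′ × β′ y ≡ κ)
recolour {Γ} {β} β-col y κ with β y 𝔹.≟ κ
... | yes p = β , β-col , p
... | no p  = not ∘ β , (λ c v → cong not (β-col c v)) , trans (cong not (¬-not p)) (not-involutive κ)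

surjective-size : ∀ {m n} (e : Fin m → Fin n) → (∀ v → ∃[ i ] e i ≡ v) → n ≤ m
surjective-size e onto = Fin.injective⇒≤ {f = proj₁ ∘ onto} λ {u} {v} p →
  trans (sym (proj₂ (onto u))) (trans (cong e p) (proj₂ (onto v)))

record Tight (Γ : CGraph) : Set where
  field
    conn₀₁ : Conn ⌊ Γ ⌋ c0 c1
    conn₂  : ∀ b → Conn ⌊ Γ ⌋ (col b) c2

  simple : 3 ≤ size Γ → ∀ b x → σ Γ (col b) x ≢ σ Γ c2 x
  simple 3≤ b = no-double-edge {Γ} b (conn₂ b) 3≤

contracted⇒tight : ∀ {Γ} → Contracted Γ → Tight Γ
contracted⇒tight con = record
  { conn₀₁ = Contracted⇒Conn con (λ ())
  ; conn₂ = λ b → Contracted⇒Conn con (col≢c2 b) }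

recut-tight : ∀ {Γ Γ′} → Recut Γ Γ′ → Tight Γ → Tight Γ′
recut-tight r t = record { conn₀₁ = recut-conn₀₁ r (Tight.conn₀₁ t) ; conn₂ = λ b → recut-conn₂ r b (Tight.conn₂ t b) }

sum-tight : ∀ {Γ₁ Γ₂ v₁ v₂ Γ} → Sum Γ₁ Γ₂ v₁ v₂ Γ → Tight Γ → Tight Γ₂
sum-tight s t = record { conn₀₁ = Sum-conn s (Tight.conn₀₁ t) ; conn₂ = λ b → Sum-conn s (Tight.conn₂ t b) }

sum-size : ∀ {Γ₁ Γ₂ v₁ v₂ Γ} → Sum Γ₁ Γ₂ v₁ v₂ Γ → size Γ₁ + size Γ₂ ≡ 2 + size Γ
sum-size s = card-smoothing s

module _ {Γ Γ′ : CGraph} (r : Recut Γ Γ′) {X Δ : CGraph} {x : Fin (size X)} where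
  open Recut r

  module _ (x₀ : Fin (size Γ̄)) (x₀∉z : Off z x₀) (x₀∉w : Off w x₀) (t : Sum X Γ x (g sz x₀) Δ) where
    private
      Ω : Graph
      Ω = ⌊ X ⌋ ⊔ ⌊ Γ̄ ⌋

      a : Bool → Fin (size X) ⊎ Fin (size Γ̄)
      a = ⟪ inj₁ x , inj₂ x₀ ⟫

      Δ̄ : CGraph
      Δ̄ = proj₁ (connectedSum X Γ̄ x x₀)

      u : Smoothing Ω a ⌊ Δ̄ ⌋
      u = proj₂ (connectedSum X Γ̄ x x₀)

      a∉ : ∀ {e : Bool → Fin (size Γ̄)} → Off e x₀ → ∀ i → Off (inj₂ ∘ e) (a i)
      a∉ x₀∉ true  j ()
      a∉ x₀∉ false j p = x₀∉ j (inj₂-injective p)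

      ∉a : ∀ {e : Bool → Fin (size Γ̄)} → Off e x₀ → ∀ i → Off a (inj₂ (e i))
      ∉a x₀∉ i = off₂ (λ p → x₀∉ i (sym p))

      sz′ : Smoothing ⌊ Δ̄ ⌋ (g u ∘ inj₂ ∘ z) ⌊ Δ ⌋
      sz′ = smoothing-comm (smoothing-⊔ʳ ⌊ X ⌋ sz) u (a∉ x₀∉z)
              (smoothing-≗ (λ { true → refl ; false → refl }) t)

      glued : ∃[ Δ′ ] Smoothing ⌊ Δ̄ ⌋ (g u ∘ inj₂ ∘ w) ⌊ Δ′ ⌋
      glued = smooth ⌊ Δ̄ ⌋ (g u ∘ inj₂ ∘ w)
        (λ p → distinct sw (inj₂-injective (g-inj u (∉a x₀∉w true) (∉a x₀∉w false) p)))
        (g u (inj₁ (σ X c0 x)) , λ i p → case g-inj u (off₁ (loopless X c0 x)) (∉a x₀∉w i) p of λ ())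

      S′ : Fin (size X) ⊎ Fin (size Γ̄) → Bool
      S′ = [ (λ _ → S x₀) , S ]′

      edge′ : ∀ {e : Bool → Fin (size Γ̄)} → Off e x₀ → σ Γ̄ c2 (e true) ≡ e false →
              σ Δ̄ c2 (g u (inj₂ (e true))) ≡ g u (inj₂ (e false))
      edge′ {e} x₀∉ p = trans (edge u c2 (∉a x₀∉ true) (subst (λ v → Off a (inj₂ v)) (sym p) (∉a {e} x₀∉ false)))
                          (cong (g u ∘ inj₂) p)

    opaque
      -- X is attached to Γ̄ at `x₀`, away from both pairs. The sum then commutes with the smoothing
      -- at either pair, so one cut graph serves both sums; the whole of X goes to the side of `x₀`.
      recut-lift : ∃[ Δ′ ] (Recut Δ Δ′ × Sum X Γ′ x (g sw x₀) Δ′)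
      recut-lift = proj₁ glued
        , record
          { Γ̄ = Δ̄
          ; S = S′ ∘ lift u
          ; S-closed = λ b → descend u id S′ (λ { (inj₁ _) → refl ; (inj₂ v) → S-closed b v })
                               λ { true → refl ; false → refl }
          ; z = g u ∘ inj₂ ∘ z
          ; w = g u ∘ inj₂ ∘ w
          ; S-z = λ i → trans (cong S′ (lift-g u (∉a x₀∉z i))) (S-z i)
          ; S-w = λ i → trans (cong S′ (lift-g u (∉a x₀∉w i))) (S-w i)
          ; z-edge = edge′ {z} x₀∉z z-edge
          ; w-edge = edge′ {w} x₀∉w w-edge
          ; sz = sz′
          ; sw = proj₂ glued }
        , smoothing-≗ (λ { true → refl ; false → refl })
            (smoothing-comm u (smoothing-⊔ʳ ⌊ X ⌋ sw) (∉a x₀∉w) (proj₂ glued))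

module _ {X B Γ₂ Γ′ X′ Γ : CGraph} {x t t′ v}
         (s : Sum B Γ₂ t v Γ′) (t′≢t : t′ ≢ t) (u : Sum X B x t′ X′)
         (r : Sum X Γ′ x (g s (inj₁ t′)) Γ) where

  opaque
    -- X is attached inside B, at `t′ ≢ t`. Both bracketings smooth X ⊔ (B ⊔ Γ₂) at the disjoint
    -- pairs {x, t′} and {t, v}, only in different orders.
    sum-assoc : Sum X′ Γ₂ (g u (inj₂ t)) v Γ
    sum-assoc = smoothing-≗ (λ { true → refl ; false → refl })
      (smoothing-comm (smoothing-⊔ʳ ⌊ X ⌋ s) (smoothing-⊔ˡ ⌊ Γ₂ ⌋ u)
        (λ { true true () ; true false () ; false true p → t′≢t (inj₁-injective (inj₂-injective p)) ; false false () })
        (smoothing-≗ (λ { true → refl ; false → refl }) r))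

opaque
  -- An `Interchange` demands distinct attaching pairs, so staying in place is the empty sequence of
  -- moves.
  relocate : ∀ {X Γk Γ x y} → Sum X Γk x y Γ → ∀ y′ →
             (Bipartite X → Bipartite Γk → ∃[ β₁ ] ∃[ β₂ ]
               (IsBipartition X β₁ × IsBipartition Γk β₂ × β₁ x ≢ β₂ y × β₁ x ≢ β₂ y′)) →
             ∃[ Γ′ ] (DEquiv Γ Γ′ × Sum X Γk x y′ Γ′)
  relocate {X} {Γk} {Γ} {x} {y} s y′ types with y Fin.≟ y′
  ... | yes refl = Γ , ε , s
  ... | no y≢ with Γ′ , s′ ← connectedSum X Γk x y′ =
    Γ′ , inj₂ (X , Γk , x , y , x , y′ , Sum⇒IsConnSum s , Sum⇒IsConnSum s′ , y≢ ∘ proj₂ , types) ◅ ε , s′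

distinct⇒2≤ : ∀ {n} {i j : Fin n} → i ≢ j → 2 ≤ n
distinct⇒2≤ {suc zero} {zero} {zero} i≢j = contradiction refl i≢j
distinct⇒2≤ {suc (suc n)} _ = s≤s (s≤s z≤n)

2≤size : ∀ Γ → Fin (size Γ) → 2 ≤ size Γ
2≤size Γ y = distinct⇒2≤ (loopless Γ c0 y)

distinct⇒3≤ : ∀ {n} {i j k : Fin n} → i ≢ j → i ≢ k → j ≢ k → 3 ≤ n
distinct⇒3≤ {n} {i} {j} {k} i≢j i≢k j≢k = Fin.injective⇒≤ {f = f} λ {p} {q} → f-inj p q
  where
  f : Fin 3 → Fin n
  f 0F = i
  f 1F = j
  f 2F = k
  f-inj : ∀ p q → f p ≡ f q → p ≡ q
  f-inj 0F 0F _ = refl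
  f-inj 0F 1F e = contradiction e i≢j
  f-inj 0F 2F e = contradiction e i≢k
  f-inj 1F 0F e = contradiction (sym e) i≢j
  f-inj 1F 1F _ = refl
  f-inj 1F 2F e = contradiction e j≢k
  f-inj 2F 0F e = contradiction (sym e) i≢k
  f-inj 2F 1F e = contradiction (sym e) j≢k
  f-inj 2F 2F _ = refl

iso-sum : ∀ {B m Γ Δ} → Iso Γ Δ → IsSumOf B m Γ → IsSumOf B m Δ
iso-sum i (one j) = one record
  { to = I.to ∘ J.to
  ; from = J.from ∘ I.from
  ; from-to = λ x → trans (cong J.from (I.from-to _)) (J.from-to x)
  ; to-from = λ y → trans (cong I.to (J.to-from _)) (I.to-from y)
  ; hom = λ c x → trans (cong I.to (J.hom c x)) (I.hom c _) }
  where
  module I = Iso i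
  module J = Iso j
iso-sum i (sum p q (v₁ , v₂ , s , types)) = sum p q (v₁ , v₂ , record
  { f₁ = I.to ∘ C.f₁
  ; f₂ = I.to ∘ C.f₂
  ; inj₁ = λ x y x≢ y≢ → C.inj₁ x y x≢ y≢ ∘ to-inj
  ; inj₂ = λ x y x≢ y≢ → C.inj₂ x y x≢ y≢ ∘ to-inj
  ; disj = λ x y x≢ y≢ → C.disj x y x≢ y≢ ∘ to-inj
  ; surj = λ z → case C.surj (I.from z) of λ
      { (inj₁ (x , x≢ , p)) → inj₁ (x , x≢ , trans (cong I.to p) (I.to-from z))
      ; (inj₂ (y , y≢ , p)) → inj₂ (y , y≢ , trans (cong I.to p) (I.to-from z)) }
  ; edge₁ = λ c x x≢ y≢ → trans (sym (I.hom c _)) (cong I.to (C.edge₁ c x x≢ y≢))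
  ; join₁ = λ c x x≢ p → trans (sym (I.hom c _)) (cong I.to (C.join₁ c x x≢ p))
  ; edge₂ = λ c x x≢ y≢ → trans (sym (I.hom c _)) (cong I.to (C.edge₂ c x x≢ y≢))
  ; join₂ = λ c x x≢ p → trans (sym (I.hom c _)) (cong I.to (C.join₂ c x x≢ p)) } , types)
  where
  module I = Iso i
  module C = IsConnSum s
  to-inj : ∀ {x y} → I.to x ≡ I.to y → x ≡ y
  to-inj p = trans (sym (I.from-to _)) (trans (cong I.from p) (I.from-to _))

module _ {X D Γ : CGraph} {x y} (s : Sum X D x y Γ) (size-D : size D ≡ 2) where
  private
    d : Fin (size D)
    d = σ D c0 y

    only : ∀ {e} → e ≢ y → e ≡ d
    only {e} e≢ with e Fin.≟ d
    ... | yes p = p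
    ... | no e≢d = contradiction (subst (3 ≤_) size-D (distinct⇒3≤ e≢ e≢d (loopless D c0 y ∘ sym)))
                                 λ { (s≤s (s≤s ())) }

    to : Fin (size X) → Fin (size Γ)
    to v with v Fin.≟ x
    ... | yes _ = g s (inj₂ d)
    ... | no _  = g s (inj₁ v)

    to-x : to x ≡ g s (inj₂ d)
    to-x with x Fin.≟ x
    ... | yes _ = refl
    ... | no p  = contradiction refl p

    to-off : ∀ {v} → v ≢ x → to v ≡ g s (inj₁ v)
    to-off {v} v≢ with v Fin.≟ x
    ... | yes p = contradiction p v≢
    ... | no _  = refl

    d≢y : d ≢ y
    d≢y = loopless D c0 y

    from : Fin (size Γ) → Fin (size X)
    from w = [ id , (λ _ → x) ]′ (lift s w)

    hom : ∀ c v → to (σ X c v) ≡ σ Γ c (to v)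
    hom c v = case v Fin.≟ x of λ
      { (yes refl) → trans (to-off (loopless X c v)) (sym (trans (cong (σ Γ c) to-x)
          (join s c false (off₂ d≢y) (cong inj₂ (ς-flip ⌊ D ⌋ (only (loopless D c y)))))))
      ; (no v≢) → case σ X c v Fin.≟ x of λ
        { (yes p) → trans (cong to p) (trans to-x (trans (cong (g s ∘ inj₂) (sym (only (loopless D c y))))
            (sym (trans (cong (σ Γ c) (to-off v≢)) (join s c true (off₁ v≢) (cong inj₁ p))))))
        ; (no y≢) → trans (to-off y≢) (sym (trans (cong (σ Γ c) (to-off v≢)) (edge s c (off₁ v≢) (off₁ y≢)))) } }

  -- D is two vertices joined by three edges; in the sum its surviving vertex `d` takes the place of
  -- `x`.
  neutral : Iso X Γ
  neutral = record
    { to = to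
    ; from = from
    ; from-to = λ v → case v Fin.≟ x of λ
        { (yes refl) → cong [ id , (λ _ → x) ]′ (trans (cong (lift s) to-x) (lift-g s (off₂ d≢y)))
        ; (no v≢) → cong [ id , (λ _ → x) ]′ (trans (cong (lift s) (to-off v≢)) (lift-g s (off₁ v≢))) }
    ; to-from = elim s _ λ
        { (inj₁ v) v∉ → trans (cong (to ∘ [ id , (λ _ → x) ]′) (lift-g s v∉)) (to-off (v∉ true ∘ cong inj₁))
        ; (inj₂ e) e∉ → trans (cong (to ∘ [ id , (λ _ → x) ]′) (lift-g s e∉))
            (trans to-x (cong (g s ∘ inj₂) (sym (only (e∉ false ∘ cong inj₂))))) }
    ; hom = hom }

avoid : ∀ {Γ} → 5 ≤ size Γ → (z w : Bool → Fin (size Γ)) → ∃[ x ] (Off z x × Off w x)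
avoid {Γ} 5≤ z w with Fin.any? (λ x → off? ⌊ Γ ⌋ z x ×-dec off? ⌊ Γ ⌋ w x)
... | yes found = found
... | no none = contradiction (surjective-size e onto) (ℕ.<⇒≱ 5≤)
  where
  e : Fin 4 → Fin (size Γ)
  e 0F = z true
  e 1F = z false
  e 2F = w true
  e 3F = w false
  onto : ∀ v → ∃[ i ] e i ≡ v
  onto v with locate ⌊ Γ ⌋ z v | locate ⌊ Γ ⌋ w v
  ... | inj₁ (true , p)  | _                = 0F , sym p
  ... | inj₁ (false , p) | _                = 1F , sym p
  ... | inj₂ _           | inj₁ (true , p)  = 2F , sym p
  ... | inj₂ _           | inj₁ (false , p) = 3F , sym p
  ... | inj₂ v∉z         | inj₂ v∉w         = contradiction (v , v∉z , v∉w) none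

-- Each pair holds one vertex of either colour. Were all vertices of colour κ excluded, there would
-- be at most two of them, and colour 0 matches them with all the others, giving at most four in
-- total.
avoid-coloured : ∀ {Γ} → 5 ≤ size Γ → ∀ {β} → Colouring Γ β → (z w : Bool → Fin (size Γ)) →
                 β (z false) ≡ not (β (z true)) → β (w false) ≡ not (β (w true)) →
                 ∀ κ → ∃[ x ] (β x ≡ κ × Off z x × Off w x)
avoid-coloured {Γ} 5≤ {β} β-col z w β-z β-w κ
  with Fin.any? (λ x → (β x 𝔹.≟ κ) ×-dec off? ⌊ Γ ⌋ z x ×-dec off? ⌊ Γ ⌋ w x)
... | yes found = found
... | no none = contradiction (surjective-size e onto) (ℕ.<⇒≱ 5≤)
  where
  pick : (a : Bool → Fin (size Γ)) → β (a false) ≡ not (β (a true)) →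
         ∃[ i ] (∀ j → β (a j) ≡ κ → a j ≡ a i)
  pick a β-a with β (a true) 𝔹.≟ κ
  ... | yes p = true , λ { true _ → refl
                         ; false q → contradiction (trans (sym q) (trans β-a (cong not p))) (not-¬ refl) }
  ... | no p = false , λ { true q → contradiction q p ; false _ → refl }

  iz = proj₁ (pick z β-z)
  iw = proj₁ (pick w β-w)

  e : Fin 4 → Fin (size Γ)
  e 0F = z iz
  e 1F = w iw
  e 2F = σ Γ c0 (z iz)
  e 3F = σ Γ c0 (w iw)

  onto-κ : ∀ v → β v ≡ κ → v ≡ z iz ⊎ v ≡ w iw
  onto-κ v βv with locate ⌊ Γ ⌋ z v | locate ⌊ Γ ⌋ w v
  ... | inj₁ (j , refl) | _               = inj₁ (proj₂ (pick z β-z) j βv)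
  ... | inj₂ _          | inj₁ (j , refl) = inj₂ (proj₂ (pick w β-w) j βv)
  ... | inj₂ v∉z        | inj₂ v∉w        = contradiction (v , βv , v∉z , v∉w) none

  onto : ∀ v → ∃[ i ] e i ≡ v
  onto v with β v 𝔹.≟ κ
  ... | yes p = case onto-κ v p of λ { (inj₁ q) → 0F , sym q ; (inj₂ q) → 1F , sym q }
  ... | no p = case onto-κ (σ Γ c0 v) (trans (β-col c0 v) (trans (cong not (¬-not p)) (not-involutive κ))) of λ
    { (inj₁ q) → 2F , ς-flip ⌊ Γ ⌋ q ; (inj₂ q) → 3F , ς-flip ⌊ Γ ⌋ q }

recut-move : ∀ {Γ Γ′} → Recut Γ Γ′ → DEquiv Γ Γ′
recut-move r = inj₁ (Recut⇒CutGlue r) ◅ ε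

opposite : ∀ {p q} → p ≡ not q → q ≢ p
opposite p≡ q≡p = not-¬ (sym q≡p) p≡

cut-size : ∀ {Γ Γ′} (r : Recut Γ Γ′) → 3 ≤ size Γ → 5 ≤ size (Recut.Γ̄ r)
cut-size r 3≤ = subst (5 ≤_) (sym (card-smoothing (Recut.sz r))) (s≤s (s≤s 3≤))

-- The colouring of Γ̄ is normalised so that `y` and the new attaching vertex both have the colour
-- opposite to `x`; this is the type condition for the interchange that precedes the lifted recut.
lift-bipartite : ∀ {Γk Γk′ X Γ x y} → BiRecut Γk Γk′ → 3 ≤ size Γk → ∀ {βX} → Colouring X βX →
                 Sum X Γk x y Γ → ∃[ Γ′ ] ∃[ y′ ] (DEquiv Γ Γ′ × Sum X Γk′ x y′ Γ′)
lift-bipartite {Γk} {X = X} {x = x} {y} (r , β̄ , β̄-col) 3≤ {βX} βX-col s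
  with β , β-col , β-y ← recolour {Recut.Γ̄ r} β̄-col (lift (Recut.sz r) y) (not (βX x))
  with x₀ , β-x₀ , x₀∉z , x₀∉w ← avoid-coloured {Recut.Γ̄ r} (cut-size r 3≤) β-col (Recut.z r) (Recut.w r)
         (trans (cong β (sym (Recut.z-edge r))) (β-col c2 _)) (trans (cong β (sym (Recut.w-edge r))) (β-col c2 _))
         (not (βX x))
  with Γ₁ , moves , s₁ ← relocate s (g (Recut.sz r) x₀) (λ _ _ →
         βX , β ∘ lift (Recut.sz r) , colouring⇒bipartition {X} βX-col ,
         colouring⇒bipartition {Γk} (chord-colouring (Recut.sz r) (Recut.z-edge r) β-col) ,
         opposite β-y , opposite (trans (cong β (lift-g (Recut.sz r) x₀∉z)) β-x₀))
  with Γ₂ , r₂ , s₂ ← recut-lift r x₀ x₀∉z x₀∉w s₁ =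
  Γ₂ , _ , moves ◅◅ recut-move r₂ , s₂

-- As X is not bipartite, interchanges carry no type condition, and any vertex off both pairs may
-- serve; Γ̄ has at least five vertices, the pairs cover at most four.
lift-moves : ∀ {Γk Γk′ X Γ x y} → Star Recut Γk Γk′ → 3 ≤ size Γk → ¬ Bipartite X →
             Sum X Γk x y Γ → ∃[ Γ′ ] ∃[ y′ ] (DEquiv Γ Γ′ × Sum X Γk′ x y′ Γ′)
lift-moves ε _ _ s = _ , _ , ε , s
lift-moves (r ◅ rs) 3≤ ¬bip s
  with x₀ , x₀∉z , x₀∉w ← avoid {Recut.Γ̄ r} (cut-size r 3≤) (Recut.z r) (Recut.w r)
  with Γ₁ , moves₁ , s₁ ← relocate s (g (Recut.sz r) x₀) (λ bip → contradiction bip ¬bip)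
  with Γ₂ , r₂ , s₂ ← recut-lift r x₀ x₀∉z x₀∉w s₁
  with Γ₃ , y₃ , moves₃ , s₃ ← lift-moves rs (subst (3 ≤_) (recut-size r) 3≤) ¬bip s₂ =
  Γ₃ , y₃ , moves₁ ◅◅ recut-move r₂ ◅◅ moves₃ , s₃

-- Reduction to standard sums

-- Here k is the number of vertices that one summand contributes, |B| - 2: it is 2 for 𝒫₁ and 4 for
-- 𝒯₁. The equation later recovers `m` from the size of the given graph.
Reduces : CGraph → ℕ → CGraph → Set
Reduces B k Γ = ∃[ Δ ] ∃[ m ] (IsSumOf B m Δ × DEquiv Γ Δ × size Γ ≡ m * k + 2)

reduces-move : ∀ {B k Γ Γ′} → DEquiv Γ Γ′ → size Γ ≡ size Γ′ → Reduces B k Γ′ → Reduces B k Γ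
reduces-move moves p (Δ , m , isSum , moves′ , q) = Δ , m , isSum , moves ◅◅ moves′ , trans p q

sum-size-≡ : ∀ {X Γ₁ Γ₂ x y₁ y₂ Δ₁ Δ₂} → Sum X Γ₁ x y₁ Δ₁ → Sum X Γ₂ x y₂ Δ₂ →
             size Γ₁ ≡ size Γ₂ → size Δ₁ ≡ size Δ₂
sum-size-≡ {X} s₁ s₂ p = ℕ.+-cancelˡ-≡ 2 _ _ (trans (sym (sum-size s₁)) (trans (cong (size X +_) p) (sum-size s₂)))

reduces-neutral : ∀ {B m k X D Γ x y} → Sum X D x y Γ → size D ≡ 2 → IsSumOf B m X → size X ≡ m * k + 2 →
                  Reduces B k Γ
reduces-neutral {X = X} s size-D isSum p = _ , _ , iso-sum (neutral s size-D) isSum , ε ,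
  trans (sym (ℕ.+-cancelˡ-≡ 2 _ _ (trans (ℕ.+-comm 2 (size X)) (trans (cong (size X +_) (sym size-D)) (sum-size s))))) p

grow-size : ∀ m k {X B X′ x t} → Sum X B x t X′ → size X ≡ m * k + 2 → size B ≡ k + 2 → size X′ ≡ (m + 1) * k + 2
grow-size m k s p q = ℕ.+-cancelˡ-≡ 2 _ _ (trans (sym (sum-size s)) (trans (cong₂ _+_ p q)
  (solve 2 (λ m k → (m :* k :+ con 2) :+ (k :+ con 2) := con 2 :+ ((m :+ con 1) :* k :+ con 2)) refl m k)))
  where open +-*-Solver

base-iso : ∀ B → Iso B B
base-iso B = record { to = id ; from = id ; from-to = λ _ → refl ; to-from = λ _ → refl ; hom = λ _ _ → refl }

rest-smaller : ∀ k {B Γ₂ t v Γ} → Sum B Γ₂ t v Γ → size B ≡ suc k + 2 → size Γ₂ < size Γ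
rest-smaller k {Γ₂ = Γ₂} s p = ℕ.+-cancelˡ-< 2 _ _ (subst (2 + size Γ₂ <_)
  (trans (cong (_+ size Γ₂) (sym p)) (sum-size s))
  (subst (λ n → 2 + size Γ₂ < n + size Γ₂) (ℕ.+-comm 2 (suc k)) (ℕ.+-monoˡ-< (size Γ₂) (s≤s (s≤s (s≤s z≤n))))))

module Orientable where
  -- X collects the torus summands found so far, Γk is what remains.
  record State (Γ : CGraph) (n : ℕ) : Set where
    field
      {X Γk} : CGraph
      {x}    : Fin (size X)
      {y}    : Fin (size Γk)
      s      : Sum X Γk x y Γ
      {βX}   : Fin (size X) → Bool
      βX-col : Colouring X βX
      {βk}   : Fin (size Γk) → Bool
      βk-col : Colouring Γk βk
      tight  : Tight Γk
      {m}    : ℕ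
      isSum  : IsSumOf 𝒯₁ m X
      size-X : size X ≡ m * 4 + 2
      size-k : size Γk ≡ n

  opaque
    place : ∀ {Γ₂ Γk v} (s : Sum 𝒯₁ Γ₂ 0F v Γk) {β} → Colouring Γk β → ∀ κ →
            ∃[ t ] (t ≢ 0F × β (g s (inj₁ t)) ≡ κ)
    place s {β} β-col κ = case β (g s (inj₁ 1F)) 𝔹.≟ κ of λ
      { (yes p) → 1F , (λ ()) , p
      ; (no p)  → 2F , (λ ()) , trans
          (trans (cong β (sym (edge s c1 {inj₁ 1F} (off₁ (λ ())) (off₁ (λ ()))))) (β-col c1 _))
          (trans (cong not (¬-not p)) (not-involutive κ)) }

    -- X is moved onto a vertex of the new torus summand other than its connecting vertex.
    -- `sum-assoc` then regroups, and X # 𝒯₁ becomes the finished part.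
    absorb : ∀ {X Γk Γ₂ Γ x y v m} (s : Sum 𝒯₁ Γ₂ 0F v Γk) → Sum X Γk x y Γ →
             ∀ {βX} → Colouring X βX → ∀ {βk} → Colouring Γk βk → ∀ {β₂} → Colouring Γ₂ β₂ →
             Tight Γ₂ → IsSumOf 𝒯₁ m X → size X ≡ m * 4 + 2 →
             ∃[ Γ′ ] (DEquiv Γ Γ′ × size Γ ≡ size Γ′ × State Γ′ (size Γ₂))
    absorb {X} {Γk} {x = x} {y} {m = m} s r {βX} βX-col βk-col β₂-col tight₂ isSum size-X =
      case recolour {Γk} βk-col y (not (βX x)) of λ { (β , β-col , β-y) →
      case place s β-col (not (βX x)) of λ { (t , t≢ , β-t) →
      case relocate r (g s (inj₁ t)) (λ _ _ → βX , β , colouring⇒bipartition {X} βX-col ,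
             colouring⇒bipartition {Γk} β-col , opposite β-y , opposite β-t) of λ { (Γ′ , moves , r′) →
      case recolour {𝒯₁} (parity₆-col true) t (not (βX x)) of λ { (βT , βT-col , βT-t) →
      case connectedSum X 𝒯₁ x t of λ { (X′ , u) →
        Γ′ , moves , sum-size-≡ r r′ refl , record
          { s = sum-assoc s t≢ u r′
          ; βX-col = λ c → descend u not [ βX , βT ]′
              (λ { (inj₁ v) → βX-col c v ; (inj₂ v) → βT-col c v })
              λ { true → βT-t ; false → trans (sym (not-involutive _)) (cong not (sym βT-t)) }
          ; βk-col = β₂-col
          ; tight = tight₂
          ; isSum = sum isSum (one (base-iso 𝒯₁)) (x , t , Sum⇒IsConnSum u , λ _ _ →
              βX , βT , colouring⇒bipartition {X} βX-col , colouring⇒bipartition {𝒯₁} βT-col , opposite βT-t)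
          ; size-X = grow-size m 4 u size-X refl
          ; size-k = refl } } } } } }

    split : ∀ {Γ β} → Tight Γ → 3 ≤ size Γ → Colouring Γ β → Fin (size Γ) →
            ∃[ Γ₁ ] (BiRecut Γ Γ₁ × TorusSplit Γ₁)
    split tight 3≤ β-col y =
      case square-split (Tight.conn₀₁ tight) β-col (Tight.conn₂ tight true) (Tight.simple tight 3≤) y of λ
      { (Γ₁ , r , square) → let tight₁ = recut-tight (proj₁ r) tight in Γ₁ , r ,
          torus-split (Tight.conn₀₁ tight₁) (Tight.simple tight₁ (subst (3 ≤_) (recut-size (proj₁ r)) 3≤))
            (recut-colouring r) square }

    step : ∀ n → (∀ {k} → k < n → ∀ {Γ} → State Γ k → Reduces 𝒯₁ 4 Γ) → ∀ {Γ} → State Γ n → Reduces 𝒯₁ 4 Γ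
    step n rec {Γ} st = case ℕ.m≤n⇒m<n∨m≡n (2≤size Γk y) of λ
      { (inj₂ 2≡) → reduces-neutral s (sym 2≡) isSum size-X
      ; (inj₁ 3≤) → case split tight 3≤ βk-col y of λ { (Γ₁ , r₁ , split₁) → continue 3≤ r₁ split₁ } }
      where
      open State st
      continue : ∀ {Γ₁} → 3 ≤ size Γk → BiRecut Γk Γ₁ → TorusSplit Γ₁ → Reduces 𝒯₁ 4 Γ
      continue 3≤ r₁ split₁ =
        case lift-bipartite r₁ 3≤ βX-col s of λ { (Δ₁ , _ , moves₁ , s₁) →
        case lift-bipartite T.recut (subst (3 ≤_) (recut-size (proj₁ r₁)) 3≤) βX-col s₁ of λ { (Δ₂ , _ , moves₂ , s₂) →
        case absorb T.s s₂ βX-col (recut-colouring T.recut) T.β₂-col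
               (sum-tight T.s (recut-tight (proj₁ T.recut) (recut-tight (proj₁ r₁) tight))) isSum size-X of λ
        { (Γ′ , moves₃ , size-eq , st′) →
          reduces-move (moves₁ ◅◅ moves₂ ◅◅ moves₃) (trans (sum-size-≡ s s₂ size-k′) size-eq)
            (rec (subst (size T.Γ₂ <_) (trans (sym size-k′) size-k) (rest-smaller 3 T.s refl)) st′) } } }
        where
        module T = TorusSplit split₁
        size-k′ : size Γk ≡ size T.Γ′
        size-k′ = trans (recut-size (proj₁ r₁)) (recut-size (proj₁ T.recut))

    reduce : ∀ {G β} → 4 ≤ size G → Tight G → Colouring G β → Fin (size G) → Reduces 𝒯₁ 4 G
    reduce 4≤ tight β-col y = case split tight (ℕ.<⇒≤ 4≤) β-col y of λ { (Γ₁ , r , split₁) →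
      let module T = TorusSplit split₁ in
      reduces-move (recut-move (proj₁ r) ◅◅ recut-move (proj₁ T.recut))
        (trans (recut-size (proj₁ r)) (recut-size (proj₁ T.recut)))
        (<-rec (λ n → ∀ {Γ} → State Γ n → Reduces 𝒯₁ 4 Γ) step _ record
          { s = T.s; βX-col = T.β-col; βk-col = T.β₂-col
          ; tight = sum-tight T.s (recut-tight (proj₁ T.recut) (recut-tight (proj₁ r) tight))
          ; isSum = one (base-iso 𝒯₁); size-X = refl; size-k = refl }) }

module NonOrientable where
  -- Non-bipartiteness in the form that `crosscap-split` consumes: the 2-colouring of the polygon
  -- together with a chord that violates it.
  Twisted : CGraph → Set
  Twisted Γ = ∃[ β ] (Alternating Γ β × ∃[ a ] β (σ Γ c2 a) ≡ β a)

  opaque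
    dichotomy : ∀ {Γ} → Tight Γ → Fin (size Γ) → ∃ (Colouring Γ) ⊎ Twisted Γ
    dichotomy {Γ} tight r = case Fin.any? (λ a → β (σ Γ c2 a) 𝔹.≟ β a) of λ
      { (yes found) → inj₂ (β , odd-pos , found)
      ; (no none)   → inj₁ (β , λ
          { zero → odd-pos false
          ; (suc zero) → odd-pos true
          ; (suc (suc zero)) v → ¬-not (λ p → none (v , p)) }) }
      where
      open Cycle Γ r (Tight.conn₀₁ tight)
      β : Fin (size Γ) → Bool
      β = odd ∘ pos

  record CapSplit (Γ : CGraph) : Set where
    field
      {Γ′ Γ₂} : CGraph
      recuts  : Star Recut Γ Γ′
      {v}     : Fin (size Γ₂)
      s       : Sum 𝒫₁ Γ₂ 3F v Γ′
      rest    : size Γ₂ ≡ 2 ⊎ Twisted Γ₂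

  opaque
    split : ∀ {Γ} → Tight Γ → Twisted Γ → CapSplit Γ
    split {Γ} tight (β , β-alt , a , same) = first (crosscap-split (Tight.conn₀₁ tight) β-alt a same)
      where
      first : CrosscapSplit Γ a → CapSplit Γ
      first C = case ℕ.m≤n⇒m<n∨m≡n (2≤size Γ₂ (g s′ x)) of λ
        { (inj₂ 2≡) → record { recuts = recut ◅ ε; s = s₁; rest = inj₁ (sym 2≡) }
        ; (inj₁ 3≤) → case dichotomy tight₂ (g s′ x) of λ
          { (inj₂ twist) → record { recuts = recut ◅ ε; s = s₁; rest = inj₂ twist }
          ; (inj₁ (β₂ , β₂-col)) → second 3≤ β₂-col
              (crosscap-split (Tight.conn₀₁ tight₁) (twisted-alternating cap s′ β₂-col) x (twisted-chord cap s′ β₂-col)) } }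
        where
        open CrosscapSplit C
        s₁ : Sum 𝒫₁ Γ₂ 3F (g s′ x) Γ′
        s₁ = crosscap-sum cap s′
        tight₁ : Tight Γ′
        tight₁ = recut-tight recut tight
        tight₂ : Tight Γ₂
        tight₂ = sum-tight s₁ tight₁
        second : 3 ≤ size Γ₂ → ∀ {β₂} → Colouring Γ₂ β₂ → CrosscapSplit Γ′ x → CapSplit Γ
        second 3≤ β₂-col C′ = case dichotomy (sum-tight s₂ (recut-tight C′.recut tight₁)) (g C′.s′ C′.x) of λ
          { (inj₂ twist) → record { recuts = recut ◅ C′.recut ◅ ε; s = s₂; rest = inj₂ twist }
          ; (inj₁ (β₃ , β₃-col)) → ⊥-elim (dyck cap s′ (Tight.conn₂ tight₂) 3≤ β₂-col C′.s β₃-col) }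
          where
          module C′ = CrosscapSplit C′
          s₂ : Sum 𝒫₁ C′.Γ₂ 3F (g C′.s′ C′.x) C′.Γ′
          s₂ = crosscap-sum C′.cap C′.s′

  recuts-size : ∀ {Γ Γ′} → Star Recut Γ Γ′ → size Γ ≡ size Γ′
  recuts-size ε        = refl
  recuts-size (r ◅ rs) = trans (recut-size r) (recuts-size rs)

  recuts-tight : ∀ {Γ Γ′} → Star Recut Γ Γ′ → Tight Γ → Tight Γ′
  recuts-tight ε        t = t
  recuts-tight (r ◅ rs) t = recuts-tight rs (recut-tight r t)

  recuts-moves : ∀ {Γ Γ′} → Star Recut Γ Γ′ → DEquiv Γ Γ′
  recuts-moves ε        = ε
  recuts-moves (r ◅ rs) = recut-move r ◅◅ recuts-moves rs

  no-odd-cycle : {p q r : Bool} → p ≢ q → q ≢ r → p ≢ r → ⊥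
  no-odd-cycle p≢q q≢r p≢r = p≢r (trans (¬-not p≢q) (sym (¬-not (q≢r ∘ sym))))

  𝒫₁-nonbipartite : ¬ Bipartite 𝒫₁
  𝒫₁-nonbipartite (β , bip) = no-odd-cycle (bip c2 2F) (bip c0 3F) (bip c1 3F)

  -- The sum is taken at v₁ of 𝒫₁, so the triangle v₂v₃v₄ survives.
  sum-nonbipartite : ∀ {X X′ x} → Sum X 𝒫₁ x 0F X′ → ¬ Bipartite X′
  sum-nonbipartite {X′ = X′} u (β , bip) = no-odd-cycle
    (along c2 1F 2F refl (λ ()) (λ ())) (along c0 2F 3F refl (λ ()) (λ ())) (along c1 1F 3F refl (λ ()) (λ ()))
    where
    along : ∀ c i j → K4-σ c j ≡ i → i ≢ 0F → j ≢ 0F → β (g u (inj₂ i)) ≢ β (g u (inj₂ j))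
    along c i j refl i≢ j≢ p = bip c _ (trans (cong β (edge u c (off₂ j≢) (off₂ i≢))) p)

  record State (Γ : CGraph) (n : ℕ) : Set where
    field
      {X Γk} : CGraph
      {x}    : Fin (size X)
      {y}    : Fin (size Γk)
      s      : Sum X Γk x y Γ
      ¬bip   : ¬ Bipartite X
      tight  : Tight Γk
      rest   : size Γk ≡ 2 ⊎ Twisted Γk
      {m}    : ℕ
      isSum  : IsSumOf 𝒫₁ m X
      size-X : size X ≡ m * 2 + 2
      size-k : size Γk ≡ n

  opaque
    absorb : ∀ {X Γk Γ₂ Γ x y v m} (s : Sum 𝒫₁ Γ₂ 3F v Γk) → Sum X Γk x y Γ → ¬ Bipartite X →
             Tight Γ₂ → size Γ₂ ≡ 2 ⊎ Twisted Γ₂ → IsSumOf 𝒫₁ m X → size X ≡ m * 2 + 2 →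
             ∃[ Γ′ ] (DEquiv Γ Γ′ × size Γ ≡ size Γ′ × State Γ′ (size Γ₂))
    absorb {X} {x = x} {m = m} s r ¬bip tight₂ rest isSum size-X =
      case relocate r (g s (inj₁ 0F)) (λ bip → contradiction bip ¬bip) of λ { (Γ′ , moves , r′) →
      case connectedSum X 𝒫₁ x 0F of λ { (X′ , u) →
        Γ′ , moves , sum-size-≡ r r′ refl , record
          { s = sum-assoc s (λ ()) u r′
          ; ¬bip = sum-nonbipartite u
          ; tight = tight₂
          ; rest = rest
          ; isSum = sum isSum (one (base-iso 𝒫₁)) (x , 0F , Sum⇒IsConnSum u , λ bip → contradiction bip ¬bip)
          ; size-X = grow-size m 2 u size-X refl
          ; size-k = refl } } }

    step : ∀ n → (∀ {k} → k < n → ∀ {Γ} → State Γ k → Reduces 𝒫₁ 2 Γ) → ∀ {Γ} → State Γ n → Reduces 𝒫₁ 2 Γ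
    step n rec {Γ} st = case rest of λ
      { (inj₁ 2≡) → reduces-neutral s 2≡ isSum size-X
      ; (inj₂ twist) → continue (split tight twist) }
      where
      open State st
      continue : CapSplit Γk → Reduces 𝒫₁ 2 Γ
      continue C =
        case lift-moves C.recuts 3≤ ¬bip s of λ { (Δ , _ , moves₁ , s₁) →
        case absorb C.s s₁ ¬bip (sum-tight C.s (recuts-tight C.recuts tight)) C.rest isSum size-X of λ
        { (Γ′ , moves₂ , size-eq , st′) →
          reduces-move (moves₁ ◅◅ moves₂) (trans (sum-size-≡ s s₁ size-k′) size-eq)
            (rec (subst (size C.Γ₂ <_) (trans (sym size-k′) size-k) smaller) st′) } }
        where
        module C = CapSplit C
        size-k′ : size Γk ≡ size C.Γ′
        size-k′ = recuts-size C.recuts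
        smaller : size C.Γ₂ < size C.Γ′
        smaller = rest-smaller 1 C.s refl
        3≤ : 3 ≤ size Γk
        3≤ = subst (3 ≤_) (sym size-k′) (ℕ.≤-trans (s≤s (2≤size C.Γ₂ C.v)) smaller)

    reduce : ∀ {G} → Tight G → Twisted G → Reduces 𝒫₁ 2 G
    reduce {G} tight twist = start (split tight twist)
      where
      start : CapSplit G → Reduces 𝒫₁ 2 G
      start C = reduces-move (recuts-moves C.recuts) (recuts-size C.recuts)
        (<-rec (λ n → ∀ {Γ} → State Γ n → Reduces 𝒫₁ 2 Γ) step _ record
          { s = C.s; ¬bip = 𝒫₁-nonbipartite; tight = sum-tight C.s (recuts-tight C.recuts tight)
          ; rest = C.rest; isSum = one (base-iso 𝒫₁); size-X = refl; size-k = refl })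
        where module C = CapSplit C

-- Classification and vertex count

classification : (G : CGraph) → 4 ≤ size G → Contracted G → Reduces 𝒫₁ 2 G ⊎ Reduces 𝒯₁ 4 G
classification G 4≤ con = case NonOrientable.dichotomy tight r of λ
  { (inj₁ (β , β-col)) → inj₂ (Orientable.reduce 4≤ tight β-col r)
  ; (inj₂ twist)       → inj₁ (NonOrientable.reduce tight twist) }
  where
  tight : Tight G
  tight = contracted⇒tight con
  r : Fin (size G)
  r = Fin.fromℕ< (ℕ.≤-trans (s≤s z≤n) 4≤)

-- The number k of summands is read off the size, which is 2k + 2 for copies of 𝒫₁ and 4k + 2 for
-- copies of 𝒯₁. The latter is never divisible by 4, so only 𝒫₁ occurs when the size is 4m.
theorem1p1 : (G : CGraph) → 4 ≤ size G → Contracted G →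
    ((m : ℕ) → 1 ≤ m → size G ≡ 4 * m → DEquivToP G (2 * m ∸ 1)) ×
    ((m : ℕ) → 1 ≤ m → size G ≡ 4 * m + 2 → DEquivToP G (2 * m) ⊎ DEquivToT G m)
theorem1p1 G 4≤ contracted = case classification G 4≤ contracted of λ
  { (inj₁ (Δ , k , isSum , moves , p)) →
      (λ m 1≤m q → Δ , subst (λ n → IsSumOf 𝒫₁ n Δ) (projective-even k m 1≤m (trans (sym p) q)) isSum , moves) ,
      (λ m 1≤m q → inj₁ (Δ , subst (λ n → IsSumOf 𝒫₁ n Δ) (projective-odd k m (trans (sym p) q)) isSum , moves))
  ; (inj₂ (Δ , k , isSum , moves , p)) →
      (λ m 1≤m q → contradiction (trans (sym p) q) (torus-≢ k m)) ,
      (λ m 1≤m q → inj₂ (Δ , subst (λ n → IsSumOf 𝒯₁ n Δ) (torus-≡ k m (trans (sym p) q)) isSum , moves)) }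
  where
  open +-*-Solver
  projective-even : ∀ k m → 1 ≤ m → k * 2 + 2 ≡ 4 * m → k ≡ 2 * m ∸ 1
  projective-even k (suc m) _ p = ℕ.suc-injective (ℕ.*-cancelʳ-≡ _ _ 2
    (trans (solve 1 (λ k → (con 1 :+ k) :* con 2 := k :* con 2 :+ con 2) refl k)
    (trans p (solve 1 (λ m → con 4 :* (con 1 :+ m) := (con 2 :* (con 1 :+ m)) :* con 2) refl m))))

  projective-odd : ∀ k m → k * 2 + 2 ≡ 4 * m + 2 → k ≡ 2 * m
  projective-odd k m p = ℕ.*-cancelʳ-≡ _ _ 2
    (trans (ℕ.+-cancelʳ-≡ 2 _ _ p) (solve 1 (λ m → con 4 :* m := (con 2 :* m) :* con 2) refl m))

  torus-≡ : ∀ k m → k * 4 + 2 ≡ 4 * m + 2 → k ≡ m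
  torus-≡ k m p = ℕ.*-cancelʳ-≡ _ _ 4 (trans (ℕ.+-cancelʳ-≡ 2 _ _ p) (ℕ.*-comm 4 m))

  torus-≢ : ∀ k m → k * 4 + 2 ≢ 4 * m
  torus-≢ k m p = case trans (sym (cong not (odd-double k))) (trans (cong odd halved) (odd-double m)) of λ ()
    where
    halved : suc (k + k) ≡ m + m
    halved = ℕ.*-cancelʳ-≡ _ _ 2
      (trans (solve 1 (λ k → (con 1 :+ (k :+ k)) :* con 2 := k :* con 4 :+ con 2) refl k)
      (trans p (solve 1 (λ m → con 4 :* m := (m :+ m) :* con 2) refl m)))
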